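{- Let $q$ be a prime power and let $n\ge3$ be odd. Let $U$ be a subset of $H_n(\mathbb{F}_{q^2})$ such that $\mathrm{rank}(x-y)\le 2$ for all $x,y\in U$. Then $|U|\le q^{2n-1}+q^n-q^{n-1}$, and if equality holds, then for every $A\in U$ the set $\{A-B : B\in U\}$ is a constant rank-distance $2$ set.
   Context: $H_n(\mathbb{F}_{q^2})$ is the set of $n\times n$ hermitian matrices over $\mathbb{F}_{q^2}$ (matrices $A$ with $\overline{A}^T=A$, $\overline{\cdot}$ being $x\mapsto x^q$ entrywise). A constant rank-distance $k$ set is a set $U$ of $n\times n$ matrices with $\mathrm{rank}(A-B)=k$ for all distinct $A,B\in U$ and $\mathrm{rank}(A)=k$ for all nonzero $A\in U$. -}

module Defs where

open import Level using (Level)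
open import Data.Nat as ℕ using (ℕ; zero)
open import Data.Fin using (Fin; zero) renaming (suc to fsuc)
open import Data.Product using (Σ; ∃; _×_; _,_)
open import Data.List using (List; map)
open import Data.List.Membership.Propositional using (_∈_)
open import Relation.Nullary using (¬_)
open import Relation.Binary.PropositionalEquality using (_≡_; _≢_)
open import Algebra.Structures using (IsCommutativeRing)
open import Data.Nat.Primality using (Prime)

record Field (c : Level) : Set (Level.suc c) where
  infixl 6 _+_
  infixl 7 _*_
  field
    Carrier : Set c
    _+_ _*_ : Carrier → Carrier → Carrier
    -_ : Carrier → Carrier
    0# 1# : Carrier
    isCommutativeRing : IsCommutativeRing _≡_ _+_ _*_ -_ 0# 1#
    0≢1 : 0# ≢ 1#
    inverse : ∀ x → x ≢ 0# → ∃ λ y → x * y ≡ 1#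

  _^_ : Carrier → ℕ → Carrier
  x ^ zero = 1#
  x ^ ℕ.suc k = x * (x ^ k)

  ∑ : ∀ {n} → (Fin n → Carrier) → Carrier
  ∑ {zero} f = 0#
  ∑ {ℕ.suc n} f = f zero + ∑ (λ i → f (fsuc i))

IsPrimePower : ℕ → Set
IsPrimePower q = ∃ λ p → ∃ λ k → Prime p × 1 ℕ.≤ k × q ≡ p ℕ.^ k

module Matrices {c} (F : Field c) where
  open Field F

  Mat : ℕ → Set c
  Mat n = Fin n → Fin n → Carrier

  _≋_ : ∀ {n} → Mat n → Mat n → Set c
  A ≋ B = ∀ i j → A i j ≡ B i j

  _-ᴹ_ : ∀ {n} → Mat n → Mat n → Mat n
  (A -ᴹ B) i j = A i j + (- B i j)

  0ᴹ : ∀ {n} → Mat n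
  0ᴹ i j = 0#

  -- hermitian w.r.t. the conjugation x ↦ x^q (F = F_{q^2})
  Hermitian : ℕ → ∀ {n} → Mat n → Set c
  Hermitian q A = ∀ i j → (A j i) ^ q ≡ A i j

  ColumnsIndependent : ∀ {n k} → Mat n → (Fin k → Fin n) → Set c
  ColumnsIndependent A f =
    ∀ (a : Fin _ → Carrier) → (∀ i → ∑ (λ j → a j * A i (f j)) ≡ 0#) → ∀ j → a j ≡ 0#

  RankAtMost : ∀ {n} → Mat n → ℕ → Set c
  RankAtMost A k = ∀ (f : Fin (ℕ.suc k) → Fin _) → ¬ ColumnsIndependent A f

  HasRank : ∀ {n} → Mat n → ℕ → Set c
  HasRank A k = RankAtMost A k × (Σ (Fin k → Fin _) λ f → ColumnsIndependent A f)

  ConstantRankDistance : ∀ {n} → ℕ → List (Mat n) → Set c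
  ConstantRankDistance k V =
    (∀ {A B} → A ∈ V → B ∈ V → ¬ (A ≋ B) → HasRank (A -ᴹ B) k)
    × (∀ {A} → A ∈ V → ¬ (A ≋ 0ᴹ) → HasRank A k)

{-# OPTIONS --safe #-}
-- Pair hermitian matrices by φ_B(X) = Σ X_kl B_kl. For a nonsingular hermitian B the q values taken by φ_B on U
-- collide at least |U|²/q times (Cauchy-Schwarz). Summing over all nonsingular B gives
-- v |U|² ≤ q Σ_{A,A' ∈ U} c(A - A'), where v is the number of such B and c(X) the number of those with φ_B(X) = 0.
-- Congruence acts transitively on nonzero vectors and on independent pairs, so c(X) depends only on the rank of X;
-- for ranks one and two it is found by counting the isotropic vectors of the forms b and M ⊗ b with M of size two.
-- A nondegenerate form of dimension d has Gauss sum (-q)^d: its square is q^2d, and it is 1 mod q + 1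
-- because isotropic vectors come in lines. For odd n one gets c(rank 1) < c(rank 2), and the inequality
-- becomes |U| ≤ q^(2n-1) + q^n - q^(n-1), strict as soon as some difference has rank one.
module Submission where

open import Defs
open import Level using (Level)
open import Algebra.Bundles using (CommutativeMonoid; CommutativeRing)
import Algebra.Properties.CommutativeMonoid.Sum as MonoidSum
import Algebra.Properties.CommutativeSemiring.Binomial as Binomial
import Algebra.Properties.CommutativeSemiring.Exp as Exp
import Algebra.Properties.Ring as RingProperties
import Algebra.Properties.Semiring.Mult as Mult
import Algebra.Properties.Semiring.Mult.TCOptimised as OptimisedMult
import Algebra.Solver.Ring as RingSolver
open import Algebra.Solver.Ring.AlmostCommutativeRing using (fromCommutativeRing; _-Raw-AlmostCommutative⟶_)
open import Data.Fin.Base as Fin using (Fin; toℕ)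
open import Data.Fin.Permutation using (Permutation; permutation)
import Data.Fin.Properties as Fin
open import Data.Integer.Base as ℤ using (ℤ; -[1+_]; _⊖_; 0ℤ; 1ℤ) renaming (+_ to pos)
import Data.Integer.Properties as ℤ
open import Data.Integer.Solver using () renaming (module +-*-Solver to ℤ-Solver)
open import Data.List.Base as List using (List; []; _∷_)
open import Data.List.Membership.Propositional using (_∈_)
open import Data.List.Membership.Propositional.Properties using (∈-map⁻)
open import Data.List.Relation.Unary.All as All using (All; []; _∷_)
open import Data.List.Relation.Unary.AllPairs using (AllPairs; []; _∷_)
open import Data.List.Relation.Unary.Any using (here; there)
open import Data.Maybe.Base using (Maybe; just; nothing)
open import Data.Nat.Base as ℕ using (ℕ; zero; suc)
open import Data.Nat.Combinatorics using (_C_; nCk+nC[k+1]≡[n+1]C[k+1]; k>n⇒nCk≡0; nCn≡1; nC1≡n)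
open import Data.Nat.Divisibility using (_∣_; divides; ∣⇒≤)
open import Data.Nat.Primality using (Prime; euclidsLemma; prime⇒nonTrivial)
import Data.Nat.Properties as ℕ
open import Data.Nat.Solver using () renaming (module +-*-Solver to ℕ-Solver)
open import Data.Product using (Σ; ∃; _×_; _,_; proj₁; proj₂)
open import Data.Sum using (_⊎_; inj₁; inj₂)
open import Data.Vec.Base as Vec using (Vec; []; _∷_)
open import Function.Bundles using (_↔_; Inverse)
open import Relation.Binary.Definitions using (DecidableEquality)
open import Relation.Binary.PropositionalEquality
open import Relation.Nullary using (¬_; Dec; yes; no; contradiction; ¬?)
open import Relation.Nullary.Decidable using (decidable-stable; _×-dec_; _→-dec_)

-- The kernel q c(X - Y) - v is positive semidefinite on hermitian matrices. The usual reason is a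
-- computation with additive characters; the collision count proves it inside the integers. Its
-- diagonal value is (q - 1)v and its value at rank two is -vW/D in the notation of
-- `BoundArithmetic`, so a set whose differences all have rank two has at most 1 + (q - 1)D/W = β
-- elements. Differences of rank one are not excluded; it is enough that they contribute less than
-- those of rank two. That is the sign of R, and it decides the parity: for even n one would have m
-- = -q^(n-1) and R negative. Nothing is diagonalised. A hermitian X of rank two is S* M S with M a
-- principal submatrix of size two, so M is an arbitrary nonsingular hermitian matrix and the count
-- has to be shown independent of it. Besides the zeros of M ⊗ b, M enters only through its
-- isotropic points on the projective line, and their number comes from the general formula in
-- dimension one, where no independent pairs exist. Division is avoided: counts stay multiplied by q
-- or by D.

-- Integer sums over lists and enumerations of finite types.

module FiniteSums where
  open import Data.Integer.Base using (_+_; _*_; _-_; -_; _≤_; _<_; +≤+)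
  open import Data.Integer.Properties hiding (_≟_)
  open import Data.List.Base using (_++_; map; tabulate; length; cartesianProductWith)
  open ℤ-Solver

  private variable
    a b : Level
    A : Set a
    B : Set b

  -- Integer-valued, because Gauss sums are signed and counts are subtracted freely.
  𝟙 : {P : Set a} → Dec P → ℤ
  𝟙 (yes _) = 1ℤ
  𝟙 (no _) = 0ℤ

  𝟙-yes : {P : Set a} (d : Dec P) → P → 𝟙 d ≡ 1ℤ
  𝟙-yes (yes _) p = refl
  𝟙-yes (no ¬p) p = contradiction p ¬p

  𝟙-no : {P : Set a} (d : Dec P) → ¬ P → 𝟙 d ≡ 0ℤ
  𝟙-no (yes p) ¬p = contradiction p ¬p
  𝟙-no (no _) ¬p = refl

  𝟙-cong : {P : Set a} {Q : Set b} (d : Dec P) (e : Dec Q) → (P → Q) → (Q → P) → 𝟙 d ≡ 𝟙 e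
  𝟙-cong (yes p) e f g = sym (𝟙-yes e (f p))
  𝟙-cong (no ¬p) e f g = sym (𝟙-no e (λ q → ¬p (g q)))

  𝟙-≥0 : {P : Set a} (d : Dec P) → 0ℤ ≤ 𝟙 d
  𝟙-≥0 (yes _) = +≤+ ℕ.z≤n
  𝟙-≥0 (no _) = +≤+ ℕ.z≤n

  *-≥0 : ∀ {i j} → 0ℤ ≤ i → 0ℤ ≤ j → 0ℤ ≤ i * j
  *-≥0 {i} {j} (+≤+ {n = m} _) (+≤+ {n = n} _) = subst (0ℤ ≤_) (pos-* m n) (+≤+ ℕ.z≤n)

  *->0 : ∀ {i j} → 0ℤ < i → 0ℤ < j → 0ℤ < i * j
  *->0 {i} {j} 0<i 0<j = subst (_< i * j) (*-zeroʳ i) (*-monoˡ-<-pos i {{ℤ.positive 0<i}} 0<j)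

  sumOver : List A → (A → ℤ) → ℤ
  sumOver [] f = 0ℤ
  sumOver (x ∷ xs) f = f x + sumOver xs f

  sum-cong : (xs : List A) {f g : A → ℤ} → (∀ x → f x ≡ g x) → sumOver xs f ≡ sumOver xs g
  sum-cong [] e = refl
  sum-cong (x ∷ xs) e = cong₂ _+_ (e x) (sum-cong xs e)

  sum-cong-∈ : (xs : List A) {f g : A → ℤ} → (∀ {x} → x ∈ xs → f x ≡ g x) → sumOver xs f ≡ sumOver xs g
  sum-cong-∈ [] e = refl
  sum-cong-∈ (x ∷ xs) e = cong₂ _+_ (e (here refl)) (sum-cong-∈ xs (λ x∈ → e (there x∈)))

  sum-+ : (xs : List A) (f g : A → ℤ) → sumOver xs (λ x → f x + g x) ≡ sumOver xs f + sumOver xs g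
  sum-+ [] f g = refl
  sum-+ (x ∷ xs) f g rewrite sum-+ xs f g =
    solve 4 (λ s t u v → (s :+ t) :+ (u :+ v) := (s :+ u) :+ (t :+ v)) refl
      (f x) (g x) (sumOver xs f) (sumOver xs g)

  sum-*ˡ : (xs : List A) (c : ℤ) (f : A → ℤ) → sumOver xs (λ x → c * f x) ≡ c * sumOver xs f
  sum-*ˡ [] c f = sym (*-zeroʳ c)
  sum-*ˡ (x ∷ xs) c f rewrite sum-*ˡ xs c f = sym (*-distribˡ-+ c (f x) (sumOver xs f))

  sum-*ʳ : (xs : List A) (c : ℤ) (f : A → ℤ) → sumOver xs (λ x → f x * c) ≡ sumOver xs f * c
  sum-*ʳ xs c f = trans (sum-cong xs (λ x → *-comm (f x) c)) (trans (sum-*ˡ xs c f) (*-comm c _))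

  sum-minus : (xs : List A) (f g : A → ℤ) → sumOver xs (λ x → f x - g x) ≡ sumOver xs f - sumOver xs g
  sum-minus [] f g = refl
  sum-minus (x ∷ xs) f g rewrite sum-minus xs f g =
    solve 4 (λ s t u v → (s :- t) :+ (u :- v) := (s :+ u) :- (t :+ v)) refl
      (f x) (g x) (sumOver xs f) (sumOver xs g)

  sum-zero : (xs : List A) → sumOver xs (λ _ → 0ℤ) ≡ 0ℤ
  sum-zero [] = refl
  sum-zero (x ∷ xs) = trans (+-identityˡ _) (sum-zero xs)

  sum-const : (xs : List A) (c : ℤ) → sumOver xs (λ _ → c) ≡ sumOver xs (λ _ → 1ℤ) * c
  sum-const xs c = trans (sum-cong xs (λ _ → sym (*-identityˡ c))) (sum-*ʳ xs c (λ _ → 1ℤ))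

  sum-length : (xs : List A) → sumOver xs (λ _ → 1ℤ) ≡ pos (length xs)
  sum-length [] = refl
  sum-length (x ∷ xs) = cong (1ℤ +_) (sum-length xs)

  sum-swap : (xs : List A) (ys : List B) (f : A → B → ℤ) →
    sumOver xs (λ x → sumOver ys (f x)) ≡ sumOver ys (λ y → sumOver xs (λ x → f x y))
  sum-swap [] ys f = sym (sum-zero ys)
  sum-swap (x ∷ xs) ys f = trans (cong (sumOver ys (f x) +_) (sum-swap xs ys f))
                                 (sym (sum-+ ys (f x) _))

  sum-mono : (xs : List A) {f g : A → ℤ} → (∀ {x} → x ∈ xs → f x ≤ g x) → sumOver xs f ≤ sumOver xs g
  sum-mono [] le = ≤-refl
  sum-mono (x ∷ xs) le = +-mono-≤ (le (here refl)) (sum-mono xs (λ x∈ → le (there x∈)))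

  sum-≥0 : (xs : List A) {f : A → ℤ} → (∀ {x} → x ∈ xs → 0ℤ ≤ f x) → 0ℤ ≤ sumOver xs f
  sum-≥0 xs {f} le = subst (_≤ sumOver xs f) (sum-zero xs) (sum-mono xs le)

  -- The source of every equality argument: a total with no room left forces each nonnegative term
  -- to vanish.
  sum≡0⇒≡0 : (xs : List A) {f : A → ℤ} → (∀ {x} → x ∈ xs → 0ℤ ≤ f x) → sumOver xs f ≤ 0ℤ →
    ∀ {x} → x ∈ xs → f x ≡ 0ℤ
  sum≡0⇒≡0 (x ∷ xs) {f} le s≤0 (here refl) = ≤-antisym fx≤0 (le (here refl))
    where
    fx≤0 : f x ≤ 0ℤ
    fx≤0 = ≤-trans (subst (_≤ f x + sumOver xs f) (+-identityʳ (f x))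
             (+-monoʳ-≤ (f x) (sum-≥0 xs (λ x∈ → le (there x∈))))) s≤0
  sum≡0⇒≡0 (x ∷ xs) {f} le s≤0 (there y∈) = sum≡0⇒≡0 xs (λ x∈ → le (there x∈)) tail≤0 y∈
    where
    tail≤0 : sumOver xs f ≤ 0ℤ
    tail≤0 = ≤-trans (subst (_≤ f x + sumOver xs f) (+-identityˡ (sumOver xs f))
               (+-monoˡ-≤ (sumOver xs f) (le (here refl)))) s≤0

  sum-++ : (xs ys : List A) (f : A → ℤ) → sumOver (xs ++ ys) f ≡ sumOver xs f + sumOver ys f
  sum-++ [] ys f = sym (+-identityˡ _)
  sum-++ (x ∷ xs) ys f = trans (cong (f x +_) (sum-++ xs ys f)) (sym (+-assoc (f x) _ _))

  sum-map : (g : A → B) (xs : List A) (f : B → ℤ) → sumOver (map g xs) f ≡ sumOver xs (λ x → f (g x))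
  sum-map g [] f = refl
  sum-map g (x ∷ xs) f = cong (f (g x) +_) (sum-map g xs f)

  sum-cartesian : ∀ {c} {C : Set c} (g : A → B → C) (xs : List A) (ys : List B) (f : C → ℤ) →
    sumOver (cartesianProductWith g xs ys) f ≡ sumOver xs (λ x → sumOver ys (λ y → f (g x y)))
  sum-cartesian g [] ys f = refl
  sum-cartesian g (x ∷ xs) ys f = trans (sum-++ (map (g x) ys) _ f)
    (cong₂ _+_ (sum-map (g x) ys f) (sum-cartesian g xs ys f))

  -- Completeness and absence of repetitions form the single condition `count`, stated as a sum of
  -- indicators so that it can be inserted directly into double counts.
  record Enumeration (A : Set a) : Set a where
    infix 4 _≟_
    field
      list : List A
      _≟_ : DecidableEquality A
      count : ∀ x → sumOver list (λ y → 𝟙 (y ≟ x)) ≡ 1ℤ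

    ∑ᴱ : (A → ℤ) → ℤ
    ∑ᴱ = sumOver list

    card : ℤ
    card = ∑ᴱ (λ _ → 1ℤ)

    δ*≡ : ∀ x y (f : A → ℤ) → 𝟙 (y ≟ x) * f y ≡ 𝟙 (y ≟ x) * f x
    δ*≡ x y f with y ≟ x
    ... | yes refl = refl
    ... | no _ = refl

    ∑-δ : ∀ x (f : A → ℤ) → ∑ᴱ (λ y → 𝟙 (y ≟ x) * f y) ≡ f x
    ∑-δ x f = trans (sum-cong list (λ y → δ*≡ x y f))
      (trans (sum-*ʳ list (f x) _) (trans (cong (_* f x) (count x)) (*-identityˡ (f x))))

    ∈list : ∀ x → x ∈ list
    ∈list x = member list λ z → contradiction (trans (sym (count x)) z) (λ ())
      where
      member : ∀ xs → ¬ (sumOver xs (λ y → 𝟙 (y ≟ x)) ≡ 0ℤ) → x ∈ xs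
      member [] s≢0 = contradiction refl s≢0
      member (y ∷ xs) s≢0 with y ≟ x
      ... | yes refl = here refl
      ... | no _ = there (member xs λ z → s≢0 (trans (+-identityˡ _) z))

    search : ∀ {p} {P : A → Set p} → (∀ x → Dec (P x)) → (∀ x → P x) ⊎ ∃ λ x → ¬ P x
    search {P = P} P? = go list (λ p x → All.lookup p (∈list x))
      where
      go : ∀ xs → (All P xs → ∀ x → P x) → (∀ x → P x) ⊎ ∃ λ x → ¬ P x
      go [] k = inj₁ (k [])
      go (x ∷ xs) k with P? x
      ... | yes p = go xs (λ ps → k (p ∷ ps))
      ... | no ¬p = inj₂ (x , ¬p)

    ∀? : ∀ {p} {P : A → Set p} → (∀ x → Dec (P x)) → Dec (∀ x → P x)
    ∀? P? with search P?
    ... | inj₁ all = yes all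
    ... | inj₂ (x , ¬p) = no λ all → ¬p (all x)

  -- The two lists may be ordered differently, so `f (φ x)` is expanded into a delta sum over B and
  -- the order of summation is exchanged.
  ∑-bijection : (EA : Enumeration A) (EB : Enumeration B) (φ : A → B) (ψ : B → A) →
    (∀ x → ψ (φ x) ≡ x) → (∀ y → φ (ψ y) ≡ y) → (f : B → ℤ) →
    Enumeration.∑ᴱ EA (λ x → f (φ x)) ≡ Enumeration.∑ᴱ EB f
  ∑-bijection EA EB φ ψ ψφ φψ f = begin
    EA.∑ᴱ (λ x → f (φ x))
      ≡⟨ sum-cong EA.list (λ x → EB.∑-δ (φ x) f) ⟨
    EA.∑ᴱ (λ x → EB.∑ᴱ (λ y → 𝟙 (y EB.≟ φ x) * f y))
      ≡⟨ sum-swap EA.list EB.list _ ⟩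
    EB.∑ᴱ (λ y → EA.∑ᴱ (λ x → 𝟙 (y EB.≟ φ x) * f y))
      ≡⟨ sum-cong EB.list (λ y → trans (sum-*ʳ EA.list (f y) _)
           (trans (cong (_* f y) (trans (sum-cong EA.list (λ x →
             𝟙-cong (y EB.≟ φ x) (x EA.≟ ψ y)
               (λ e → trans (sym (ψφ x)) (cong ψ (sym e)))
               (λ e → trans (sym (φψ y)) (cong φ (sym e)))))
             (EA.count (ψ y)))) (*-identityˡ (f y)))) ⟩
    EB.∑ᴱ f ∎
    where
    open ≡-Reasoning
    module EA = Enumeration EA
    module EB = Enumeration EB

  ↔⇒Enumeration : ∀ {N} → A ↔ Fin N → Enumeration A
  ↔⇒Enumeration {A = A} {N} iso = record
    { list = tabulate from
    ; _≟_ = _≟_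
    ; count = λ x → trans
        (sum-cong (tabulate from) (λ y → 𝟙-cong (y ≟ x) (y ≟ from (to x))
          (λ e → trans e (sym (strictlyInverseʳ x))) (λ e → trans e (strictlyInverseʳ x))))
        (once from (λ {i} {j} e → trans (sym (strictlyInverseˡ i)) (trans (cong to e) (strictlyInverseˡ j))) (to x))
    }
    where
    open Inverse iso
    _≟_ : DecidableEquality A
    x ≟ y with to x Fin.≟ to y
    ... | yes e = yes (trans (sym (strictlyInverseʳ x)) (trans (cong from e) (strictlyInverseʳ y)))
    ... | no ne = no λ e → ne (cong to e)
    none : ∀ {n} (g : Fin n → A) x → (∀ i → ¬ (g i ≡ x)) → sumOver (tabulate g) (λ y → 𝟙 (y ≟ x)) ≡ 0ℤ
    none {zero} g x ne = refl
    none {suc n} g x ne = cong₂ _+_ (𝟙-no (g Fin.zero ≟ x) (ne Fin.zero))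
                                    (none (λ i → g (Fin.suc i)) x (λ i → ne (Fin.suc i)))
    once : ∀ {n} (g : Fin n → A) → (∀ {i j} → g i ≡ g j → i ≡ j) → ∀ i →
      sumOver (tabulate g) (λ y → 𝟙 (y ≟ g i)) ≡ 1ℤ
    once g inj Fin.zero = cong₂ _+_ (𝟙-yes (g Fin.zero ≟ g Fin.zero) refl)
      (none (λ i → g (Fin.suc i)) (g Fin.zero) λ i e → Fin.0≢1+n (sym (inj e)))
    once g inj (Fin.suc i) = cong₂ _+_ (𝟙-no (g Fin.zero ≟ g (Fin.suc i)) (λ e → Fin.0≢1+n (inj e)))
      (once (λ i → g (Fin.suc i)) (λ e → Fin.suc-injective (inj e)) i)

  tabulate-card : ∀ {n} (g : Fin n → A) → sumOver (tabulate g) (λ _ → 1ℤ) ≡ pos n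
  tabulate-card {n = zero} g = refl
  tabulate-card {n = suc n} g = cong (1ℤ +_) (tabulate-card (λ i → g (Fin.suc i)))

  ↔⇒card : ∀ {N} (iso : A ↔ Fin N) → Enumeration.card (↔⇒Enumeration iso) ≡ pos N
  ↔⇒card iso = tabulate-card (Inverse.from iso)

  module _ (EA : Enumeration A) (EB : Enumeration B) where
    private
      module EA = Enumeration EA
      module EB = Enumeration EB

    ×-Enumeration : Enumeration (A × B)
    ×-Enumeration = record
      { list = cartesianProductWith _,_ EA.list EB.list
      ; _≟_ = _≟_
      ; count = λ (x , y) → begin
          sumOver (cartesianProductWith _,_ EA.list EB.list) (λ p → 𝟙 (p ≟ (x , y)))
            ≡⟨ sum-cartesian _,_ EA.list EB.list _ ⟩
          EA.∑ᴱ (λ x′ → EB.∑ᴱ (λ y′ → 𝟙 ((x′ , y′) ≟ (x , y))))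
            ≡⟨ sum-cong EA.list (λ x′ → trans (sum-cong EB.list (λ y′ → split x′ y′ x y))
                 (trans (sum-*ˡ EB.list (𝟙 (x′ EA.≟ x)) _) (cong (𝟙 (x′ EA.≟ x) *_) (EB.count y)))) ⟩
          EA.∑ᴱ (λ x′ → 𝟙 (x′ EA.≟ x) * 1ℤ)
            ≡⟨ EA.∑-δ x (λ _ → 1ℤ) ⟩
          1ℤ ∎
      }
      where
      open ≡-Reasoning
      _≟_ : DecidableEquality (A × B)
      (x , y) ≟ (x′ , y′) with x EA.≟ x′ | y EB.≟ y′
      ... | yes refl | yes refl = yes refl
      ... | no ne | _ = no λ e → ne (cong proj₁ e)
      ... | yes refl | no ne = no λ e → ne (cong proj₂ e)
      split : ∀ x′ y′ x y → 𝟙 ((x′ , y′) ≟ (x , y)) ≡ 𝟙 (x′ EA.≟ x) * 𝟙 (y′ EB.≟ y)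
      split x′ y′ x y with x′ EA.≟ x | y′ EB.≟ y
      ... | yes refl | yes refl = refl
      ... | no ne | _ = refl
      ... | yes refl | no ne = refl

    ∑-× : (f : A × B → ℤ) →
      Enumeration.∑ᴱ ×-Enumeration f ≡ EA.∑ᴱ (λ x → EB.∑ᴱ (λ y → f (x , y)))
    ∑-× = sum-cartesian _,_ EA.list EB.list

    ×-card : Enumeration.card ×-Enumeration ≡ EA.card * EB.card
    ×-card = trans (∑-× (λ _ → 1ℤ)) (sum-const EA.list EB.card)

  retract-Enumeration : (EA : Enumeration A) (φ : A → B) (ψ : B → A) →
    (∀ x → ψ (φ x) ≡ x) → (∀ y → φ (ψ y) ≡ y) → Enumeration B
  retract-Enumeration {B = B} EA φ ψ ψφ φψ = record
    { list = map φ EA.list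
    ; _≟_ = _≟_
    ; count = λ y → trans (sum-map φ EA.list _)
        (trans (sum-cong EA.list (λ x → 𝟙-cong (φ x ≟ y) (x EA.≟ ψ y)
          (λ e → trans (sym (ψφ x)) (cong ψ e)) (λ e → trans (cong φ e) (φψ y))))
        (EA.count (ψ y)))
    }
    where
    module EA = Enumeration EA
    _≟_ : DecidableEquality B
    x ≟ y with ψ x EA.≟ ψ y
    ... | yes e = yes (trans (sym (φψ x)) (trans (cong φ e) (φψ y)))
    ... | no ne = no λ e → ne (cong ψ e)

  Vec-Enumeration : Enumeration A → ∀ n → Enumeration (Vec A n)
  Vec-Enumeration {A = A} EA zero = record
    { list = [] ∷ []
    ; _≟_ = λ { [] [] → yes refl }
    ; count = λ { [] → refl }
    }
  Vec-Enumeration EA (suc n) = retract-Enumeration (×-Enumeration EA (Vec-Enumeration EA n))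
    (λ (x , xs) → x ∷ xs) (λ { (x ∷ xs) → x , xs }) (λ _ → refl) (λ { (x ∷ xs) → refl })

  module _ (EA : Enumeration A) where
    private module EA = Enumeration EA

    ∑-Vec-suc : ∀ n (f : Vec A (suc n) → ℤ) → Enumeration.∑ᴱ (Vec-Enumeration EA (suc n)) f ≡
      EA.∑ᴱ (λ x → Enumeration.∑ᴱ (Vec-Enumeration EA n) (λ xs → f (x ∷ xs)))
    ∑-Vec-suc n f = trans (sum-map _ (Enumeration.list (×-Enumeration EA (Vec-Enumeration EA n))) f)
                          (∑-× EA (Vec-Enumeration EA n) _)

    Vec-card-suc : ∀ n → Enumeration.card (Vec-Enumeration EA (suc n)) ≡
      EA.card * Enumeration.card (Vec-Enumeration EA n)
    Vec-card-suc n = trans (∑-Vec-suc n (λ _ → 1ℤ)) (sum-const EA.list _)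

open FiniteSums

-- A ring solver and cancellation laws for a field.

module FieldRing {c} (F : Field c) where
  open Field F

  commutativeRing : CommutativeRing c c
  commutativeRing = record { isCommutativeRing = isCommutativeRing }

  open CommutativeRing commutativeRing public
    using (+-assoc; +-comm; +-identityˡ; +-identityʳ; -‿inverseˡ; -‿inverseʳ; *-assoc; *-comm;
           *-identityˡ; *-identityʳ; distribˡ; distribʳ; zeroˡ; zeroʳ; ring; semiring;
           commutativeSemiring; +-commutativeMonoid; *-commutativeMonoid)
  open RingProperties ring public
    using (-‿distribˡ-*; -‿distribʳ-*; -‿+-comm; -0#≈0#; -‿involutive)

  open OptimisedMult semiring using (×-homo-+; ×1-homo-*) renaming (_×_ to _×′_; 1+× to 1+×′)

  -- The canonical homomorphism ℤ → F, which supplies the coefficients of the ring solver on F.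
  fromℤ : ℤ → Carrier
  fromℤ (pos n) = n ×′ 1#
  fromℤ -[1+ n ] = - (suc n ×′ 1#)

  private
    fromℤ-neg : ∀ i → fromℤ (ℤ.- i) ≡ - fromℤ i
    fromℤ-neg (pos zero) = sym -0#≈0#
    fromℤ-neg (pos (suc n)) = refl
    fromℤ-neg -[1+ n ] = sym (-‿involutive _)

    shift : ∀ x y z → x + - y ≡ (z + x) + - (z + y)
    shift x y z = begin
      x + - y ≡⟨ cong (_+ - y) (sym (trans (cong (_+ x) (-‿inverseʳ z)) (+-identityˡ x))) ⟩
      ((z + - z) + x) + - y ≡⟨ cong (_+ - y) (trans (+-assoc z (- z) x) (trans (cong (z +_) (+-comm (- z) x)) (sym (+-assoc z x (- z))))) ⟩
      ((z + x) + - z) + - y ≡⟨ +-assoc (z + x) (- z) (- y) ⟩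
      (z + x) + (- z + - y) ≡⟨ cong ((z + x) +_) (-‿+-comm z y) ⟩
      (z + x) + - (z + y) ∎
      where open ≡-Reasoning

    fromℤ-⊖ : ∀ m n → fromℤ (m ⊖ n) ≡ m ×′ 1# + - (n ×′ 1#)
    fromℤ-⊖ m zero = sym (trans (cong (m ×′ 1# +_) -0#≈0#) (+-identityʳ _))
    fromℤ-⊖ zero (suc n) = sym (+-identityˡ _)
    fromℤ-⊖ (suc m) (suc n) = begin
      fromℤ (suc m ⊖ suc n) ≡⟨ cong fromℤ (ℤ.[1+m]⊖[1+n]≡m⊖n m n) ⟩
      fromℤ (m ⊖ n) ≡⟨ fromℤ-⊖ m n ⟩
      m ×′ 1# + - (n ×′ 1#) ≡⟨ shift _ _ 1# ⟩
      (1# + m ×′ 1#) + - (1# + n ×′ 1#) ≡⟨ cong₂ (λ x y → x + - y) (1+×′ m 1#) (1+×′ n 1#) ⟨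
      suc m ×′ 1# + - (suc n ×′ 1#) ∎
      where open ≡-Reasoning

    fromℤ-+ : ∀ i j → fromℤ (i ℤ.+ j) ≡ fromℤ i + fromℤ j
    fromℤ-+ (pos m) (pos n) = ×-homo-+ 1# m n
    fromℤ-+ (pos m) -[1+ n ] = fromℤ-⊖ m (suc n)
    fromℤ-+ -[1+ m ] (pos n) = trans (fromℤ-⊖ n (suc m)) (+-comm _ _)
    fromℤ-+ -[1+ m ] -[1+ n ] = begin
      - (suc (suc (m ℕ.+ n)) ×′ 1#) ≡⟨ cong (λ k → - (k ×′ 1#)) (cong suc (sym (ℕ.+-suc m n))) ⟩
      - ((suc m ℕ.+ suc n) ×′ 1#) ≡⟨ cong -_ (×-homo-+ 1# (suc m) (suc n)) ⟩
      - (suc m ×′ 1# + suc n ×′ 1#) ≡⟨ -‿+-comm _ _ ⟨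
      - (suc m ×′ 1#) + - (suc n ×′ 1#) ∎
      where
      open ≡-Reasoning

    fromℤ-pos* : ∀ m j → fromℤ (pos m ℤ.* j) ≡ fromℤ (pos m) * fromℤ j
    fromℤ-pos* m (pos n) = trans (cong fromℤ (sym (ℤ.pos-* m n))) (×1-homo-* m n)
    fromℤ-pos* m -[1+ n ] = begin
      fromℤ (pos m ℤ.* ℤ.- pos (suc n)) ≡⟨ cong fromℤ (ℤ.neg-distribʳ-* (pos m) (pos (suc n))) ⟨
      fromℤ (ℤ.- (pos m ℤ.* pos (suc n))) ≡⟨ fromℤ-neg (pos m ℤ.* pos (suc n)) ⟩
      - fromℤ (pos m ℤ.* pos (suc n)) ≡⟨ cong -_ (fromℤ-pos* m (pos (suc n))) ⟩
      - (fromℤ (pos m) * (suc n ×′ 1#)) ≡⟨ -‿distribʳ-* _ _ ⟩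
      fromℤ (pos m) * - (suc n ×′ 1#) ∎
      where open ≡-Reasoning

    fromℤ-* : ∀ i j → fromℤ (i ℤ.* j) ≡ fromℤ i * fromℤ j
    fromℤ-* (pos m) j = fromℤ-pos* m j
    fromℤ-* -[1+ m ] j = begin
      fromℤ (ℤ.- pos (suc m) ℤ.* j) ≡⟨ cong fromℤ (ℤ.neg-distribˡ-* (pos (suc m)) j) ⟨
      fromℤ (ℤ.- (pos (suc m) ℤ.* j)) ≡⟨ fromℤ-neg (pos (suc m) ℤ.* j) ⟩
      - fromℤ (pos (suc m) ℤ.* j) ≡⟨ cong -_ (fromℤ-pos* (suc m) j) ⟩
      - (suc m ×′ 1# * fromℤ j) ≡⟨ -‿distribˡ-* _ _ ⟩
      - (suc m ×′ 1#) * fromℤ j ∎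
      where open ≡-Reasoning

    morphism : ℤ.+-*-rawRing -Raw-AlmostCommutative⟶ fromCommutativeRing commutativeRing
    morphism = record
      { ⟦_⟧ = fromℤ
      ; +-homo = fromℤ-+
      ; *-homo = fromℤ-*
      ; -‿homo = fromℤ-neg
      ; 0-homo = refl
      ; 1-homo = refl
      }

    coeff≟ : ∀ i j → Maybe (fromℤ i ≡ fromℤ j)
    coeff≟ i j with i ℤ.≟ j
    ... | yes e = just (cong fromℤ e)
    ... | no _ = nothing

  module Solver = RingSolver ℤ.+-*-rawRing (fromCommutativeRing commutativeRing) morphism coeff≟

  *-zero-product : ∀ {x y} → x ≢ 0# → x * y ≡ 0# → y ≡ 0#
  *-zero-product {x} {y} x≢0 xy≡0 with inverse x x≢0
  ... | z , xz≡1 = begin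
    y ≡⟨ *-identityˡ y ⟨
    1# * y ≡⟨ cong (_* y) xz≡1 ⟨
    x * z * y ≡⟨ solve 3 (λ x y z → x :* z :* y := z :* (x :* y)) refl x y z ⟩
    z * (x * y) ≡⟨ cong (z *_) xy≡0 ⟩
    z * 0# ≡⟨ zeroʳ z ⟩
    0# ∎
    where
    open ≡-Reasoning
    open Solver using (solve; _:*_; _:=_)

  *-≢0 : ∀ {x y} → x ≢ 0# → y ≢ 0# → x * y ≢ 0#
  *-≢0 x≢0 y≢0 xy≡0 = y≢0 (*-zero-product x≢0 xy≡0)

  x-y≡0⇒x≡y : ∀ {x y} → x + - y ≡ 0# → x ≡ y
  x-y≡0⇒x≡y {x} {y} e = begin
    x ≡⟨ solve 2 (λ x y → x := (x :+ :- y) :+ y) refl x y ⟩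
    (x + - y) + y ≡⟨ cong (_+ y) e ⟩
    0# + y ≡⟨ +-identityˡ y ⟩
    y ∎
    where
    open ≡-Reasoning
    open Solver using (solve; _:+_; :-_; _:=_)

  x≡y⇒x-y≡0 : ∀ {x y} → x ≡ y → x + - y ≡ 0#
  x≡y⇒x-y≡0 {x} refl = -‿inverseʳ x

-- Divisibility of binomial coefficients by a prime.

-- The absorption identity, free of division and therefore accessible to induction by Pascal's rule.
C-absorb : ∀ n k → suc k ℕ.* (suc n C suc k) ≡ suc n ℕ.* (n C k)
C-absorb zero zero = refl
C-absorb zero (suc k) = begin
  suc (suc k) ℕ.* (1 C suc (suc k)) ≡⟨ cong (suc (suc k) ℕ.*_) (k>n⇒nCk≡0 {1} {suc (suc k)} (ℕ.s≤s (ℕ.s≤s ℕ.z≤n))) ⟩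
  suc (suc k) ℕ.* 0 ≡⟨ ℕ.*-zeroʳ (suc (suc k)) ⟩
  0 ≡⟨ cong (1 ℕ.*_) (k>n⇒nCk≡0 {0} {suc k} (ℕ.s≤s ℕ.z≤n)) ⟨
  1 ℕ.* (0 C suc k) ∎
  where open ≡-Reasoning
C-absorb (suc n) zero = begin
  1 ℕ.* (suc (suc n) C 1) ≡⟨ ℕ.*-identityˡ _ ⟩
  suc (suc n) C 1 ≡⟨ nC1≡n (suc (suc n)) ⟩
  suc (suc n) ≡⟨ ℕ.*-identityʳ _ ⟨
  suc (suc n) ℕ.* 1 ∎
  where open ≡-Reasoning
C-absorb (suc n) (suc k) = begin
  suc (suc k) ℕ.* (suc (suc n) C suc (suc k))
    ≡⟨ cong (suc (suc k) ℕ.*_) (nCk+nC[k+1]≡[n+1]C[k+1] (suc n) (suc k)) ⟨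
  suc (suc k) ℕ.* (b ℕ.+ c)
    ≡⟨ solve 3 (λ k b c → (con 2 :+ k) :* (b :+ c) := b :+ ((con 1 :+ k) :* b :+ (con 2 :+ k) :* c)) refl k b c ⟩
  b ℕ.+ (suc k ℕ.* b ℕ.+ suc (suc k) ℕ.* c)
    ≡⟨ cong (b ℕ.+_) (cong₂ ℕ._+_ (C-absorb n k) (C-absorb n (suc k))) ⟩
  b ℕ.+ (suc n ℕ.* (n C k) ℕ.+ suc n ℕ.* (n C suc k))
    ≡⟨ cong (b ℕ.+_) (ℕ.*-distribˡ-+ (suc n) (n C k) (n C suc k)) ⟨
  b ℕ.+ suc n ℕ.* (n C k ℕ.+ n C suc k)
    ≡⟨ cong (λ z → b ℕ.+ suc n ℕ.* z) (nCk+nC[k+1]≡[n+1]C[k+1] n k) ⟩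
  suc (suc n) ℕ.* (suc n C suc k) ∎
  where
  open ≡-Reasoning
  open ℕ-Solver
  b = suc n C suc k
  c = suc n C suc (suc k)

-- Absorption shows that the prime divides `suc k` times the coefficient, and `suc k` is positive
-- and smaller than the prime.
prime∣C : ∀ {p} → Prime (suc p) → ∀ k → k ℕ.< p → suc p ∣ (suc p C suc k)
prime∣C {p} pr k k<p with euclidsLemma (suc k) (suc p C suc k) pr
  (divides (p C k) (trans (C-absorb p k) (ℕ.*-comm (suc p) (p C k))))
... | inj₁ p∣k = contradiction (∣⇒≤ p∣k) (ℕ.<⇒≱ (ℕ.s≤s k<p))
... | inj₂ p∣C = p∣C

-- Finite fields: `x^N = x`, the Frobenius map and root counting.

module _ {c ℓ} (M : CommutativeMonoid c ℓ) where
  open CommutativeMonoid M using (_≈_)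
  open MonoidSum M using (sum; sum-permute; sum-cong-≗)
  open CommutativeMonoid M using (reflexive) renaming (trans to ≈-trans)

  -- Stated for a commutative monoid since it serves twice: additively for translation by 1 and
  -- multiplicatively for scaling by a nonzero element.
  sum-reindex : ∀ {a} {A : Set a} {N} (iso : A ↔ Fin N) (φ ψ : A → A) →
    (∀ x → ψ (φ x) ≡ x) → (∀ x → φ (ψ x) ≡ x) → (f : A → CommutativeMonoid.Carrier M) →
    sum (λ i → f (Inverse.from iso i)) ≈ sum (λ i → f (φ (Inverse.from iso i)))
  sum-reindex iso φ ψ ψφ φψ f = ≈-trans (sum-permute (λ i → f (from i)) π)
      (reflexive (sum-cong-≗ (λ i → cong f (strictlyInverseʳ (φ (from i))))))
    where
    open Inverse iso
    cancel : ∀ (φ ψ : _ → _) → (∀ x → φ (ψ x) ≡ x) → ∀ i → to (φ (from (to (ψ (from i))))) ≡ i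
    cancel φ ψ φψ i = trans (cong (λ x → to (φ x)) (strictlyInverseʳ (ψ (from i))))
                            (trans (cong to (φψ (from i))) (strictlyInverseˡ i))
    π : Permutation _ _
    π = permutation (λ i → to (φ (from i))) (λ i → to (ψ (from i))) (cancel φ ψ φψ) (cancel ψ φ ψφ)

module FiniteField {c} (F : Field c) where
  open Field F
  open FieldRing F public
  open Mult semiring using (×-homo-+; ×1-homo-*; ×-assocˡ; ×-assoc-*; ×-congʳ) renaming (_×_ to _×ᶠ_)
  open Exp commutativeSemiring using (^-distrib-*; ^-assocʳ) renaming (_^_ to _^ᶠ_)
  private
    module ∑+ = MonoidSum +-commutativeMonoid
    module ∏ = MonoidSum *-commutativeMonoid

  ^≡^ᶠ : ∀ x n → x ^ n ≡ x ^ᶠ n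
  ^≡^ᶠ x zero = refl
  ^≡^ᶠ x (suc n) = cong (x *_) (^≡^ᶠ x n)

  0^ : ∀ n → 0# ^ᶠ suc n ≡ 0#
  0^ n = zeroˡ _

  module _ {N} (iso : Carrier ↔ Fin N) where
    open Inverse iso using (to; from; strictlyInverseˡ; strictlyInverseʳ)
    open Enumeration (↔⇒Enumeration iso) using (_≟_)

    -- Translation by 1 permutes the field, so the sum s of all elements equals s + N · 1.
    N×1≡0 : N ×ᶠ 1# ≡ 0#
    N×1≡0 = begin
      N ×ᶠ 1# ≡⟨ solve 2 (λ s t → t := (s :+ t) :+ :- s) refl s (N ×ᶠ 1#) ⟩
      (s + N ×ᶠ 1#) + - s ≡⟨ cong (_+ - s) shifted ⟨
      s + - s ≡⟨ -‿inverseʳ s ⟩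
      0# ∎
      where
      open ≡-Reasoning
      open Solver using (solve; _:+_; :-_; _:=_; con)
      s : Carrier
      s = ∑+.sum from
      shifted : s ≡ s + N ×ᶠ 1#
      shifted = begin
        s ≡⟨ sum-reindex +-commutativeMonoid iso (_+ 1#) (_+ - 1#)
               (λ x → solve 1 (λ x → (x :+ con 1ℤ) :+ :- con 1ℤ := x) refl x)
               (λ x → solve 1 (λ x → (x :+ :- con 1ℤ) :+ con 1ℤ := x) refl x) (λ x → x) ⟩
        ∑+.sum (λ i → from i + 1#) ≡⟨ ∑+.∑-distrib-+ from (λ _ → 1#) ⟩
        s + ∑+.sum {N} (λ _ → 1#) ≡⟨ cong (s +_) (∑+.sum-replicate N) ⟩
        s + N ×ᶠ 1# ∎

    ∏≢0 : ∀ {n} (f : Fin n → Carrier) → (∀ i → f i ≢ 0#) → ∏.sum f ≢ 0#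
    ∏≢0 {zero} f f≢0 = λ e → 0≢1 (sym e)
    ∏≢0 {suc n} f f≢0 = *-≢0 (f≢0 Fin.zero) (∏≢0 (λ i → f (Fin.suc i)) (λ i → f≢0 (Fin.suc i)))

    if0 : Carrier → Carrier → Carrier → Carrier
    if0 y u v with y ≟ 0#
    ... | yes _ = u
    ... | no _ = v

    -- Multiplication by x permutes the nonzero elements, so their product P satisfies P = x^(N-1) P;
    -- the functions below extend this to products over all of F.
    x^N≡x : ∀ x → x ^ N ≡ x
    x^N≡x x with x ≟ 0#
    ... | yes refl = trans (^≡^ᶠ 0# N) (zeroPow N iso)
      where
      zeroPow : ∀ N → Carrier ↔ Fin N → 0# ^ᶠ N ≡ 0#
      zeroPow zero iso′ = contradiction (Inverse.to iso′ 0#) λ ()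
      zeroPow (suc n) _ = 0^ n
    ... | no x≢0 with inverse x x≢0
    ... | z , xz≡1 = begin
      x ^ N ≡⟨ ^≡^ᶠ x N ⟩
      x ^ᶠ N ≡⟨ ∏.sum-replicate N ⟨
      -- The N factors are distributed over the elements of the field: those at nonzero elements
      -- multiply to 1 by `units≡1`, and the one at zero remains.
      ∏.sum {N} (λ _ → x) ≡⟨ ∏.sum-cong-≗ (λ i → splitConst (from i)) ⟩
      ∏.sum (λ i → if0 (from i) 1# x * if0 (from i) x 1#)
        ≡⟨ ∏.∑-distrib-+ (λ i → if0 (from i) 1# x) (λ i → if0 (from i) x 1#) ⟩
      ∏.sum (λ i → if0 (from i) 1# x) * ∏.sum (λ i → if0 (from i) x 1#)
        ≡⟨ cong₂ _*_ units≡1 (single from (to 0#) (strictlyInverseʳ 0#) λ i e → trans (sym (strictlyInverseˡ i)) (cong to e)) ⟩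
      1# * x ≡⟨ *-identityˡ x ⟩
      x ∎
      where
      open ≡-Reasoning
      open Solver using (solve; _:*_; _:+_; :-_; _:=_; con)
      splitConst : ∀ y → x ≡ if0 y 1# x * if0 y x 1#
      splitConst y with y ≟ 0#
      ... | yes _ = sym (*-identityˡ x)
      ... | no _ = sym (*-identityʳ x)
      single : ∀ {n} (h : Fin n → Carrier) i₀ → h i₀ ≡ 0# → (∀ i → h i ≡ 0# → i ≡ i₀) →
        ∏.sum (λ i → if0 (h i) x 1#) ≡ x
      single {suc n} h i₀ h0 uniq = begin
        ∏.sum (λ i → if0 (h i) x 1#) ≡⟨ ∏.sum-remove {i = i₀} (λ i → if0 (h i) x 1#) ⟩
        if0 (h i₀) x 1# * ∏.sum (λ j → if0 (h (Fin.punchIn i₀ j)) x 1#)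
          ≡⟨ cong₂ _*_ (at0 (h i₀) h0) (trans (∏.sum-cong-≗ (λ j → off0 _ λ e → Fin.punchInᵢ≢i i₀ j (uniq _ e))) (∏.sum-replicate-zero n)) ⟩
        x * 1# ≡⟨ *-identityʳ x ⟩
        x ∎
        where
        at0 : ∀ y → y ≡ 0# → if0 y x 1# ≡ x
        at0 y e with y ≟ 0#
        ... | yes _ = refl
        ... | no ne = contradiction e ne
        off0 : ∀ y → y ≢ 0# → if0 y x 1# ≡ 1#
        off0 y ne with y ≟ 0#
        ... | yes e = contradiction e ne
        ... | no _ = refl
      g P′ : Fin N → Carrier
      g i = if0 (from i) 1# x
      P′ i = if0 (from i) 1# (from i)
      P≢0 : ∏.sum P′ ≢ 0#
      P≢0 = ∏≢0 P′ λ i → nz (from i)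
        where
        nz : ∀ y → if0 y 1# y ≢ 0#
        nz y with y ≟ 0#
        ... | yes _ = λ e → 0≢1 (sym e)
        ... | no ne = ne
      scaled : ∀ y → if0 (x * y) 1# (x * y) ≡ if0 y 1# x * if0 y 1# y
      scaled y with x * y ≟ 0# | y ≟ 0#
      ... | yes _ | yes _ = sym (*-identityˡ 1#)
      ... | yes e | no ne = contradiction e (*-≢0 x≢0 ne)
      ... | no ne | yes refl = contradiction (zeroʳ x) ne
      ... | no _ | no _ = refl
      P≡ : ∏.sum P′ ≡ ∏.sum g * ∏.sum P′
      P≡ = begin
        ∏.sum P′ ≡⟨ sum-reindex *-commutativeMonoid iso (x *_) (z *_)
                      (λ y → trans (solve 3 (λ x y z → z :* (x :* y) := (x :* z) :* y) refl x y z)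
                                   (trans (cong (_* y) xz≡1) (*-identityˡ y)))
                      (λ y → trans (solve 3 (λ x y z → x :* (z :* y) := (x :* z) :* y) refl x y z)
                                   (trans (cong (_* y) xz≡1) (*-identityˡ y)))
                      (λ y → if0 y 1# y) ⟩
        ∏.sum (λ i → if0 (x * from i) 1# (x * from i)) ≡⟨ ∏.sum-cong-≗ (λ i → scaled (from i)) ⟩
        ∏.sum (λ i → g i * P′ i) ≡⟨ ∏.∑-distrib-+ g P′ ⟩
        ∏.sum g * ∏.sum P′ ∎
      units≡1 : ∏.sum g ≡ 1#
      units≡1 = x-y≡0⇒x≡y (*-zero-product P≢0 (begin
        ∏.sum P′ * (∏.sum g + - 1#)
          ≡⟨ solve 2 (λ p g → p :* (g :+ :- con 1ℤ) := g :* p :+ :- p) refl (∏.sum P′) (∏.sum g) ⟩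
        ∏.sum g * ∏.sum P′ + - ∏.sum P′ ≡⟨ cong (_+ - ∏.sum P′) P≡ ⟨
        ∏.sum P′ + - ∏.sum P′ ≡⟨ -‿inverseʳ _ ⟩
        0# ∎))

    -- p^k · 1 is the k-th power of p · 1, and a field has no zero divisors.
    p^k×1≡0⇒p×1≡0 : ∀ p k → (p ℕ.^ k) ×ᶠ 1# ≡ 0# → p ×ᶠ 1# ≡ 0#
    p^k×1≡0⇒p×1≡0 p zero e = contradiction (trans (sym e) (+-identityʳ 1#)) 0≢1
    p^k×1≡0⇒p×1≡0 p (suc k) e with p ×ᶠ 1# ≟ 0#
    ... | yes p≡0 = p≡0
    ... | no p≢0 = p^k×1≡0⇒p×1≡0 p k
      (*-zero-product p≢0 (trans (sym (×1-homo-* p (p ℕ.^ k))) e))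

  module _ {p} (pr : Prime p) (p×1≡0 : p ×ᶠ 1# ≡ 0#) where

    p×≡0 : ∀ x → p ×ᶠ x ≡ 0#
    p×≡0 x = begin
      p ×ᶠ x ≡⟨ ×-congʳ p (*-identityˡ x) ⟨
      p ×ᶠ (1# * x) ≡⟨ ×-assoc-* p 1# x ⟨
      (p ×ᶠ 1#) * x ≡⟨ cong (_* x) p×1≡0 ⟩
      0# * x ≡⟨ zeroˡ x ⟩
      0# ∎
      where open ≡-Reasoning

    ∣⇒×≡0 : ∀ {m} → p ∣ m → ∀ x → m ×ᶠ x ≡ 0#
    ∣⇒×≡0 (divides d refl) x = trans (sym (×-assocˡ x d p)) (trans (×-congʳ d (p×≡0 x)) (×0 d))
      where
      ×0 : ∀ d → d ×ᶠ 0# ≡ 0#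
      ×0 zero = refl
      ×0 (suc d) = trans (+-identityˡ _) (×0 d)

  -- Only the two end terms of the binomial expansion survive, the inner coefficients being
  -- multiples of p.
  frobenius : ∀ {p} → Prime p → p ×ᶠ 1# ≡ 0# → ∀ x y → (x + y) ^ᶠ p ≡ x ^ᶠ p + y ^ᶠ p
  frobenius {zero} pr = contradiction pr λ ()
  frobenius {suc p} pr p≡0 x y = begin
    (x + y) ^ᶠ suc p ≡⟨ theorem (suc p) x y ⟩
    t Fin.zero + ∑+.sum (λ i → t (Fin.suc i)) ≡⟨ cong (t Fin.zero +_) (∑+.sum-init-last (λ i → t (Fin.suc i))) ⟩
    t Fin.zero + (∑+.sum (λ i → t (Fin.suc (Fin.inject₁ i))) + t (Fin.suc (Fin.fromℕ p)))
      ≡⟨ cong₂ _+_ first (cong₂ _+_ middle last) ⟩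
    y ^ᶠ suc p + (0# + x ^ᶠ suc p) ≡⟨ solve 2 (λ u v → v :+ (con 0ℤ :+ u) := u :+ v) refl _ _ ⟩
    x ^ᶠ suc p + y ^ᶠ suc p ∎
    where
    open ≡-Reasoning
    open Solver using (solve; _:+_; _:=_; con)
    open Binomial commutativeSemiring using (theorem; binomialTerm)
    t : Fin (suc (suc p)) → Carrier
    t = binomialTerm x y (suc p)
    first : t Fin.zero ≡ y ^ᶠ suc p
    first = trans (+-identityʳ _) (*-identityˡ _)
    middle : ∑+.sum (λ i → t (Fin.suc (Fin.inject₁ i))) ≡ 0#
    middle = trans (∑+.sum-cong-≗ λ i → ∣⇒×≡0 pr p≡0
        (subst (λ k → suc p ∣ (suc p C suc k)) (sym (Fin.toℕ-inject₁ i)) (prime∣C pr (toℕ i) (Fin.toℕ<n i))) _)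
      (∑+.sum-replicate-zero p)
    last : t (Fin.suc (Fin.fromℕ p)) ≡ x ^ᶠ suc p
    last rewrite Fin.toℕ-fromℕ p | nCn≡1 (suc p) | ℕ.n∸n≡0 p =
      trans (+-identityʳ _) (*-identityʳ _)

  frobenius^ : ∀ {p} → Prime p → p ×ᶠ 1# ≡ 0# → ∀ k x y →
    (x + y) ^ᶠ (p ℕ.^ k) ≡ x ^ᶠ (p ℕ.^ k) + y ^ᶠ (p ℕ.^ k)
  frobenius^ pr p≡0 zero x y = solve 2 (λ x y → (x :+ y) :* con 1ℤ := x :* con 1ℤ :+ y :* con 1ℤ) refl x y
    where open Solver using (solve; _:+_; _:*_; _:=_; con)
  frobenius^ {p} pr p≡0 (suc k) x y = begin
    (x + y) ^ᶠ (p ℕ.* P) ≡⟨ ^-assocʳ (x + y) p P ⟨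
    ((x + y) ^ᶠ p) ^ᶠ P ≡⟨ cong (_^ᶠ P) (frobenius pr p≡0 x y) ⟩
    (x ^ᶠ p + y ^ᶠ p) ^ᶠ P ≡⟨ frobenius^ pr p≡0 k (x ^ᶠ p) (y ^ᶠ p) ⟩
    (x ^ᶠ p) ^ᶠ P + (y ^ᶠ p) ^ᶠ P ≡⟨ cong₂ _+_ (^-assocʳ x p P) (^-assocʳ y p P) ⟩
    x ^ᶠ (p ℕ.* P) + y ^ᶠ (p ℕ.* P) ∎
    where
    open ≡-Reasoning
    P = p ℕ.^ k

  -- f is a polynomial function of degree at most d whose coefficient of x^d is a:
  -- each divided difference (f x - f r) / (x - r) is one of degree at most d - 1 with the same coefficient a.
  Poly : ℕ → Carrier → (Carrier → Carrier) → Set c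
  Poly zero a f = ∀ x → f x ≡ a
  Poly (suc d) a f = ∀ r → ∃ λ g → Poly d a g × (∀ x → f x + - f r ≡ (x + - r) * g x)

  Poly-+ : ∀ d {a b f g} → Poly d a f → Poly d b g → Poly d (a + b) (λ x → f x + g x)
  Poly-+ zero p q x = cong₂ _+_ (p x) (q x)
  Poly-+ (suc d) {f = f} {g} p q r with p r | q r
  ... | f′ , p′ , ef | g′ , q′ , eg = (λ x → f′ x + g′ x) , Poly-+ d p′ q′ , λ x → begin
    (f x + g x) + - (f r + g r)
      ≡⟨ solve 4 (λ u v s t → (u :+ v) :+ :- (s :+ t) := (u :+ :- s) :+ (v :+ :- t)) refl (f x) (g x) (f r) (g r) ⟩
    (f x + - f r) + (g x + - g r) ≡⟨ cong₂ _+_ (ef x) (eg x) ⟩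
    (x + - r) * f′ x + (x + - r) * g′ x ≡⟨ distribˡ _ _ _ ⟨
    (x + - r) * (f′ x + g′ x) ∎
    where
    open ≡-Reasoning
    open Solver using (solve; _:+_; :-_; _:=_)

  Poly-*ˡ : ∀ d {a f} b → Poly d a f → Poly d (b * a) (λ x → b * f x)
  Poly-*ˡ zero b p x = cong (b *_) (p x)
  Poly-*ˡ (suc d) {f = f} b p r with p r
  ... | f′ , p′ , ef = (λ x → b * f′ x) , Poly-*ˡ d b p′ , λ x → begin
    b * f x + - (b * f r) ≡⟨ solve 3 (λ b u s → b :* u :+ :- (b :* s) := b :* (u :+ :- s)) refl b (f x) (f r) ⟩
    b * (f x + - f r) ≡⟨ cong (b *_) (ef x) ⟩
    b * ((x + - r) * f′ x) ≡⟨ solve 3 (λ b u s → b :* (u :* s) := u :* (b :* s)) refl b (x + - r) (f′ x) ⟩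
    (x + - r) * (b * f′ x) ∎
    where
    open ≡-Reasoning
    open Solver using (solve; _:+_; _:*_; :-_; _:=_)

  Poly-suc : ∀ d {a f} → Poly d a f → Poly (suc d) 0# f
  Poly-suc zero p r = (λ _ → 0#) , (λ _ → refl) , λ x →
    trans (x≡y⇒x-y≡0 (trans (p x) (sym (p r)))) (sym (zeroʳ _))
  Poly-suc (suc d) p r with p r
  ... | f′ , p′ , ef = f′ , Poly-suc d p′ , ef

  Poly-resp : ∀ d {a b f} → a ≡ b → Poly d a f → Poly d b f
  Poly-resp d refl p = p

  -- Lower-order terms get leading coefficient zero in the higher degree, so adding them leaves the
  -- leading coefficient unchanged.
  Poly-< : ∀ {d e a f} → d ℕ.< e → Poly d a f → Poly e 0# f
  Poly-< {d} d<e p = go (ℕ.≤⇒≤′ d<e)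
    where
    go : ∀ {e} → suc d ℕ.≤′ e → Poly e 0# _
    go ℕ.≤′-refl = Poly-suc d p
    go (ℕ.≤′-step l) = Poly-suc _ (go l)

  -- The product rule for divided differences: that of `x * f x` at r is `f x + r * f′ x`, where
  -- `f′` is that of f.
  Poly-x* : ∀ d {a f} → Poly d a f → Poly (suc d) a (λ x → x * f x)
  Poly-x* zero {a} {f} p r = f , p , λ x → begin
    x * f x + - (r * f r) ≡⟨ cong (λ z → x * f x + - (r * z)) (trans (p r) (sym (p x))) ⟩
    x * f x + - (r * f x) ≡⟨ solve 3 (λ x r u → x :* u :+ :- (r :* u) := (x :+ :- r) :* u) refl x r (f x) ⟩
    (x + - r) * f x ∎
    where
    open ≡-Reasoning
    open Solver using (solve; _:+_; _:*_; :-_; _:=_)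
  Poly-x* (suc d) {a} {f} p r with p r
  ... | f′ , p′ , ef = (λ x → f x + r * f′ x) ,
    Poly-resp (suc d) (+-identityʳ a) (Poly-+ (suc d) p (Poly-suc d (Poly-*ˡ d r p′))) , λ x → begin
    x * f x + - (r * f r)
      ≡⟨ solve 4 (λ x r u s → x :* u :+ :- (r :* s) := (x :+ :- r) :* u :+ r :* (u :+ :- s)) refl x r (f x) (f r) ⟩
    (x + - r) * f x + r * (f x + - f r) ≡⟨ cong (λ z → (x + - r) * f x + r * z) (ef x) ⟩
    (x + - r) * f x + r * ((x + - r) * f′ x)
      ≡⟨ solve 4 (λ d r u s → d :* u :+ r :* (d :* s) := d :* (u :+ r :* s)) refl (x + - r) r (f x) (f′ x) ⟩
    (x + - r) * (f x + r * f′ x) ∎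
    where
    open ≡-Reasoning
    open Solver using (solve; _:+_; _:*_; :-_; _:=_)

  Poly-^ : ∀ d → Poly d 1# (_^ d)
  Poly-^ zero x = refl
  Poly-^ (suc d) = Poly-x* d (Poly-^ d)

  module RootCount (E : Enumeration Carrier) where
    open Enumeration E

    -- At a root r the divided difference g satisfies f x = (x - r) g x, so every other root of f is
    -- a root of g, whose degree is one less and whose leading coefficient is the same.
    roots≤degree : ∀ d {a f} → a ≢ 0# → Poly d a f → ∑ᴱ (λ x → 𝟙 (f x ≟ 0#)) ℤ.≤ pos d
    roots≤degree zero {a} {f} a≢0 p = ℤ.≤-reflexive (trans
      (sum-cong list (λ x → 𝟙-no (f x ≟ 0#) (λ e → a≢0 (trans (sym (p x)) e)))) (sum-zero list))
    roots≤degree (suc d) {a} {f} a≢0 p with search (λ x → dec (f x ≟ 0#))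
      where
      dec : ∀ {P : Set c} → Dec P → Dec (¬ P)
      dec (yes p) = no λ ¬p → ¬p p
      dec (no ¬p) = yes ¬p
    ... | inj₁ none = subst (ℤ._≤ pos (suc d))
            (sym (trans (sum-cong list (λ x → 𝟙-no (f x ≟ 0#) (none x))) (sum-zero list))) (ℤ.+≤+ ℕ.z≤n)
    ... | inj₂ (r , ¬¬fr) with f r ≟ 0#
    ... | no ne = contradiction ne ¬¬fr
    ... | yes fr≡0 with p r
    ... | g , q , eg = begin
      ∑ᴱ (λ x → 𝟙 (f x ≟ 0#)) ≤⟨ sum-mono list (λ {x} _ → root x) ⟩
      ∑ᴱ (λ x → 𝟙 (x ≟ r) ℤ.+ 𝟙 (g x ≟ 0#)) ≡⟨ sum-+ list (λ x → 𝟙 (x ≟ r)) (λ x → 𝟙 (g x ≟ 0#)) ⟩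
      ∑ᴱ (λ x → 𝟙 (x ≟ r)) ℤ.+ ∑ᴱ (λ x → 𝟙 (g x ≟ 0#))
        ≤⟨ ℤ.+-mono-≤ (ℤ.≤-reflexive (count r)) (roots≤degree d a≢0 q) ⟩
      pos (suc d) ∎
      where
      open ℤ.≤-Reasoning
      root : ∀ x → 𝟙 (f x ≟ 0#) ℤ.≤ 𝟙 (x ≟ r) ℤ.+ 𝟙 (g x ≟ 0#)
      root x with f x ≟ 0# | x ≟ r | g x ≟ 0#
      ... | no _ | yes _ | yes _ = ℤ.+≤+ ℕ.z≤n
      ... | no _ | yes _ | no _ = ℤ.+≤+ ℕ.z≤n
      ... | no _ | no _ | yes _ = ℤ.+≤+ ℕ.z≤n
      ... | no _ | no _ | no _ = ℤ.+≤+ ℕ.z≤n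
      ... | yes _ | yes _ | yes _ = ℤ.+≤+ (ℕ.s≤s ℕ.z≤n)
      ... | yes _ | yes _ | no _ = ℤ.+≤+ (ℕ.s≤s ℕ.z≤n)
      ... | yes _ | no _ | yes _ = ℤ.+≤+ (ℕ.s≤s ℕ.z≤n)
      ... | yes e | no x≢r | no gx≢0 = contradiction
        (trans (sym (eg x)) (x≡y⇒x-y≡0 (trans e (sym fr≡0))))
        (*-≢0 (λ e′ → x≢r (x-y≡0⇒x≡y e′)) gx≢0)

-- Conjugation, trace and norm over the subfield of order q.

primePower>1 : ∀ {q} → IsPrimePower q → 1 ℕ.< q
primePower>1 (p , suc k , pr , _ , refl) = ℕ.≤-trans (ℕ.nonTrivial⇒n>1 p) (ℕ.m≤m*n p (p ℕ.^ k))
  where instance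
    _ = prime⇒nonTrivial pr
    _ = ℕ.m^n≢0 p k {{ℕ.nonTrivial⇒nonZero p}}

module Conjugation {c} (q : ℕ) (pp : IsPrimePower q) (F : Field c) (iso : Field.Carrier F ↔ Fin (q ℕ.^ 2)) where
  open Field F
  open FiniteField F public
  open Mult semiring using (×1-homo-*) renaming (_×_ to _×ᶠ_)
  open Exp commutativeSemiring using (^-distrib-*; ^-assocʳ) renaming (_^_ to _^ᶠ_)

  E : Enumeration Carrier
  E = ↔⇒Enumeration iso

  open Enumeration E public using (list; _≟_; ∑ᴱ; count; ∑-δ; search; ∈list)
  open RootCount E

  Q : ℤ
  Q = pos q

  q>1 : 1 ℕ.< q
  q>1 = primePower>1 pp

  instance
    Q-pos : ℤ.Positive Q
    Q-pos = ℤ.positive (ℤ.+<+ (ℕ.≤-trans (ℕ.s≤s ℕ.z≤n) q>1))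

    Q-nonZero : ℤ.NonZero Q
    Q-nonZero = ℕ.>-nonZero (ℕ.≤-trans (ℕ.s≤s ℕ.z≤n) q>1)

  card-F : ∑ᴱ (λ _ → 1ℤ) ≡ Q ℤ.* Q
  card-F = trans (↔⇒card iso) (trans (cong pos (cong (q ℕ.*_) (ℕ.*-identityʳ q))) (ℤ.pos-* q q))

  conj : Carrier → Carrier
  conj x = x ^ q

  private
    -- The q² = p^(2k) elements of the field annihilate 1, and then so does p.
    char : ∃ λ p → ∃ λ k → Prime p × q ≡ p ℕ.^ k × p ×ᶠ 1# ≡ 0#
    char = let p , k , pr , _ , q≡ = pp in p , k , pr , q≡ , p^k×1≡0⇒p×1≡0 iso p (k ℕ.* 2)
      (subst (λ N → N ×ᶠ 1# ≡ 0#) (trans (cong (ℕ._^ 2) q≡) (ℕ.^-*-assoc p k 2)) (N×1≡0 iso))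

  conj-+ : ∀ x y → conj (x + y) ≡ conj x + conj y
  conj-+ x y = begin
    (x + y) ^ q ≡⟨ ^≡^ᶠ (x + y) q ⟩
    (x + y) ^ᶠ q ≡⟨ subst (λ q → (x + y) ^ᶠ q ≡ x ^ᶠ q + y ^ᶠ q) (sym q≡) (frobenius^ pr p≡0 k x y) ⟩
    x ^ᶠ q + y ^ᶠ q ≡⟨ cong₂ _+_ (^≡^ᶠ x q) (^≡^ᶠ y q) ⟨
    x ^ q + y ^ q ∎
    where
    open ≡-Reasoning
    k = proj₁ (proj₂ char)
    pr = proj₁ (proj₂ (proj₂ char))
    q≡ = proj₁ (proj₂ (proj₂ (proj₂ char)))
    p≡0 = proj₂ (proj₂ (proj₂ (proj₂ char)))

  conj-* : ∀ x y → conj (x * y) ≡ conj x * conj y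
  conj-* x y = trans (^≡^ᶠ (x * y) q) (trans (^-distrib-* x y q) (sym (cong₂ _*_ (^≡^ᶠ x q) (^≡^ᶠ y q))))

  conj-conj : ∀ x → conj (conj x) ≡ x
  conj-conj x = begin
    (x ^ q) ^ q ≡⟨ trans (^≡^ᶠ _ q) (cong (_^ᶠ q) (^≡^ᶠ x q)) ⟩
    (x ^ᶠ q) ^ᶠ q ≡⟨ ^-assocʳ x q q ⟩
    x ^ᶠ (q ℕ.* q) ≡⟨ cong (λ n → x ^ᶠ (q ℕ.* n)) (ℕ.*-identityʳ q) ⟨
    x ^ᶠ (q ℕ.^ 2) ≡⟨ ^≡^ᶠ x (q ℕ.^ 2) ⟨
    x ^ (q ℕ.^ 2) ≡⟨ x^N≡x iso x ⟩
    x ∎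
    where open ≡-Reasoning

  conj-0 : conj 0# ≡ 0#
  conj-0 = begin
    conj 0# ≡⟨ solve 1 (λ a → a := (a :+ a) :+ :- a) refl (conj 0#) ⟩
    (conj 0# + conj 0#) + - conj 0# ≡⟨ cong (_+ - conj 0#) (conj-+ 0# 0#) ⟨
    conj (0# + 0#) + - conj 0# ≡⟨ cong (λ z → conj z + - conj 0#) (+-identityˡ 0#) ⟩
    conj 0# + - conj 0# ≡⟨ -‿inverseʳ _ ⟩
    0# ∎
    where
    open ≡-Reasoning
    open Solver using (solve; _:+_; :-_; _:=_)

  conj-neg : ∀ x → conj (- x) ≡ - conj x
  conj-neg x = begin
    conj (- x) ≡⟨ solve 2 (λ a b → b := (a :+ b) :+ :- a) refl (conj x) (conj (- x)) ⟩
    (conj x + conj (- x)) + - conj x ≡⟨ cong (_+ - conj x) (conj-+ x (- x)) ⟨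
    conj (x + - x) + - conj x ≡⟨ cong (_+ - conj x) (trans (cong conj (-‿inverseʳ x)) conj-0) ⟩
    0# + - conj x ≡⟨ +-identityˡ _ ⟩
    - conj x ∎
    where
    open ≡-Reasoning
    open Solver using (solve; _:+_; :-_; _:=_)

  conj-1 : conj 1# ≡ 1#
  conj-1 = one^ q
    where
    one^ : ∀ n → 1# ^ n ≡ 1#
    one^ zero = refl
    one^ (suc n) = trans (*-identityˡ _) (one^ n)

  conj≡0 : ∀ {x} → conj x ≡ 0# → x ≡ 0#
  conj≡0 {x} e = trans (sym (conj-conj x)) (trans (cong conj e) conj-0)

  -- The subfield of order q enters as a weight on F instead of a separate type, so all sums range
  -- over the same list.
  fixed : Carrier → ℤ
  fixed t = 𝟙 (conj t ≟ t)

  fixed≥0 : ∀ t → 0ℤ ℤ.≤ fixed t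
  fixed≥0 t = 𝟙-≥0 (conj t ≟ t)

  norm trace : Carrier → Carrier
  norm x = conj x * x
  trace x = x + conj x

  norm-fixed : ∀ x → conj (norm x) ≡ norm x
  norm-fixed x = trans (conj-* (conj x) x) (trans (cong (_* conj x) (conj-conj x)) (*-comm x (conj x)))

  trace-fixed : ∀ x → conj (trace x) ≡ trace x
  trace-fixed x = trans (conj-+ x (conj x)) (trans (cong (conj x +_) (conj-conj x)) (+-comm (conj x) x))

  norm≡0 : ∀ {x} → norm x ≡ 0# → x ≡ 0#
  norm≡0 {x} e with x ≟ 0#
  ... | yes x≡0 = x≡0
  ... | no x≢0 = contradiction e (*-≢0 (λ e′ → x≢0 (conj≡0 e′)) x≢0)

  -- Every x lies in exactly one fibre, and that fibre sits over a fixed value; the fibres therefore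
  -- exhaust the q² elements.
  fibres : (f : Carrier → Carrier) → (∀ x → conj (f x) ≡ f x) →
    ∑ᴱ (λ t → fixed t ℤ.* ∑ᴱ (λ x → 𝟙 (f x ≟ t))) ≡ Q ℤ.* Q
  fibres f f-fixed = begin
    ∑ᴱ (λ t → fixed t ℤ.* ∑ᴱ (λ x → 𝟙 (f x ≟ t))) ≡⟨ sum-cong list (λ t → sum-*ˡ list (fixed t) _) ⟨
    ∑ᴱ (λ t → ∑ᴱ (λ x → fixed t ℤ.* 𝟙 (f x ≟ t))) ≡⟨ sum-swap list list _ ⟩
    ∑ᴱ (λ x → ∑ᴱ (λ t → fixed t ℤ.* 𝟙 (f x ≟ t)))
      ≡⟨ sum-cong list (λ x → trans (sum-cong list (λ t → trans (ℤ.*-comm (fixed t) _)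
           (cong (ℤ._* fixed t) (𝟙-cong (f x ≟ t) (t ≟ f x) sym sym)))) (∑-δ (f x) fixed)) ⟩
    ∑ᴱ (λ x → fixed (f x)) ≡⟨ sum-cong list (λ x → 𝟙-yes (conj (f x) ≟ f x) (f-fixed x)) ⟩
    ∑ᴱ (λ _ → 1ℤ) ≡⟨ card-F ⟩
    Q ℤ.* Q ∎
    where open ≡-Reasoning

  private
    -- Applied to leading coefficients, which arise in the form `1# + 0#`.
    -1≢0 : ∀ {x} → x ≡ 1# → x ≢ 0#
    -1≢0 e e′ = 0≢1 (trans (sym e′) e)

    -- Fixed elements are roots of `x^q - x`. This bound and the next two use only a degree; exact
    -- sizes come afterwards from counting the whole field.
    fixed≤Q : ∑ᴱ fixed ℤ.≤ Q
    fixed≤Q = subst (ℤ._≤ Q) (sum-cong list (λ x → 𝟙-cong (x ^ q + - 1# * x ≟ 0#) (conj x ≟ x)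
        (λ e → x-y≡0⇒x≡y (trans (minus x) e)) (λ e → trans (sym (minus x)) (x≡y⇒x-y≡0 e))))
      (roots≤degree q (-1≢0 (+-identityʳ 1#)) (Poly-+ q (Poly-^ q)
        (Poly-< q>1 (Poly-*ˡ 1 (- 1#) (Poly-resp 1 refl linear)))))
      where
      open Solver using (solve; _:+_; _:*_; :-_; _:=_; con)
      minus : ∀ x → conj x + - x ≡ conj x + - 1# * x
      minus x = solve 2 (λ a x → a :+ :- x := a :+ :- con 1ℤ :* x) refl (conj x) x
      linear : Poly 1 1# (λ x → x)
      linear r = (λ _ → 1#) , (λ _ → refl) , λ x → sym (*-identityʳ _)

    trace≤Q : ∀ t → ∑ᴱ (λ x → 𝟙 (trace x ≟ t)) ℤ.≤ Q
    trace≤Q t = subst (ℤ._≤ Q) (sum-cong list (λ x → 𝟙-cong (x ^ q + (x + - t) ≟ 0#) (trace x ≟ t)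
        (λ e → x-y≡0⇒x≡y (trans (sym (assoc x)) e)) (λ e → trans (assoc x) (x≡y⇒x-y≡0 e))))
      (roots≤degree q (-1≢0 (+-identityʳ 1#)) (Poly-+ q (Poly-^ q) (Poly-< q>1 affine)))
      where
      open Solver using (solve; _:+_; _:*_; :-_; _:=_; con)
      assoc : ∀ x → conj x + (x + - t) ≡ trace x + - t
      assoc x = solve 3 (λ a x t → a :+ (x :+ :- t) := (x :+ a) :+ :- t) refl (conj x) x t
      affine : Poly 1 1# (λ x → x + - t)
      affine r = (λ _ → 1#) , (λ _ → refl) , λ x →
        solve 3 (λ x r t → (x :+ :- t) :+ :- (r :+ :- t) := (x :+ :- r) :* con 1ℤ) refl x r t

    norm≤Q+1 : ∀ t → ∑ᴱ (λ x → 𝟙 (norm x ≟ t)) ℤ.≤ Q ℤ.+ 1ℤ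
    norm≤Q+1 t = subst₂ ℤ._≤_ (sum-cong list (λ x → 𝟙-cong (x ^ suc q + - t * 1# ≟ 0#) (norm x ≟ t)
        (λ e → x-y≡0⇒x≡y (trans (sym (comm x)) e)) (λ e → trans (comm x) (x≡y⇒x-y≡0 e))))
        (trans (cong pos (ℕ.+-comm 1 q)) refl)
      (roots≤degree (suc q) (-1≢0 (+-identityʳ 1#)) (Poly-+ (suc q) (Poly-^ (suc q))
        (Poly-< (ℕ.s≤s ℕ.z≤n) (Poly-*ˡ 0 (- t) (Poly-^ 0)))))
      where
      open Solver using (solve; _:+_; _:*_; :-_; _:=_; con)
      comm : ∀ x → x * conj x + - t * 1# ≡ norm x + - t
      comm x = solve 3 (λ a x t → x :* a :+ :- t :* con 1ℤ := a :* x :+ :- t) refl (conj x) x t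

  -- The trace maps q² elements into the fixed ones with at most q in each fibre, so there are at
  -- least q fixed elements.
  card-fixed : ∑ᴱ fixed ≡ Q
  card-fixed = ℤ.≤-antisym fixed≤Q (ℤ.*-cancelʳ-≤-pos Q (∑ᴱ fixed) Q (begin
    Q ℤ.* Q ≡⟨ fibres trace trace-fixed ⟨
    ∑ᴱ (λ t → fixed t ℤ.* ∑ᴱ (λ x → 𝟙 (trace x ≟ t)))
      ≤⟨ sum-mono list (λ {t} _ → ℤ.*-monoˡ-≤-nonNeg (fixed t) {{ℤ.nonNegative (fixed≥0 t)}} (trace≤Q t)) ⟩
    ∑ᴱ (λ t → fixed t ℤ.* Q) ≡⟨ sum-*ʳ list Q fixed ⟩
    ∑ᴱ fixed ℤ.* Q ∎))
    where open ℤ.≤-Reasoning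

  private
    -- Upper bounds on the fibres whose total is exactly q² leave no slack, hence all of them are
    -- attained.
    saturated : (f : Carrier → Carrier) (ub : Carrier → ℤ) → (∀ x → conj (f x) ≡ f x) →
      (∀ t → ∑ᴱ (λ x → 𝟙 (f x ≟ t)) ℤ.≤ ub t) → ∑ᴱ (λ t → fixed t ℤ.* ub t) ≡ Q ℤ.* Q →
      ∀ t → conj t ≡ t → ∑ᴱ (λ x → 𝟙 (f x ≟ t)) ≡ ub t
    saturated f ub f-fixed f≤ub total t t-fixed = sym (ℤ.i-j≡0⇒i≡j (ub t) (fibre t) (begin
      ub t ℤ.- fibre t ≡⟨ ℤ.*-identityˡ _ ⟨
      1ℤ ℤ.* (ub t ℤ.- fibre t) ≡⟨ cong (ℤ._* (ub t ℤ.- fibre t)) (𝟙-yes (conj t ≟ t) t-fixed) ⟨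
      fixed t ℤ.* (ub t ℤ.- fibre t) ≡⟨ sum≡0⇒≡0 list (λ {t} _ → *-≥0 (fixed≥0 t) (ℤ.i≤j⇒0≤j-i (f≤ub t)))
                                            (ℤ.≤-reflexive slack) (∈list t) ⟩
      0ℤ ∎))
      where
      open ≡-Reasoning
      fibre : Carrier → ℤ
      fibre t = ∑ᴱ (λ x → 𝟙 (f x ≟ t))
      slack : ∑ᴱ (λ t → fixed t ℤ.* (ub t ℤ.- fibre t)) ≡ 0ℤ
      slack = begin
        ∑ᴱ (λ t → fixed t ℤ.* (ub t ℤ.- fibre t))
          ≡⟨ sum-cong list (λ t → let open ℤ-Solver in
               solve 3 (λ u v w → u :* (v :- w) := u :* v :- u :* w) refl (fixed t) (ub t) (fibre t)) ⟩
        ∑ᴱ (λ t → fixed t ℤ.* ub t ℤ.- fixed t ℤ.* fibre t) ≡⟨ sum-minus list _ _ ⟩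
        ∑ᴱ (λ t → fixed t ℤ.* ub t) ℤ.- ∑ᴱ (λ t → fixed t ℤ.* fibre t) ≡⟨ cong₂ ℤ._-_ total (fibres f f-fixed) ⟩
        Q ℤ.* Q ℤ.- Q ℤ.* Q ≡⟨ ℤ.+-inverseʳ (Q ℤ.* Q) ⟩
        0ℤ ∎

  trace-fibre : ∀ t → conj t ≡ t → ∑ᴱ (λ x → 𝟙 (trace x ≟ t)) ≡ Q
  trace-fibre = saturated trace (λ _ → Q) trace-fixed trace≤Q
    (trans (sum-*ʳ list Q fixed) (cong (ℤ._* Q) card-fixed))

  -- An empty fibre over t would turn the saturated bound into 0 = q + 1.
  norm-surjective : ∀ t → conj t ≡ t → t ≢ 0# → ∃ λ x → norm x ≡ t
  norm-surjective t t-fixed t≢0 with search (λ x → ¬? (norm x ≟ t))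
  ... | inj₂ (x , ¬¬e) = x , decidable-stable (norm x ≟ t) ¬¬e
  ... | inj₁ none = contradiction (begin
        0ℤ ≡⟨ sum-zero list ⟨
        ∑ᴱ (λ _ → 0ℤ) ≡⟨ sum-cong list (λ x → 𝟙-no (norm x ≟ t) (none x)) ⟨
        ∑ᴱ (λ x → 𝟙 (norm x ≟ t)) ≡⟨ saturated norm ub norm-fixed norm≤ub total t t-fixed ⟩
        ub t ≡⟨ ub-≢0 ⟩
        Q ℤ.+ 1ℤ ∎) (λ e → Q+1≢0 (sym e))
    where
    open ≡-Reasoning
    -- The bound is 1 at zero, whose only preimage is 0, and q + 1 elsewhere; over the q fixed
    -- values it adds up to 1 + (q - 1)(q + 1) = q².
    ub : Carrier → ℤ
    ub t = (Q ℤ.+ 1ℤ) ℤ.- Q ℤ.* 𝟙 (t ≟ 0#)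
    Q+1≢0 : Q ℤ.+ 1ℤ ≢ 0ℤ
    Q+1≢0 e = contradiction (trans (cong pos (ℕ.+-comm 1 q)) e) λ ()
    ub-≢0 : ub t ≡ Q ℤ.+ 1ℤ
    ub-≢0 = trans (cong (λ z → (Q ℤ.+ 1ℤ) ℤ.- Q ℤ.* z) (𝟙-no (t ≟ 0#) t≢0))
      (let open ℤ-Solver in solve 1 (λ Q → (Q :+ con 1ℤ) :- Q :* con 0ℤ := Q :+ con 1ℤ) refl Q)
    norm≤ub : ∀ t → ∑ᴱ (λ x → 𝟙 (norm x ≟ t)) ℤ.≤ ub t
    norm≤ub t with t ≟ 0#
    ... | no _ = ℤ.≤-trans (norm≤Q+1 t) (ℤ.≤-reflexive (let open ℤ-Solver in
            solve 1 (λ Q → Q :+ con 1ℤ := (Q :+ con 1ℤ) :- Q :* con 0ℤ) refl Q))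
    ... | yes refl = ℤ.≤-reflexive (trans (sum-cong list (λ x → 𝟙-cong (norm x ≟ 0#) (x ≟ 0#) norm≡0
              (λ e → trans (cong (conj x *_) e) (zeroʳ (conj x)))))
            (trans (count 0#) (let open ℤ-Solver in
              solve 1 (λ Q → con 1ℤ := (Q :+ con 1ℤ) :- Q :* con 1ℤ) refl Q)))
    total : ∑ᴱ (λ t → fixed t ℤ.* ub t) ≡ Q ℤ.* Q
    total = begin
      ∑ᴱ (λ t → fixed t ℤ.* ub t)
        ≡⟨ sum-cong list (λ t → let open ℤ-Solver in
             solve 3 (λ f Q d → f :* ((Q :+ con 1ℤ) :- Q :* d) := (Q :+ con 1ℤ) :* f :- Q :* (d :* f)) refl
               (fixed t) Q (𝟙 (t ≟ 0#))) ⟩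
      ∑ᴱ (λ t → (Q ℤ.+ 1ℤ) ℤ.* fixed t ℤ.- Q ℤ.* (𝟙 (t ≟ 0#) ℤ.* fixed t)) ≡⟨ sum-minus list _ _ ⟩
      ∑ᴱ (λ t → (Q ℤ.+ 1ℤ) ℤ.* fixed t) ℤ.- ∑ᴱ (λ t → Q ℤ.* (𝟙 (t ≟ 0#) ℤ.* fixed t))
        ≡⟨ cong₂ ℤ._-_ (sum-*ˡ list (Q ℤ.+ 1ℤ) fixed) (sum-*ˡ list Q _) ⟩
      (Q ℤ.+ 1ℤ) ℤ.* ∑ᴱ fixed ℤ.- Q ℤ.* ∑ᴱ (λ t → 𝟙 (t ≟ 0#) ℤ.* fixed t)
        ≡⟨ cong₂ (λ u v → (Q ℤ.+ 1ℤ) ℤ.* u ℤ.- Q ℤ.* v) card-fixed (trans (∑-δ 0# fixed) (𝟙-yes (conj 0# ≟ 0#) conj-0)) ⟩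
      (Q ℤ.+ 1ℤ) ℤ.* Q ℤ.- Q ℤ.* 1ℤ
        ≡⟨ (let open ℤ-Solver in solve 1 (λ Q → (Q :+ con 1ℤ) :* Q :- Q :* con 1ℤ := Q :* Q) refl Q) ⟩
      Q ℤ.* Q ∎

-- Integer arithmetic that determines a Gauss sum with its sign.

module GaussSum (q : ℕ) (q>1 : 1 ℕ.< q) where
  open ≡-Reasoning
  open ℤ-Solver

  Q : ℤ
  Q = pos q

  Q-1-nonZero : ℤ.NonZero (Q ℤ.- 1ℤ)
  Q-1-nonZero = ℤ.>-nonZero (ℤ.+-monoˡ-< (ℤ.- 1ℤ) {1ℤ} {Q} (ℤ.+<+ q>1))

  -- If g = -s, adding the two congruences makes q + 1 a divisor of 2, which is impossible for q >
  -- 1.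
  sign-mod : ∀ g s → g ℤ.* g ≡ s ℤ.* s → (∃ λ k → g ℤ.- 1ℤ ≡ (Q ℤ.+ 1ℤ) ℤ.* k) →
    (∃ λ l → s ℤ.- 1ℤ ≡ (Q ℤ.+ 1ℤ) ℤ.* l) → g ≡ s
  sign-mod g s g²≡s² (k , ek) (l , el) with ℤ.i*j≡0⇒i≡0∨j≡0 (g ℤ.- s) (trans
      (solve 2 (λ s t → (s :- t) :* (s :+ t) := s :* s :- t :* t) refl g s) (ℤ.i≡j⇒i-j≡0 g²≡s²))
  ... | inj₁ e = ℤ.i-j≡0⇒i≡j g s e
  ... | inj₂ e = contradiction (∣⇒≤ (divides ℤ.∣ k ℤ.+ l ∣ (trans (cong ℤ.∣_∣ -2≡) (ℤ.abs-* (k ℤ.+ l) (pos (suc q))))))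
                   (ℕ.<⇒≱ (ℕ.s≤s q>1))
    where
    -2≡ : ℤ.- pos 2 ≡ (k ℤ.+ l) ℤ.* pos (suc q)
    -2≡ = begin
      ℤ.- pos 2 ≡⟨ cong (ℤ._- pos 2) e ⟨
      (g ℤ.+ s) ℤ.- pos 2
        ≡⟨ solve 2 (λ s t → (s :+ t) :- con (pos 2) := (s :- con 1ℤ) :+ (t :- con 1ℤ)) refl g s ⟩
      (g ℤ.- 1ℤ) ℤ.+ (s ℤ.- 1ℤ) ≡⟨ cong₂ ℤ._+_ ek el ⟩
      (Q ℤ.+ 1ℤ) ℤ.* k ℤ.+ (Q ℤ.+ 1ℤ) ℤ.* l
        ≡⟨ solve 3 (λ Q k l → Q :* k :+ Q :* l := (k :+ l) :* Q) refl (Q ℤ.+ 1ℤ) k l ⟩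
      (k ℤ.+ l) ℤ.* (Q ℤ.+ 1ℤ) ≡⟨ cong ((k ℤ.+ l) ℤ.*_) (cong pos (ℕ.+-comm q 1)) ⟩
      (k ℤ.+ l) ℤ.* pos (suc q) ∎

  -- z vectors have value 0 and n vectors have any given nonzero value; z - n is the Gauss sum.
  zeros-from-moments : ∀ z n s → s ℤ.* s ≡ Q ℤ.* n ℤ.+ (z ℤ.- n) →
    Q ℤ.* (Q ℤ.* (n ℤ.* n) ℤ.+ (z ℤ.* z ℤ.- n ℤ.* n)) ≡ (s ℤ.* s) ℤ.* (s ℤ.* s) ℤ.+ (Q ℤ.- 1ℤ) ℤ.* (s ℤ.* s) →
    (∃ λ k → z ≡ 1ℤ ℤ.+ (Q ℤ.* Q ℤ.- 1ℤ) ℤ.* k) →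
    (∃ λ k → s ℤ.* s ℤ.- z ≡ 0ℤ ℤ.+ (Q ℤ.* Q ℤ.- 1ℤ) ℤ.* k) →
    (∃ λ k → s ℤ.- 1ℤ ≡ (Q ℤ.+ 1ℤ) ℤ.* k) →
    Q ℤ.* z ≡ s ℤ.* s ℤ.+ (Q ℤ.- 1ℤ) ℤ.* s
  zeros-from-moments z n s first second (k , z≡) (k′ , s²-z≡) s-mod = begin
    Q ℤ.* z
      ≡⟨ solve 3 (λ Q n z → Q :* z := (Q :* n :+ (z :- n)) :+ (Q :- con 1ℤ) :* (z :- n)) refl Q n z ⟩
    (Q ℤ.* n ℤ.+ (z ℤ.- n)) ℤ.+ (Q ℤ.- 1ℤ) ℤ.* (z ℤ.- n)
      ≡⟨ cong₂ (λ x y → x ℤ.+ (Q ℤ.- 1ℤ) ℤ.* y) (sym first) (sign-mod (z ℤ.- n) s g²≡s² g-mod s-mod) ⟩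
    s ℤ.* s ℤ.+ (Q ℤ.- 1ℤ) ℤ.* s ∎
    where
    -- A variance: q times the second moment minus the square of the first is (q - 1)(z - n)².
    g²≡s² : (z ℤ.- n) ℤ.* (z ℤ.- n) ≡ s ℤ.* s
    g²≡s² = ℤ.*-cancelˡ-≡ (Q ℤ.- 1ℤ) ((z ℤ.- n) ℤ.* (z ℤ.- n)) (s ℤ.* s) {{Q-1-nonZero}} (begin
      (Q ℤ.- 1ℤ) ℤ.* ((z ℤ.- n) ℤ.* (z ℤ.- n))
        ≡⟨ solve 3 (λ Q n z → (Q :- con 1ℤ) :* ((z :- n) :* (z :- n)) :=
             Q :* (Q :* (n :* n) :+ (z :* z :- n :* n)) :- (Q :* n :+ (z :- n)) :* (Q :* n :+ (z :- n))) refl Q n z ⟩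
      Q ℤ.* (Q ℤ.* (n ℤ.* n) ℤ.+ (z ℤ.* z ℤ.- n ℤ.* n)) ℤ.- (Q ℤ.* n ℤ.+ (z ℤ.- n)) ℤ.* (Q ℤ.* n ℤ.+ (z ℤ.- n))
        ≡⟨ cong₂ ℤ._-_ second (sym (cong₂ ℤ._*_ first first)) ⟩
      ((s ℤ.* s) ℤ.* (s ℤ.* s) ℤ.+ (Q ℤ.- 1ℤ) ℤ.* (s ℤ.* s)) ℤ.- (s ℤ.* s) ℤ.* (s ℤ.* s)
        ≡⟨ solve 2 (λ Q s → (s :* s :+ (Q :- con 1ℤ) :* s) :- s :* s := (Q :- con 1ℤ) :* s) refl Q (s ℤ.* s) ⟩
      (Q ℤ.- 1ℤ) ℤ.* (s ℤ.* s) ∎)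
    -- The s² - z vectors of nonzero value number (q - 1)n and form a multiple of q² - 1, so q + 1
    -- divides n.
    n≡ : n ≡ (Q ℤ.+ 1ℤ) ℤ.* k′
    n≡ = ℤ.*-cancelˡ-≡ (Q ℤ.- 1ℤ) n ((Q ℤ.+ 1ℤ) ℤ.* k′) {{Q-1-nonZero}} (begin
      (Q ℤ.- 1ℤ) ℤ.* n
        ≡⟨ solve 3 (λ Q n z → (Q :- con 1ℤ) :* n := (Q :* n :+ (z :- n)) :- z) refl Q n z ⟩
      (Q ℤ.* n ℤ.+ (z ℤ.- n)) ℤ.- z ≡⟨ cong (ℤ._- z) first ⟨
      s ℤ.* s ℤ.- z ≡⟨ s²-z≡ ⟩
      0ℤ ℤ.+ (Q ℤ.* Q ℤ.- 1ℤ) ℤ.* k′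
        ≡⟨ solve 2 (λ Q k → con 0ℤ :+ (Q :* Q :- con 1ℤ) :* k := (Q :- con 1ℤ) :* ((Q :+ con 1ℤ) :* k)) refl Q k′ ⟩
      (Q ℤ.- 1ℤ) ℤ.* ((Q ℤ.+ 1ℤ) ℤ.* k′) ∎)
    g-mod : ∃ λ k → (z ℤ.- n) ℤ.- 1ℤ ≡ (Q ℤ.+ 1ℤ) ℤ.* k
    g-mod = (Q ℤ.- 1ℤ) ℤ.* k ℤ.- k′ , (begin
      (z ℤ.- n) ℤ.- 1ℤ ≡⟨ cong₂ (λ z n → (z ℤ.- n) ℤ.- 1ℤ) z≡ n≡ ⟩
      ((1ℤ ℤ.+ (Q ℤ.* Q ℤ.- 1ℤ) ℤ.* k) ℤ.- (Q ℤ.+ 1ℤ) ℤ.* k′) ℤ.- 1ℤ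
        ≡⟨ solve 3 (λ Q k l → ((con 1ℤ :+ (Q :* Q :- con 1ℤ) :* k) :- (Q :+ con 1ℤ) :* l) :- con 1ℤ :=
             (Q :+ con 1ℤ) :* ((Q :- con 1ℤ) :* k :- l)) refl Q k k′ ⟩
      (Q ℤ.+ 1ℤ) ℤ.* ((Q ℤ.- 1ℤ) ℤ.* k ℤ.- k′) ∎)

-- Isotropic vectors of a nondegenerate hermitian form.

module HermitianSpaces {c} (q : ℕ) (pp : IsPrimePower q) (F : Field c) (iso : Field.Carrier F ↔ Fin (q ℕ.^ 2)) where
  open Field F
  open Conjugation q pp F iso public

  module Occurrences {a} {A : Set a} (xs : List A) (φ : A → Carrier) where
    occ : Carrier → ℤ
    occ t = sumOver xs (λ x → 𝟙 (φ x ≟ t))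

    -- The second moment of a value distribution counts colliding pairs. It is used for the Gauss
    -- sum of a form and again for the collisions of the pairing on U.
    ∑occ² : ∑ᴱ (λ t → occ t ℤ.* occ t) ≡ sumOver xs (λ x → sumOver xs (λ y → 𝟙 (φ x ≟ φ y)))
    ∑occ² = begin
      ∑ᴱ (λ t → occ t ℤ.* occ t)
        ≡⟨ sum-cong list (λ t → sum-*ʳ xs (occ t) (λ x → 𝟙 (φ x ≟ t))) ⟨
      ∑ᴱ (λ t → sumOver xs (λ x → 𝟙 (φ x ≟ t) ℤ.* occ t))
        ≡⟨ sum-swap list xs _ ⟩
      sumOver xs (λ x → ∑ᴱ (λ t → 𝟙 (φ x ≟ t) ℤ.* occ t))
        ≡⟨ sum-cong xs (λ x → trans (sum-cong list (λ t → cong (ℤ._* occ t) (𝟙-cong (φ x ≟ t) (t ≟ φ x) sym sym)))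
             (trans (∑-δ (φ x) occ) (sum-cong xs (λ y → 𝟙-cong (φ y ≟ φ x) (φ x ≟ φ y) sym sym)))) ⟩
      sumOver xs (λ x → sumOver xs (λ y → 𝟙 (φ x ≟ φ y))) ∎
      where open ≡-Reasoning

    ∑fixed*occ : (∀ {x} → x ∈ xs → conj (φ x) ≡ φ x) → ∑ᴱ (λ t → fixed t ℤ.* occ t) ≡ sumOver xs (λ _ → 1ℤ)
    ∑fixed*occ φ-fixed = begin
      ∑ᴱ (λ t → fixed t ℤ.* occ t) ≡⟨ sum-cong list (λ t → sum-*ˡ xs (fixed t) _) ⟨
      ∑ᴱ (λ t → sumOver xs (λ x → fixed t ℤ.* 𝟙 (φ x ≟ t))) ≡⟨ sum-swap list xs _ ⟩
      sumOver xs (λ x → ∑ᴱ (λ t → fixed t ℤ.* 𝟙 (φ x ≟ t)))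
        ≡⟨ sum-cong xs (λ x → trans (sum-cong list (λ t → trans (ℤ.*-comm (fixed t) _)
             (cong (ℤ._* fixed t) (𝟙-cong (φ x ≟ t) (t ≟ φ x) sym sym)))) (∑-δ (φ x) fixed)) ⟩
      sumOver xs (λ x → fixed (φ x))
        ≡⟨ sum-cong-∈ xs (λ {x} x∈ → 𝟙-yes (conj (φ x) ≟ φ x) (φ-fixed x∈)) ⟩
      sumOver xs (λ _ → 1ℤ) ∎
      where open ≡-Reasoning

    occ-nonfixed : (∀ {x} → x ∈ xs → conj (φ x) ≡ φ x) → ∀ {t} → conj t ≢ t → occ t ≡ 0ℤ
    occ-nonfixed φ-fixed {t} ne = trans (sum-cong-∈ xs (λ {x} x∈ → 𝟙-no (φ x ≟ t)
      (λ e → ne (subst (λ t → conj t ≡ t) e (φ-fixed x∈))))) (sum-zero xs)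

  -- The cardinality is recorded as σ², σ = (-q)^dim, since σ is the value of the Gauss sum of a
  -- nondegenerate hermitian form; its sign is pinned down by σ ≡ 1 mod q + 1.
  record Space : Set (Level.suc c) where
    infixl 6 _⊕_
    infixr 7 _·_
    field
      V : Set c
      enum : Enumeration V
      _⊕_ : V → V → V
      ⊖_ : V → V
      0ⱽ : V
      _·_ : Carrier → V → V
      ⊕-⊖ : ∀ u w → (u ⊕ w) ⊕ (⊖ w) ≡ u
      ⊖-⊕ : ∀ u w → (u ⊕ (⊖ w)) ⊕ w ≡ u
      ·-· : ∀ x y u → x · (y · u) ≡ (x * y) · u
      1· : ∀ u → 1# · u ≡ u
      0· : ∀ u → 0# · u ≡ 0ⱽ
      ·0ⱽ : ∀ x → x · 0ⱽ ≡ 0ⱽ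
      -- A scaling-equivariant function vanishing only at the zero vector; the value 1 selects one
      -- representative on each line.
      pivot : V → Carrier
      pivot-· : ∀ x u → pivot (x · u) ≡ x * pivot u
      pivot-0 : pivot 0ⱽ ≡ 0#
      pivot≡0 : ∀ u → pivot u ≡ 0# → u ≡ 0ⱽ
      σ : ℤ
      card-σ : Enumeration.card enum ≡ σ ℤ.* σ
      σ-mod : ∃ λ k → σ ℤ.- 1ℤ ≡ (Q ℤ.+ 1ℤ) ℤ.* k

    open Enumeration enum public using () renaming (list to vectors; _≟_ to _≟ⱽ_; ∑ᴱ to ∑ⱽ; count to countⱽ; search to searchⱽ; ∑-δ to ∑ⱽ-δ)

    ∑-translate : ∀ w (f : V → ℤ) → ∑ⱽ (λ u → f (u ⊕ w)) ≡ ∑ⱽ f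
    ∑-translate w = ∑-bijection enum enum (_⊕ w) (_⊕ (⊖ w)) (λ u → ⊕-⊖ u w) (λ u → ⊖-⊕ u w)

    ∑-scale : ∀ x → x ≢ 0# → (f : V → ℤ) → ∑ⱽ (λ u → f (x · u)) ≡ ∑ⱽ f
    ∑-scale x x≢0 = let y , xy≡1 = inverse x x≢0 in
      ∑-bijection enum enum (x ·_) (y ·_)
        (λ u → trans (·-· y x u) (trans (cong (_· u) (trans (*-comm y x) xy≡1)) (1· u)))
        (λ u → trans (·-· x y u) (trans (cong (_· u) xy≡1) (1· u)))

    -- The nonzero vectors fall into orbits of size q² - 1 under scaling.
    ∑-scaleInvariant : (P : V → ℤ) → (∀ x u → x ≢ 0# → P (x · u) ≡ P u) →
      ∃ λ k → ∑ⱽ P ≡ P 0ⱽ ℤ.+ (Q ℤ.* Q ℤ.- 1ℤ) ℤ.* k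
    ∑-scaleInvariant P P-· = k , (begin
      ∑ⱽ P
        ≡⟨ sum-cong vectors (λ v → ∑-δ (pivot v) (λ _ → P v)) ⟨
      ∑ⱽ (λ v → ∑ᴱ (λ x → 𝟙 (x ≟ pivot v) ℤ.* P v))
        ≡⟨ sum-swap vectors list _ ⟩
      ∑ᴱ slice
        ≡⟨ sum-cong list slice≡ ⟩
      ∑ᴱ (λ x → k ℤ.+ 𝟙 (x ≟ 0#) ℤ.* (P 0ⱽ ℤ.- k))
        ≡⟨ sum-+ list (λ _ → k) _ ⟩
      ∑ᴱ (λ _ → k) ℤ.+ ∑ᴱ (λ x → 𝟙 (x ≟ 0#) ℤ.* (P 0ⱽ ℤ.- k))
        ≡⟨ cong₂ ℤ._+_ (trans (sum-const list k) (cong (ℤ._* k) card-F)) (∑-δ 0# (λ _ → P 0ⱽ ℤ.- k)) ⟩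
      Q ℤ.* Q ℤ.* k ℤ.+ (P 0ⱽ ℤ.- k)
        ≡⟨ (let open ℤ-Solver in solve 3 (λ Q k p → Q :* Q :* k :+ (p :- k) := p :+ (Q :* Q :- con 1ℤ) :* k) refl Q k (P 0ⱽ)) ⟩
      P 0ⱽ ℤ.+ (Q ℤ.* Q ℤ.- 1ℤ) ℤ.* k ∎)
      where
      open ≡-Reasoning
      -- The sum is cut by the value of the pivot. The slice at 0 holds only `0ⱽ`, and scaling
      -- carries the slice at 1 to the slice at any nonzero x.
      slice : Carrier → ℤ
      slice x = ∑ⱽ (λ v → 𝟙 (x ≟ pivot v) ℤ.* P v)
      k : ℤ
      k = slice 1#
      slice≡ : ∀ x → slice x ≡ k ℤ.+ 𝟙 (x ≟ 0#) ℤ.* (P 0ⱽ ℤ.- k)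
      slice≡ x with x ≟ 0#
      ... | yes refl = begin
        slice 0#
          ≡⟨ sum-cong vectors (λ v → cong (ℤ._* P v) (𝟙-cong (0# ≟ pivot v) (v ≟ⱽ 0ⱽ)
               (λ e → pivot≡0 v (sym e)) (λ e → sym (trans (cong pivot e) pivot-0)))) ⟩
        ∑ⱽ (λ v → 𝟙 (v ≟ⱽ 0ⱽ) ℤ.* P v) ≡⟨ ∑ⱽ-δ 0ⱽ P ⟩
        P 0ⱽ
          ≡⟨ (let open ℤ-Solver in solve 2 (λ k p → p := k :+ con 1ℤ :* (p :- k)) refl k (P 0ⱽ)) ⟩
        k ℤ.+ 1ℤ ℤ.* (P 0ⱽ ℤ.- k) ∎
      ... | no x≢0 = begin
        slice x
          ≡⟨ ∑-scale x x≢0 (λ v → 𝟙 (x ≟ pivot v) ℤ.* P v) ⟨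
        ∑ⱽ (λ v → 𝟙 (x ≟ pivot (x · v)) ℤ.* P (x · v))
          ≡⟨ sum-cong vectors (λ v → cong₂ ℤ._*_ (𝟙-cong (x ≟ pivot (x · v)) (1# ≟ pivot v) (cancel v) (scale v)) (P-· x v x≢0)) ⟩
        k ≡⟨ ℤ.+-identityʳ k ⟨
        k ℤ.+ 0ℤ ∎
        where
        open Solver using (solve; _:+_; _:*_; :-_; _:=_; con)
        scale : ∀ v → 1# ≡ pivot v → x ≡ pivot (x · v)
        scale v e = trans (sym (*-identityʳ x)) (trans (cong (x *_) e) (sym (pivot-· x v)))
        cancel : ∀ v → x ≡ pivot (x · v) → 1# ≡ pivot v
        cancel v e = x-y≡0⇒x≡y (*-zero-product x≢0 (trans
          (solve 2 (λ x p → x :* (con 1ℤ :+ :- p) := x :+ :- (x :* p)) refl x (pivot v))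
          (x≡y⇒x-y≡0 (trans e (pivot-· x v)))))

  record HermitianForm (𝒮 : Space) : Set c where
    open Space 𝒮
    field
      form : V → V → Carrier
      form-⊕ : ∀ u v w → form u (v ⊕ w) ≡ form u v + form u w
      form-· : ∀ u x v → form u (x · v) ≡ x * form u v
      form-sym : ∀ u v → conj (form u v) ≡ form v u

    Nondegenerate : Set c
    Nondegenerate = ∀ u → (∀ v → form u v ≡ 0#) → u ≡ 0ⱽ

    h : V → Carrier
    h v = form v v

    h-fixed : ∀ v → conj (h v) ≡ h v
    h-fixed v = form-sym v v

    form-⊕ˡ : ∀ u v w → form (u ⊕ v) w ≡ form u w + form v w
    form-⊕ˡ u v w = begin
      form (u ⊕ v) w ≡⟨ form-sym w (u ⊕ v) ⟨
      conj (form w (u ⊕ v)) ≡⟨ cong conj (form-⊕ w u v) ⟩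
      conj (form w u + form w v) ≡⟨ conj-+ _ _ ⟩
      conj (form w u) + conj (form w v) ≡⟨ cong₂ _+_ (form-sym w u) (form-sym w v) ⟩
      form u w + form v w ∎
      where open ≡-Reasoning

    form-·ˡ : ∀ x u v → form (x · u) v ≡ conj x * form u v
    form-·ˡ x u v = begin
      form (x · u) v ≡⟨ form-sym v (x · u) ⟨
      conj (form v (x · u)) ≡⟨ cong conj (form-· v x u) ⟩
      conj (x * form v u) ≡⟨ conj-* _ _ ⟩
      conj x * conj (form v u) ≡⟨ cong (conj x *_) (form-sym v u) ⟩
      conj x * form u v ∎
      where open ≡-Reasoning

    form-0ˡ : ∀ v → form 0ⱽ v ≡ 0#
    form-0ˡ v = begin
      form 0ⱽ v ≡⟨ cong (λ u → form u v) (0· 0ⱽ) ⟨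
      form (0# · 0ⱽ) v ≡⟨ form-·ˡ 0# 0ⱽ v ⟩
      conj 0# * form 0ⱽ v ≡⟨ cong (_* form 0ⱽ v) conj-0 ⟩
      0# * form 0ⱽ v ≡⟨ zeroˡ _ ⟩
      0# ∎
      where open ≡-Reasoning

    h-· : ∀ x v → h (x · v) ≡ norm x * h v
    h-· x v = begin
      form (x · v) (x · v) ≡⟨ form-· (x · v) x v ⟩
      x * form (x · v) v ≡⟨ cong (x *_) (form-·ˡ x v v) ⟩
      x * (conj x * h v) ≡⟨ solve 3 (λ x y z → x :* (y :* z) := (y :* x) :* z) refl x (conj x) (h v) ⟩
      norm x * h v ∎
      where
      open ≡-Reasoning
      open Solver using (solve; _:*_; _:=_)

    -- Polarisation: for a fixed difference u, the collision `h (u ⊕ w) ≡ h w` becomes an affine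
    -- trace condition on w, whose solutions can be counted.
    h-⊕ : ∀ u w → h (u ⊕ w) + - h w ≡ h u + trace (form u w)
    h-⊕ u w = begin
      form (u ⊕ w) (u ⊕ w) + - h w ≡⟨ cong (_+ - h w) (form-⊕ (u ⊕ w) u w) ⟩
      (form (u ⊕ w) u + form (u ⊕ w) w) + - h w
        ≡⟨ cong (_+ - h w) (cong₂ _+_ (form-⊕ˡ u w u) (form-⊕ˡ u w w)) ⟩
      ((h u + form w u) + (form u w + h w)) + - h w
        ≡⟨ solve 4 (λ a b c d → ((a :+ b) :+ (c :+ d)) :+ :- d := a :+ (c :+ b)) refl (h u) (form w u) (form u w) (h w) ⟩
      h u + (form u w + form w u) ≡⟨ cong (λ z → h u + (form u w + z)) (form-sym u w) ⟨
      h u + trace (form u w) ∎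
      where
      open ≡-Reasoning
      open Solver using (solve; _:+_; :-_; _:=_)

    zeros : ℤ
    zeros = ∑ⱽ (λ v → 𝟙 (h v ≟ 0#))

    private module ZeroCount (nondegenerate : Nondegenerate) where
      open Occurrences vectors h

      solutions : V → ℤ
      solutions u = ∑ⱽ (λ w → 𝟙 (h u + trace (form u w) ≟ 0#))

      ∑occ²≡∑solutions : ∑ᴱ (λ t → occ t ℤ.* occ t) ≡ ∑ⱽ solutions
      ∑occ²≡∑solutions = begin
        ∑ᴱ (λ t → occ t ℤ.* occ t) ≡⟨ ∑occ² ⟩
        ∑ⱽ (λ v → ∑ⱽ (λ w → 𝟙 (h v ≟ h w))) ≡⟨ sum-swap vectors vectors _ ⟩
        ∑ⱽ (λ w → ∑ⱽ (λ v → 𝟙 (h v ≟ h w))) ≡⟨ sum-cong vectors (λ w → ∑-translate w (λ v → 𝟙 (h v ≟ h w))) ⟨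
        ∑ⱽ (λ w → ∑ⱽ (λ u → 𝟙 (h (u ⊕ w) ≟ h w)))
          ≡⟨ sum-cong vectors (λ w → sum-cong vectors (λ u → 𝟙-cong (h (u ⊕ w) ≟ h w) (h u + trace (form u w) ≟ 0#)
               (λ e → trans (sym (h-⊕ u w)) (x≡y⇒x-y≡0 e)) (λ e → x-y≡0⇒x≡y (trans (h-⊕ u w) e)))) ⟩
        ∑ⱽ (λ w → ∑ⱽ (λ u → 𝟙 (h u + trace (form u w) ≟ 0#))) ≡⟨ sum-swap vectors vectors _ ⟩
        ∑ⱽ solutions ∎
        where open ≡-Reasoning

      unitPartner : ∀ u → u ≢ 0ⱽ → ∃ λ w → form u w ≡ 1#
      unitPartner u u≢0 with searchⱽ (λ v → form u v ≟ 0#)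
      ... | inj₁ all = contradiction (nondegenerate u all) u≢0
      ... | inj₂ (w , ne) = let y , e = inverse (form u w) ne in
        y · w , trans (form-· u y w) (trans (*-comm y _) e)

      trace-+ : ∀ x y → trace (x + y) ≡ trace x + trace y
      trace-+ x y = trans (cong ((x + y) +_) (conj-+ x y))
        (let open Solver in solve 4 (λ a b c d → (a :+ b) :+ (c :+ d) := (a :+ c) :+ (b :+ d)) refl x y (conj x) (conj y))

      -- Averaging over the translates w + x w₁ with `form u w₁ ≡ 1#` turns the condition into a
      -- prescribed trace of x, met by q of the q² scalars. A fraction 1/q of all w are therefore
      -- solutions.
      solutions-≢0 : ∀ u → u ≢ 0ⱽ → Q ℤ.* solutions u ≡ σ ℤ.* σ
      solutions-≢0 u u≢0 = ℤ.*-cancelʳ-≡ (Q ℤ.* solutions u) (σ ℤ.* σ) Q (begin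
        Q ℤ.* solutions u ℤ.* Q
          ≡⟨ (let open ℤ-Solver in solve 2 (λ Q s → Q :* s :* Q := Q :* Q :* s) refl Q (solutions u)) ⟩
        Q ℤ.* Q ℤ.* solutions u
          ≡⟨ cong (ℤ._* solutions u) card-F ⟨
        ∑ᴱ (λ _ → 1ℤ) ℤ.* solutions u
          ≡⟨ sum-const list (solutions u) ⟨
        ∑ᴱ (λ x → solutions u)
          ≡⟨ sum-cong list (λ x → ∑-translate (x · w₁) (λ w → 𝟙 (value w ≟ 0#))) ⟨
        ∑ᴱ (λ x → ∑ⱽ (λ w → 𝟙 (value (w ⊕ x · w₁) ≟ 0#)))
          ≡⟨ sum-swap list vectors _ ⟩
        ∑ⱽ (λ w → ∑ᴱ (λ x → 𝟙 (value (w ⊕ x · w₁) ≟ 0#)))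
          ≡⟨ sum-cong vectors (λ w → trans (sum-cong list (λ x → 𝟙-cong (value (w ⊕ x · w₁) ≟ 0#) (trace x ≟ - value w)
               (λ e → x-y≡0⇒x≡y (trans (shifted w x) e)) (λ e → trans (sym (shifted w x)) (x≡y⇒x-y≡0 e))))
               (trace-fibre (- value w) (trans (conj-neg (value w)) (cong -_ (value-fixed w))))) ⟩
        ∑ⱽ (λ w → Q) ≡⟨ trans (sum-const vectors Q) (cong (ℤ._* Q) card-σ) ⟩
        σ ℤ.* σ ℤ.* Q ∎)
        where
        open ≡-Reasoning
        w₁ : V
        w₁ = proj₁ (unitPartner u u≢0)
        value : V → Carrier
        value w = h u + trace (form u w)
        value-fixed : ∀ w → conj (value w) ≡ value w
        value-fixed w = trans (conj-+ _ _) (cong₂ _+_ (h-fixed u) (trace-fixed (form u w)))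
        shifted : ∀ w x → trace x + - - value w ≡ value (w ⊕ x · w₁)
        shifted w x = begin
          trace x + - - value w
            ≡⟨ (let open Solver in solve 3 (λ t h s → t :+ :- (:- (h :+ s)) := h :+ (s :+ t)) refl (trace x) (h u) (trace (form u w))) ⟩
          h u + (trace (form u w) + trace x) ≡⟨ cong (h u +_) (trace-+ (form u w) x) ⟨
          h u + trace (form u w + x)
            ≡⟨ cong (λ z → h u + trace (form u w + z)) (trans (cong (x *_) (proj₂ (unitPartner u u≢0))) (*-identityʳ x)) ⟨
          h u + trace (form u w + x * form u w₁) ≡⟨ cong (λ z → h u + trace (form u w + z)) (form-· u x w₁) ⟨
          h u + trace (form u w + form u (x · w₁)) ≡⟨ cong (λ z → h u + trace z) (form-⊕ u w (x · w₁)) ⟨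
          value (w ⊕ x · w₁) ∎

      Q*solutions : ∀ u → Q ℤ.* solutions u ≡ σ ℤ.* σ ℤ.+ 𝟙 (u ≟ⱽ 0ⱽ) ℤ.* ((Q ℤ.- 1ℤ) ℤ.* (σ ℤ.* σ))
      Q*solutions u with u ≟ⱽ 0ⱽ
      ... | no u≢0 = trans (solutions-≢0 u u≢0) (sym (ℤ.+-identityʳ (σ ℤ.* σ)))
      ... | yes refl = trans (cong (Q ℤ.*_) (trans (sum-cong vectors (λ w → 𝟙-yes (h 0ⱽ + trace (form 0ⱽ w) ≟ 0#) (zero-value w))) card-σ))
        (let open ℤ-Solver in solve 2 (λ Q s → Q :* s := s :+ con 1ℤ :* ((Q :- con 1ℤ) :* s)) refl Q (σ ℤ.* σ))
        where
        zero-value : ∀ w → h 0ⱽ + trace (form 0ⱽ w) ≡ 0#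
        zero-value w = begin
          h 0ⱽ + trace (form 0ⱽ w) ≡⟨ cong₂ (λ x y → x + trace y) (form-0ˡ 0ⱽ) (form-0ˡ w) ⟩
          0# + (0# + conj 0#) ≡⟨ trans (+-identityˡ _) (trans (+-identityˡ _) conj-0) ⟩
          0# ∎
          where open ≡-Reasoning

      second-moment : Q ℤ.* ∑ᴱ (λ t → occ t ℤ.* occ t) ≡
        (σ ℤ.* σ) ℤ.* (σ ℤ.* σ) ℤ.+ (Q ℤ.- 1ℤ) ℤ.* (σ ℤ.* σ)
      second-moment = begin
        Q ℤ.* ∑ᴱ (λ t → occ t ℤ.* occ t) ≡⟨ cong (Q ℤ.*_) ∑occ²≡∑solutions ⟩
        Q ℤ.* ∑ⱽ solutions ≡⟨ sum-*ˡ vectors Q solutions ⟨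
        ∑ⱽ (λ u → Q ℤ.* solutions u) ≡⟨ sum-cong vectors Q*solutions ⟩
        ∑ⱽ (λ u → σ ℤ.* σ ℤ.+ 𝟙 (u ≟ⱽ 0ⱽ) ℤ.* ((Q ℤ.- 1ℤ) ℤ.* (σ ℤ.* σ)))
          ≡⟨ sum-+ vectors (λ _ → σ ℤ.* σ) _ ⟩
        ∑ⱽ (λ u → σ ℤ.* σ) ℤ.+ ∑ⱽ (λ u → 𝟙 (u ≟ⱽ 0ⱽ) ℤ.* ((Q ℤ.- 1ℤ) ℤ.* (σ ℤ.* σ)))
          ≡⟨ cong₂ ℤ._+_ (trans (sum-const vectors (σ ℤ.* σ)) (cong (ℤ._* (σ ℤ.* σ)) card-σ)) (∑ⱽ-δ 0ⱽ _) ⟩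
        (σ ℤ.* σ) ℤ.* (σ ℤ.* σ) ℤ.+ (Q ℤ.- 1ℤ) ℤ.* (σ ℤ.* σ) ∎
        where open ≡-Reasoning

      N : ℤ
      N = occ 1#

      -- Scaling by an element of norm t multiplies h by t, and the norm is onto, so all nonzero
      -- fixed values are equally frequent.
      occ-≢0 : ∀ t → conj t ≡ t → t ≢ 0# → occ t ≡ N
      occ-≢0 t t-fixed t≢0 = let x , nx = norm-surjective t t-fixed t≢0 in begin
        occ t
          ≡⟨ ∑-scale x (λ e → t≢0 (trans (sym nx) (trans (cong (conj x *_) e) (zeroʳ _)))) (λ v → 𝟙 (h v ≟ t)) ⟨
        ∑ⱽ (λ v → 𝟙 (h (x · v) ≟ t))
          ≡⟨ sum-cong vectors (λ v → 𝟙-cong (h (x · v) ≟ t) (h v ≟ 1#)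
               (λ e → x-y≡0⇒x≡y (*-zero-product t≢0 (trans (distr v) (x≡y⇒x-y≡0 (trans (sym (scaled x nx v)) e)))))
               (λ e → trans (scaled x nx v) (trans (cong (t *_) e) (*-identityʳ t)))) ⟩
        N ∎
        where
        open ≡-Reasoning
        scaled : ∀ x → norm x ≡ t → ∀ v → h (x · v) ≡ t * h v
        scaled x nx v = trans (h-· x v) (cong (_* h v) nx)
        distr : ∀ v → t * (h v + - 1#) ≡ t * h v + - t
        distr v = let open Solver in solve 2 (λ t x → t :* (x :+ :- con 1ℤ) := t :* x :+ :- t) refl t (h v)

      -- Both `occ` and its square become combinations of `fixed` and the indicator at zero, so
      -- `∑-fixed-δ` evaluates the two moments. The decisions are arguments so that the cases can be
      -- matched.
      occ≡ : ∀ t (d : Dec (conj t ≡ t)) (e : Dec (t ≡ 0#)) →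
        (𝟙 d ℤ.* occ t ≡ 𝟙 d ℤ.* N ℤ.+ 𝟙 e ℤ.* (zeros ℤ.- N)) ×
        (occ t ℤ.* occ t ≡ 𝟙 d ℤ.* (N ℤ.* N) ℤ.+ 𝟙 e ℤ.* (zeros ℤ.* zeros ℤ.- N ℤ.* N))
      occ≡ t (no ne) (yes e) = contradiction (subst (λ t → conj t ≡ t) (sym e) conj-0) ne
      occ≡ t (no ne) (no _) = refl , cong₂ ℤ._*_ (occ-nonfixed (λ {x} _ → h-fixed x) ne) (occ-nonfixed (λ {x} _ → h-fixed x) ne)
      occ≡ t (yes _) (yes e) =
        trans (cong (λ t → 1ℤ ℤ.* occ t) e) (at-0 zeros N) ,
        trans (cong (λ t → occ t ℤ.* occ t) e) (at-0² zeros N)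
        where
        open ℤ-Solver
        at-0 : ∀ z n → 1ℤ ℤ.* z ≡ 1ℤ ℤ.* n ℤ.+ 1ℤ ℤ.* (z ℤ.- n)
        at-0 = solve 2 (λ z n → con 1ℤ :* z := con 1ℤ :* n :+ con 1ℤ :* (z :- n)) refl
        at-0² : ∀ z n → z ℤ.* z ≡ 1ℤ ℤ.* (n ℤ.* n) ℤ.+ 1ℤ ℤ.* (z ℤ.* z ℤ.- n ℤ.* n)
        at-0² = solve 2 (λ z n → z :* z := con 1ℤ :* (n :* n) :+ con 1ℤ :* (z :* z :- n :* n)) refl
      occ≡ t (yes d) (no t≢0) =
        trans (cong (1ℤ ℤ.*_) (occ-≢0 t d t≢0)) (off-0 N (zeros ℤ.- N)) ,
        trans (cong₂ ℤ._*_ (occ-≢0 t d t≢0) (occ-≢0 t d t≢0)) (off-0² N (zeros ℤ.* zeros ℤ.- N ℤ.* N))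
        where
        open ℤ-Solver
        off-0 : ∀ n z → 1ℤ ℤ.* n ≡ 1ℤ ℤ.* n ℤ.+ 0ℤ ℤ.* z
        off-0 = solve 2 (λ n z → con 1ℤ :* n := con 1ℤ :* n :+ con 0ℤ :* z) refl
        off-0² : ∀ n z → n ℤ.* n ≡ 1ℤ ℤ.* (n ℤ.* n) ℤ.+ 0ℤ ℤ.* z
        off-0² = solve 2 (λ n z → n :* n := con 1ℤ :* (n :* n) :+ con 0ℤ :* z) refl

      ∑-fixed-δ : ∀ a b → ∑ᴱ (λ t → fixed t ℤ.* a ℤ.+ 𝟙 (t ≟ 0#) ℤ.* b) ≡ Q ℤ.* a ℤ.+ b
      ∑-fixed-δ a b = trans (sum-+ list _ _)
        (cong₂ ℤ._+_ (trans (sum-*ʳ list a fixed) (cong (ℤ._* a) card-fixed)) (∑-δ 0# (λ _ → b)))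

      first-moment : σ ℤ.* σ ≡ Q ℤ.* N ℤ.+ (zeros ℤ.- N)
      first-moment = begin
        σ ℤ.* σ ≡⟨ card-σ ⟨
        ∑ⱽ (λ _ → 1ℤ) ≡⟨ ∑fixed*occ (λ {x} _ → h-fixed x) ⟨
        ∑ᴱ (λ t → fixed t ℤ.* occ t) ≡⟨ sum-cong list (λ t → proj₁ (occ≡ t (conj t ≟ t) (t ≟ 0#))) ⟩
        ∑ᴱ (λ t → fixed t ℤ.* N ℤ.+ 𝟙 (t ≟ 0#) ℤ.* (zeros ℤ.- N)) ≡⟨ ∑-fixed-δ N _ ⟩
        Q ℤ.* N ℤ.+ (zeros ℤ.- N) ∎
        where open ≡-Reasoning

      isotropic-· : ∀ x v → x ≢ 0# → 𝟙 (h (x · v) ≟ 0#) ≡ 𝟙 (h v ≟ 0#)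
      isotropic-· x v x≢0 = 𝟙-cong (h (x · v) ≟ 0#) (h v ≟ 0#)
        (λ e → *-zero-product (λ e′ → x≢0 (norm≡0 e′)) (trans (sym (h-· x v)) e))
        (λ e → trans (h-· x v) (trans (cong (norm x *_) e) (zeroʳ _)))

      zeros-mod : ∃ λ k → zeros ≡ 1ℤ ℤ.+ (Q ℤ.* Q ℤ.- 1ℤ) ℤ.* k
      zeros-mod = let k , e = ∑-scaleInvariant (λ v → 𝟙 (h v ≟ 0#)) isotropic-· in
        k , trans e (cong (ℤ._+ (Q ℤ.* Q ℤ.- 1ℤ) ℤ.* k) (𝟙-yes (h 0ⱽ ≟ 0#) (form-0ˡ 0ⱽ)))

      -- The Gauss sum is `zeros` minus N; its residue modulo q + 1 needs the anisotropic vectors as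
      -- well, since they determine N.
      nonzeros-mod : ∃ λ k → σ ℤ.* σ ℤ.- zeros ≡ 0ℤ ℤ.+ (Q ℤ.* Q ℤ.- 1ℤ) ℤ.* k
      nonzeros-mod = let k , e = ∑-scaleInvariant (λ v → 1ℤ ℤ.- 𝟙 (h v ≟ 0#)) (λ x v x≢0 → cong (λ z → 1ℤ ℤ.- z) (isotropic-· x v x≢0)) in
        k , (begin
          σ ℤ.* σ ℤ.- zeros ≡⟨ cong (ℤ._- zeros) card-σ ⟨
          ∑ⱽ (λ _ → 1ℤ) ℤ.- zeros ≡⟨ sum-minus vectors (λ _ → 1ℤ) _ ⟨
          ∑ⱽ (λ v → 1ℤ ℤ.- 𝟙 (h v ≟ 0#)) ≡⟨ e ⟩
          (1ℤ ℤ.- 𝟙 (h 0ⱽ ≟ 0#)) ℤ.+ (Q ℤ.* Q ℤ.- 1ℤ) ℤ.* k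
            ≡⟨ cong (λ z → (1ℤ ℤ.- z) ℤ.+ (Q ℤ.* Q ℤ.- 1ℤ) ℤ.* k) (𝟙-yes (h 0ⱽ ≟ 0#) (form-0ˡ 0ⱽ)) ⟩
          0ℤ ℤ.+ (Q ℤ.* Q ℤ.- 1ℤ) ℤ.* k ∎)
        where open ≡-Reasoning

      Q*zeros : Q ℤ.* zeros ≡ σ ℤ.* σ ℤ.+ (Q ℤ.- 1ℤ) ℤ.* σ
      Q*zeros = GaussSum.zeros-from-moments q q>1 zeros N σ first-moment
        (trans (cong (Q ℤ.*_) (sym (trans (sum-cong list (λ t → proj₂ (occ≡ t (conj t ≟ t) (t ≟ 0#)))) (∑-fixed-δ (N ℤ.* N) _)))) second-moment)
        zeros-mod nonzeros-mod σ-mod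

    -- The classical number of isotropic vectors, the zero vector included, kept multiplied by q.
    Q*zeros : Nondegenerate → Q ℤ.* zeros ≡ σ ℤ.* σ ℤ.+ (Q ℤ.- 1ℤ) ℤ.* σ
    Q*zeros nondegenerate = ZeroCount.Q*zeros nondegenerate

-- Isotropic independent pairs for the form M ⊗ b.

module ProductSpaces {c} (q : ℕ) (pp : IsPrimePower q) (F : Field c) (iso : Field.Carrier F ↔ Fin (q ℕ.^ 2)) where
  open Field F
  open HermitianSpaces q pp F iso public

  product-mod : ∀ s t → (∃ λ k → s ℤ.- 1ℤ ≡ (Q ℤ.+ 1ℤ) ℤ.* k) → (∃ λ l → t ℤ.- 1ℤ ≡ (Q ℤ.+ 1ℤ) ℤ.* l) →
    ∃ λ m → s ℤ.* t ℤ.- 1ℤ ≡ (Q ℤ.+ 1ℤ) ℤ.* m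
  product-mod s t (k , ek) (l , el) = s ℤ.* l ℤ.+ k , (begin
    s ℤ.* t ℤ.- 1ℤ ≡⟨ solve 2 (λ s t → s :* t :- con 1ℤ := s :* (t :- con 1ℤ) :+ (s :- con 1ℤ)) refl s t ⟩
    s ℤ.* (t ℤ.- 1ℤ) ℤ.+ (s ℤ.- 1ℤ) ≡⟨ cong₂ (λ x y → s ℤ.* x ℤ.+ y) el ek ⟩
    s ℤ.* ((Q ℤ.+ 1ℤ) ℤ.* l) ℤ.+ (Q ℤ.+ 1ℤ) ℤ.* k
      ≡⟨ solve 4 (λ s Q k l → s :* (Q :* l) :+ Q :* k := Q :* (s :* l :+ k)) refl s (Q ℤ.+ 1ℤ) k l ⟩
    (Q ℤ.+ 1ℤ) ℤ.* (s ℤ.* l ℤ.+ k) ∎)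
    where
    open ≡-Reasoning
    open ℤ-Solver

  -Q-mod : ∃ λ k → ℤ.- Q ℤ.- 1ℤ ≡ (Q ℤ.+ 1ℤ) ℤ.* k
  -Q-mod = ℤ.- 1ℤ , solve 1 (λ Q → :- Q :- con 1ℤ := (Q :+ con 1ℤ) :* :- con 1ℤ) refl Q
    where open ℤ-Solver

  -- The pivot of a product, computed from an explicit decision so that proofs can match on it.
  firstNonzero : ∀ {x : Carrier} → Dec (x ≡ 0#) → Carrier → Carrier
  firstNonzero (yes _) y = y
  firstNonzero {x} (no _) y = x

  firstNonzero-* : ∀ a {x y x′} (d : Dec (x ≡ 0#)) (d′ : Dec (x′ ≡ 0#)) → x′ ≡ a * x →
    firstNonzero d′ (a * y) ≡ a * firstNonzero d y
  firstNonzero-* a {x} {y} {x′} (yes x≡0) (yes _) e = refl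
  firstNonzero-* a {x} {y} {x′} (yes x≡0) (no ne) e = contradiction (trans e (trans (cong (a *_) x≡0) (zeroʳ a))) ne
  firstNonzero-* a {x} {y} {x′} (no x≢0) (no _) e = e
  firstNonzero-* a {x} {y} {x′} (no x≢0) (yes x′≡0) e =
    trans (cong (_* y) a≡0) (trans (zeroˡ y) (sym (trans (cong (_* x) a≡0) (zeroˡ x))))
    where
    a≡0 : a ≡ 0#
    a≡0 = *-zero-product x≢0 (trans (*-comm x a) (trans (sym e) x′≡0))

  firstNonzero-0 : ∀ {x y} (d : Dec (x ≡ 0#)) → x ≡ 0# → y ≡ 0# → firstNonzero d y ≡ 0#
  firstNonzero-0 (yes _) _ y≡0 = y≡0
  firstNonzero-0 (no ne) x≡0 _ = contradiction x≡0 ne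

  firstNonzero≡0 : ∀ {x y} (d : Dec (x ≡ 0#)) → firstNonzero d y ≡ 0# → x ≡ 0# × y ≡ 0#
  firstNonzero≡0 (yes x≡0) y≡0 = x≡0 , y≡0
  firstNonzero≡0 (no ne) x≡0 = contradiction x≡0 ne

  lineSpace : Space
  lineSpace = record
    { V = Carrier ; enum = E
    ; _⊕_ = _+_ ; ⊖_ = -_ ; 0ⱽ = 0# ; _·_ = _*_
    ; ⊕-⊖ = solve 2 (λ u w → (u :+ w) :+ :- w := u) refl
    ; ⊖-⊕ = solve 2 (λ u w → (u :+ :- w) :+ w := u) refl
    ; ·-· = λ x y u → sym (*-assoc x y u)
    ; 1· = *-identityˡ ; 0· = zeroˡ ; ·0ⱽ = zeroʳ
    ; pivot = λ x → x ; pivot-· = λ _ _ → refl ; pivot-0 = refl ; pivot≡0 = λ _ e → e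
    -- Of the two square roots of q², this is the one congruent to 1 modulo q + 1.
    ; σ = ℤ.- Q
    ; card-σ = trans card-F (square-neg Q)
    ; σ-mod = -Q-mod
    }
    where
    open Solver using (solve; _:+_; :-_; _:=_)
    square-neg : ∀ i → i ℤ.* i ≡ ℤ.- i ℤ.* ℤ.- i
    square-neg = let module I = ℤ-Solver in I.solve 1 (λ i → i I.:* i I.:= I.:- i I.:* I.:- i) refl

  module _ (𝒮 𝒯 : Space) where
    private
      module S = Space 𝒮
      module T = Space 𝒯

    productSpace : Space
    productSpace = record
      { V = S.V × T.V ; enum = ×-Enumeration S.enum T.enum
      ; _⊕_ = λ (u , u′) (v , v′) → u S.⊕ v , u′ T.⊕ v′
      ; ⊖_ = λ (u , u′) → S.⊖ u , T.⊖ u′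
      ; 0ⱽ = S.0ⱽ , T.0ⱽ
      ; _·_ = λ x (u , u′) → x S.· u , x T.· u′
      ; ⊕-⊖ = λ (u , u′) (w , w′) → cong₂ _,_ (S.⊕-⊖ u w) (T.⊕-⊖ u′ w′)
      ; ⊖-⊕ = λ (u , u′) (w , w′) → cong₂ _,_ (S.⊖-⊕ u w) (T.⊖-⊕ u′ w′)
      ; ·-· = λ x y (u , u′) → cong₂ _,_ (S.·-· x y u) (T.·-· x y u′)
      ; 1· = λ (u , u′) → cong₂ _,_ (S.1· u) (T.1· u′)
      ; 0· = λ (u , u′) → cong₂ _,_ (S.0· u) (T.0· u′)
      ; ·0ⱽ = λ x → cong₂ _,_ (S.·0ⱽ x) (T.·0ⱽ x)
      ; pivot = λ (u , u′) → firstNonzero (S.pivot u ≟ 0#) (T.pivot u′)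
      ; pivot-· = λ x (u , u′) → trans (cong (firstNonzero (S.pivot (x S.· u) ≟ 0#)) (T.pivot-· x u′))
          (firstNonzero-* x (S.pivot u ≟ 0#) (S.pivot (x S.· u) ≟ 0#) (S.pivot-· x u))
      ; pivot-0 = firstNonzero-0 (S.pivot S.0ⱽ ≟ 0#) S.pivot-0 T.pivot-0
      ; pivot≡0 = λ (u , u′) e → let eu , eu′ = firstNonzero≡0 (S.pivot u ≟ 0#) e in
          cong₂ _,_ (S.pivot≡0 u eu) (T.pivot≡0 u′ eu′)
      ; σ = S.σ ℤ.* T.σ
      ; card-σ = trans (×-card S.enum T.enum) (trans (cong₂ ℤ._*_ S.card-σ T.card-σ) (squares S.σ T.σ))
      ; σ-mod = product-mod S.σ T.σ S.σ-mod T.σ-mod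
      }
      where
      squares : ∀ s t → (s ℤ.* s) ℤ.* (t ℤ.* t) ≡ (s ℤ.* t) ℤ.* (s ℤ.* t)
      squares = let open ℤ-Solver in solve 2 (λ s t → (s :* s) :* (t :* t) := (s :* t) :* (s :* t)) refl

  record HermitianMatrix₂ : Set c where
    field
      m₁₁ m₁₂ m₂₁ m₂₂ : Carrier
      m₁₁-fixed : conj m₁₁ ≡ m₁₁
      m₂₂-fixed : conj m₂₂ ≡ m₂₂
      conj-m₁₂ : conj m₁₂ ≡ m₂₁
      det≢0 : m₁₁ * m₂₂ + - (m₁₂ * m₂₁) ≢ 0#

    conj-m₂₁ : conj m₂₁ ≡ m₁₂
    conj-m₂₁ = trans (cong conj (sym conj-m₁₂)) (conj-conj m₁₂)

    -- The arguments are the four values b(v,v), b(v,w), b(w,v), b(w,w); the result is the value of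
    -- M ⊗ b at the pair (v, w).
    combination : (x y z t : Carrier) → Carrier
    combination x y z t = m₁₁ * x + m₁₂ * y + (m₂₁ * z + m₂₂ * t)

    -- The value of the binary form M at the vector (1, a).
    affineValue : Carrier → Carrier
    affineValue a = combination 1# a (conj a) (norm a)

    -- Together these count the isotropic points of M on the projective line: `δ₂₂` stands for the
    -- point (0, 1) and `affineZeros` for the points (1, a).
    δ₂₂ affineZeros : ℤ
    δ₂₂ = 𝟙 (m₂₂ ≟ 0#)
    affineZeros = ∑ᴱ (λ a → 𝟙 (affineValue a ≟ 0#))

  module PairForm (M : HermitianMatrix₂) {𝒮 : Space} (H : HermitianForm 𝒮) where
    open HermitianMatrix₂ M
    open Space 𝒮
    open HermitianForm H

    pairForm : HermitianForm (productSpace 𝒮 𝒮)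
    pairForm = record
      { form = λ (v , w) (v′ , w′) → combination (form v v′) (form v w′) (form w v′) (form w w′)
      ; form-⊕ = λ (u , u′) (v , v′) (w , w′) → trans
          (combination-cong (form-⊕ u v w) (form-⊕ u v′ w′) (form-⊕ u′ v w) (form-⊕ u′ v′ w′))
          (combination-+ (form u v) (form u w) (form u v′) (form u w′) (form u′ v) (form u′ w) (form u′ v′) (form u′ w′))
      ; form-· = λ (u , u′) x (v , v′) → trans
          (combination-cong (form-· u x v) (form-· u x v′) (form-· u′ x v) (form-· u′ x v′))
          (combination-* x (form u v) (form u v′) (form u′ v) (form u′ v′))
      ; form-sym = λ (u , u′) (v , v′) → begin
          conj (combination (form u v) (form u v′) (form u′ v) (form u′ v′))
            ≡⟨ conj-combination _ _ _ _ ⟩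
          combination (conj (form u v)) (conj (form u′ v)) (conj (form u v′)) (conj (form u′ v′))
            ≡⟨ combination-cong (form-sym u v) (form-sym u′ v) (form-sym u v′) (form-sym u′ v′) ⟩
          combination (form v u) (form v u′) (form v′ u) (form v′ u′) ∎
      }
      where
      open ≡-Reasoning
      open Solver using (solve; _:+_; _:*_; _:=_)
      combination-cong : ∀ {x y z t x′ y′ z′ t′} → x ≡ x′ → y ≡ y′ → z ≡ z′ → t ≡ t′ →
        combination x y z t ≡ combination x′ y′ z′ t′
      combination-cong refl refl refl refl = refl
      combination-+ : ∀ x x′ y y′ z z′ t t′ → combination (x + x′) (y + y′) (z + z′) (t + t′) ≡
        combination x y z t + combination x′ y′ z′ t′
      combination-+ x x′ y y′ z z′ t t′ = solve 12 (λ a b c d x x′ y y′ z z′ t t′ →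
        a :* (x :+ x′) :+ b :* (y :+ y′) :+ (c :* (z :+ z′) :+ d :* (t :+ t′)) :=
        (a :* x :+ b :* y :+ (c :* z :+ d :* t)) :+ (a :* x′ :+ b :* y′ :+ (c :* z′ :+ d :* t′)))
        refl m₁₁ m₁₂ m₂₁ m₂₂ x x′ y y′ z z′ t t′
      combination-* : ∀ s x y z t → combination (s * x) (s * y) (s * z) (s * t) ≡ s * combination x y z t
      combination-* s x y z t = solve 9 (λ a b c d s x y z t →
        a :* (s :* x) :+ b :* (s :* y) :+ (c :* (s :* z) :+ d :* (s :* t)) :=
        s :* (a :* x :+ b :* y :+ (c :* z :+ d :* t))) refl m₁₁ m₁₂ m₂₁ m₂₂ s x y z t
      conj-combination : ∀ x y z t → conj (combination x y z t) ≡ combination (conj x) (conj z) (conj y) (conj t)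
      conj-combination x y z t = begin
        conj (m₁₁ * x + m₁₂ * y + (m₂₁ * z + m₂₂ * t))
          ≡⟨ trans (conj-+ _ _) (cong₂ _+_ (conj-+ _ _) (conj-+ _ _)) ⟩
        conj (m₁₁ * x) + conj (m₁₂ * y) + (conj (m₂₁ * z) + conj (m₂₂ * t))
          ≡⟨ cong₂ _+_ (cong₂ _+_ (trans (conj-* _ _) (cong (_* conj x) m₁₁-fixed)) (trans (conj-* _ _) (cong (_* conj y) conj-m₁₂)))
               (cong₂ _+_ (trans (conj-* _ _) (cong (_* conj z) conj-m₂₁)) (trans (conj-* _ _) (cong (_* conj t) m₂₂-fixed))) ⟩
        m₁₁ * conj x + m₂₁ * conj y + (m₁₂ * conj z + m₂₂ * conj t)
          ≡⟨ solve 4 (λ a b c d → a :+ b :+ (c :+ d) := a :+ c :+ (b :+ d)) refl _ _ _ _ ⟩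
        combination (conj x) (conj z) (conj y) (conj t) ∎

    module P = HermitianForm pairForm

    form-0ʳ : ∀ v → form v 0ⱽ ≡ 0#
    form-0ʳ v = trans (cong (form v) (sym (0· 0ⱽ))) (trans (form-· v 0# 0ⱽ) (zeroˡ _))

    -- Testing against (x, 0) and (0, x) gives two linear equations with the entries of M as
    -- coefficients, and `det≢0` separates v from w by Cramer's rule.
    pairForm-nondegenerate : Nondegenerate → P.Nondegenerate
    pairForm-nondegenerate nd (v , w) orth = cong₂ _,_
      (nd v (λ x → *-zero-product det≢0 (begin
        (m₁₁ * m₂₂ + - (m₁₂ * m₂₁)) * form v x
          ≡⟨ solve 6 (λ a b c d v w → (a :* d :+ :- (b :* c)) :* v :=
               d :* (a :* v :+ c :* w) :+ :- (c :* (b :* v :+ d :* w))) refl m₁₁ m₁₂ m₂₁ m₂₂ (form v x) (form w x) ⟩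
        m₂₂ * (m₁₁ * form v x + m₂₁ * form w x) + - (m₂₁ * (m₁₂ * form v x + m₂₂ * form w x))
          ≡⟨ cong₂ (λ s t → m₂₂ * s + - (m₂₁ * t)) (first x) (second x) ⟩
        m₂₂ * 0# + - (m₂₁ * 0#)
          ≡⟨ solve 2 (λ c d → d :* con 0ℤ :+ :- (c :* con 0ℤ) := con 0ℤ) refl m₂₁ m₂₂ ⟩
        0# ∎)))
      (nd w (λ x → *-zero-product det≢0 (begin
        (m₁₁ * m₂₂ + - (m₁₂ * m₂₁)) * form w x
          ≡⟨ solve 6 (λ a b c d v w → (a :* d :+ :- (b :* c)) :* w :=
               a :* (b :* v :+ d :* w) :+ :- (b :* (a :* v :+ c :* w))) refl m₁₁ m₁₂ m₂₁ m₂₂ (form v x) (form w x) ⟩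
        m₁₁ * (m₁₂ * form v x + m₂₂ * form w x) + - (m₁₂ * (m₁₁ * form v x + m₂₁ * form w x))
          ≡⟨ cong₂ (λ s t → m₁₁ * s + - (m₁₂ * t)) (second x) (first x) ⟩
        m₁₁ * 0# + - (m₁₂ * 0#)
          ≡⟨ solve 2 (λ c d → d :* con 0ℤ :+ :- (c :* con 0ℤ) := con 0ℤ) refl m₁₂ m₁₁ ⟩
        0# ∎)))
      where
      open ≡-Reasoning
      open Solver using (solve; _:+_; _:*_; :-_; _:=_; con)
      first : ∀ x → m₁₁ * form v x + m₂₁ * form w x ≡ 0#
      first x = begin
        m₁₁ * form v x + m₂₁ * form w x
          ≡⟨ solve 6 (λ a b c d v w → a :* v :+ c :* w := a :* v :+ b :* con 0ℤ :+ (c :* w :+ d :* con 0ℤ)) refl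
               m₁₁ m₁₂ m₂₁ m₂₂ (form v x) (form w x) ⟩
        combination (form v x) 0# (form w x) 0#
          ≡⟨ cong₂ (λ s t → combination (form v x) s (form w x) t) (form-0ʳ v) (form-0ʳ w) ⟨
        P.form (v , w) (x , 0ⱽ) ≡⟨ orth (x , 0ⱽ) ⟩
        0# ∎
      second : ∀ x → m₁₂ * form v x + m₂₂ * form w x ≡ 0#
      second x = begin
        m₁₂ * form v x + m₂₂ * form w x
          ≡⟨ solve 6 (λ a b c d v w → b :* v :+ d :* w := a :* con 0ℤ :+ b :* v :+ (c :* con 0ℤ :+ d :* w)) refl
               m₁₁ m₁₂ m₂₁ m₂₂ (form v x) (form w x) ⟩
        combination 0# (form v x) 0# (form w x)
          ≡⟨ cong₂ (λ s t → combination s (form v x) t (form w x)) (form-0ʳ v) (form-0ʳ w) ⟨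
        P.form (v , w) (0ⱽ , x) ≡⟨ orth (0ⱽ , x) ⟩
        0# ∎

    isotropic : V → V → ℤ
    isotropic v w = 𝟙 (P.h (v , w) ≟ 0#)

    h-0-w : ∀ w → P.h (0ⱽ , w) ≡ m₂₂ * h w
    h-0-w w = begin
      combination (form 0ⱽ 0ⱽ) (form 0ⱽ w) (form w 0ⱽ) (form w w)
        ≡⟨ cong₂ (λ s t → combination s t (form w 0ⱽ) (h w)) (form-0ˡ 0ⱽ) (form-0ˡ w) ⟩
      combination 0# 0# (form w 0ⱽ) (h w) ≡⟨ cong (λ t → combination 0# 0# t (h w)) (form-0ʳ w) ⟩
      combination 0# 0# 0# (h w)
        ≡⟨ solve 5 (λ a b c d x → a :* con 0ℤ :+ b :* con 0ℤ :+ (c :* con 0ℤ :+ d :* x) := d :* x) refl m₁₁ m₁₂ m₂₁ m₂₂ (h w) ⟩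
      m₂₂ * h w ∎
      where
      open ≡-Reasoning
      open Solver using (solve; _:+_; _:*_; _:=_; con)

    -- On dependent pairs M ⊗ b factors into the value of M at (1, a) and that of b at v, so these
    -- pairs can be counted separately.
    h-v-av : ∀ a v → P.h (v , a · v) ≡ affineValue a * h v
    h-v-av a v = begin
      combination (h v) (form v (a · v)) (form (a · v) v) (h (a · v))
        ≡⟨ cong₂ (λ s t → combination (h v) s t (h (a · v))) (form-· v a v) (form-·ˡ a v v) ⟩
      combination (h v) (a * h v) (conj a * h v) (h (a · v))
        ≡⟨ cong (combination (h v) (a * h v) (conj a * h v)) (h-· a v) ⟩
      combination (h v) (a * h v) (conj a * h v) (norm a * h v)
        ≡⟨ solve 8 (λ p q r s a b n x → p :* x :+ q :* (a :* x) :+ (r :* (b :* x) :+ s :* (n :* x)) :=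
             (p :* con 1ℤ :+ q :* a :+ (r :* b :+ s :* n)) :* x) refl m₁₁ m₁₂ m₂₁ m₂₂ a (conj a) (norm a) (h v) ⟩
      affineValue a * h v ∎
      where
      open ≡-Reasoning
      open Solver using (solve; _:+_; _:*_; _:=_; con)

    𝟙-*≟0 : ∀ x y (d : Dec (x * y ≡ 0#)) (d₁ : Dec (x ≡ 0#)) (d₂ : Dec (y ≡ 0#)) →
      𝟙 d ≡ 𝟙 d₁ ℤ.+ 𝟙 d₂ ℤ.* (1ℤ ℤ.- 𝟙 d₁)
    𝟙-*≟0 x y d (yes refl) (yes _) = 𝟙-yes d (zeroˡ y)
    𝟙-*≟0 x y d (yes refl) (no _) = 𝟙-yes d (zeroˡ y)
    𝟙-*≟0 x y d (no _) (yes refl) = 𝟙-yes d (zeroʳ x)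
    𝟙-*≟0 x y d (no x≢0) (no y≢0) = 𝟙-no d (*-≢0 x≢0 y≢0)

    ∑-isotropic-0 : ∑ⱽ (isotropic 0ⱽ) ≡ δ₂₂ ℤ.* (σ ℤ.* σ) ℤ.+ zeros ℤ.* (1ℤ ℤ.- δ₂₂)
    ∑-isotropic-0 = begin
      ∑ⱽ (isotropic 0ⱽ)
        ≡⟨ sum-cong vectors (λ w → trans (𝟙-cong (P.h (0ⱽ , w) ≟ 0#) (m₂₂ * h w ≟ 0#) (trans (sym (h-0-w w))) (trans (h-0-w w)))
             (𝟙-*≟0 m₂₂ (h w) (m₂₂ * h w ≟ 0#) (m₂₂ ≟ 0#) (h w ≟ 0#))) ⟩
      ∑ⱽ (λ w → δ₂₂ ℤ.+ 𝟙 (h w ≟ 0#) ℤ.* (1ℤ ℤ.- δ₂₂))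
        ≡⟨ sum-+ vectors (λ _ → δ₂₂) _ ⟩
      ∑ⱽ (λ _ → δ₂₂) ℤ.+ ∑ⱽ (λ w → 𝟙 (h w ≟ 0#) ℤ.* (1ℤ ℤ.- δ₂₂))
        ≡⟨ cong₂ ℤ._+_ (trans (sum-const vectors δ₂₂) (trans (cong (ℤ._* δ₂₂) card-σ) (ℤ.*-comm (σ ℤ.* σ) δ₂₂)))
             (sum-*ʳ vectors (1ℤ ℤ.- δ₂₂) _) ⟩
      δ₂₂ ℤ.* (σ ℤ.* σ) ℤ.+ zeros ℤ.* (1ℤ ℤ.- δ₂₂) ∎
      where open ≡-Reasoning

    ∑-isotropic-line : ∀ v → ∑ᴱ (λ a → isotropic v (a · v)) ≡
      affineZeros ℤ.+ 𝟙 (h v ≟ 0#) ℤ.* (Q ℤ.* Q ℤ.- affineZeros)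
    ∑-isotropic-line v = begin
      ∑ᴱ (λ a → isotropic v (a · v))
        ≡⟨ sum-cong list (λ a → trans (𝟙-cong (P.h (v , a · v) ≟ 0#) (affineValue a * h v ≟ 0#)
             (trans (sym (h-v-av a v))) (trans (h-v-av a v)))
             (𝟙-*≟0 (affineValue a) (h v) (affineValue a * h v ≟ 0#) (affineValue a ≟ 0#) (h v ≟ 0#))) ⟩
      ∑ᴱ (λ a → 𝟙 (affineValue a ≟ 0#) ℤ.+ 𝟙 (h v ≟ 0#) ℤ.* (1ℤ ℤ.- 𝟙 (affineValue a ≟ 0#)))
        ≡⟨ sum-+ list _ _ ⟩
      affineZeros ℤ.+ ∑ᴱ (λ a → 𝟙 (h v ≟ 0#) ℤ.* (1ℤ ℤ.- 𝟙 (affineValue a ≟ 0#)))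
        ≡⟨ cong (λ z → affineZeros ℤ.+ z) (trans (sum-*ˡ list (𝟙 (h v ≟ 0#)) _)
             (cong (𝟙 (h v ≟ 0#) ℤ.*_) (trans (sum-minus list (λ _ → 1ℤ) _) (cong (ℤ._- affineZeros) card-F)))) ⟩
      affineZeros ℤ.+ 𝟙 (h v ≟ 0#) ℤ.* (Q ℤ.* Q ℤ.- affineZeros) ∎
      where open ≡-Reasoning

    nonzero : V → ℤ
    nonzero v = 1ℤ ℤ.- 𝟙 (v ≟ⱽ 0ⱽ)

    ∑-nonzero : (f : V → ℤ) → ∑ⱽ (λ v → nonzero v ℤ.* f v) ≡ ∑ⱽ f ℤ.- f 0ⱽ
    ∑-nonzero f = begin
      ∑ⱽ (λ v → nonzero v ℤ.* f v)
        ≡⟨ sum-cong vectors (λ v → distr (𝟙 (v ≟ⱽ 0ⱽ)) (f v)) ⟩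
      ∑ⱽ (λ v → f v ℤ.- 𝟙 (v ≟ⱽ 0ⱽ) ℤ.* f v) ≡⟨ sum-minus vectors f _ ⟩
      ∑ⱽ f ℤ.- ∑ⱽ (λ v → 𝟙 (v ≟ⱽ 0ⱽ) ℤ.* f v) ≡⟨ cong (λ z → ∑ⱽ f ℤ.- z) (∑ⱽ-δ 0ⱽ f) ⟩
      ∑ⱽ f ℤ.- f 0ⱽ ∎
      where
      open ≡-Reasoning
      distr : ∀ d x → (1ℤ ℤ.- d) ℤ.* x ≡ x ℤ.- d ℤ.* x
      distr = let open ℤ-Solver in solve 2 (λ d x → (con 1ℤ :- d) :* x := x :- d :* x) refl

    -- For nonzero v the multiples `a · v` are distinct, so the difference counts exactly the w
    -- outside the line of v.
    isotropicIndependentPairs : ℤ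
    isotropicIndependentPairs = ∑ⱽ (λ v → nonzero v ℤ.* (∑ⱽ (isotropic v) ℤ.- ∑ᴱ (λ a → isotropic v (a · v))))

    -- Removing the dependent pairs leaves a formula in which M enters only through `P.zeros` and
    -- its number of isotropic projective points.
    isotropicIndependentPairs≡ : isotropicIndependentPairs ≡
      P.zeros ℤ.- zeros ℤ.- (δ₂₂ ℤ.+ affineZeros) ℤ.* (σ ℤ.* σ ℤ.- zeros) ℤ.- (zeros ℤ.- 1ℤ) ℤ.* (Q ℤ.* Q)
    isotropicIndependentPairs≡ = begin
      ∑ⱽ (λ v → nonzero v ℤ.* (∑ⱽ (isotropic v) ℤ.- line v))
        ≡⟨ ∑-nonzero (λ v → ∑ⱽ (isotropic v) ℤ.- line v) ⟩
      ∑ⱽ (λ v → ∑ⱽ (isotropic v) ℤ.- line v) ℤ.- (∑ⱽ (isotropic 0ⱽ) ℤ.- line 0ⱽ)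
        ≡⟨ cong₂ ℤ._-_ (trans (sum-minus vectors _ line) (cong₂ ℤ._-_ (sym (∑-× enum enum (λ vw → 𝟙 (P.h vw ≟ 0#)))) ∑-line))
             (cong₂ ℤ._-_ ∑-isotropic-0 (trans (∑-isotropic-line 0ⱽ)
                (cong (λ z → affineZeros ℤ.+ z ℤ.* (Q ℤ.* Q ℤ.- affineZeros)) (𝟙-yes (h 0ⱽ ≟ 0#) (form-0ˡ 0ⱽ))))) ⟩
      (P.zeros ℤ.- (affineZeros ℤ.* (σ ℤ.* σ) ℤ.+ zeros ℤ.* (Q ℤ.* Q ℤ.- affineZeros))) ℤ.-
        ((δ₂₂ ℤ.* (σ ℤ.* σ) ℤ.+ zeros ℤ.* (1ℤ ℤ.- δ₂₂)) ℤ.- (affineZeros ℤ.+ 1ℤ ℤ.* (Q ℤ.* Q ℤ.- affineZeros)))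
        ≡⟨ rearrange P.zeros affineZeros δ₂₂ (σ ℤ.* σ) zeros (Q ℤ.* Q) ⟩
      P.zeros ℤ.- zeros ℤ.- (δ₂₂ ℤ.+ affineZeros) ℤ.* (σ ℤ.* σ ℤ.- zeros) ℤ.- (zeros ℤ.- 1ℤ) ℤ.* (Q ℤ.* Q) ∎
      where
      open ≡-Reasoning
      line : V → ℤ
      line v = ∑ᴱ (λ a → isotropic v (a · v))
      ∑-line : ∑ⱽ line ≡ affineZeros ℤ.* (σ ℤ.* σ) ℤ.+ zeros ℤ.* (Q ℤ.* Q ℤ.- affineZeros)
      ∑-line = begin
        ∑ⱽ line ≡⟨ sum-cong vectors ∑-isotropic-line ⟩
        ∑ⱽ (λ v → affineZeros ℤ.+ 𝟙 (h v ≟ 0#) ℤ.* (Q ℤ.* Q ℤ.- affineZeros)) ≡⟨ sum-+ vectors (λ _ → affineZeros) _ ⟩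
        ∑ⱽ (λ v → affineZeros) ℤ.+ ∑ⱽ (λ v → 𝟙 (h v ≟ 0#) ℤ.* (Q ℤ.* Q ℤ.- affineZeros))
          ≡⟨ cong₂ ℤ._+_ (trans (sum-const vectors affineZeros) (trans (cong (ℤ._* affineZeros) card-σ) (ℤ.*-comm (σ ℤ.* σ) affineZeros)))
               (sum-*ʳ vectors (Q ℤ.* Q ℤ.- affineZeros) _) ⟩
        affineZeros ℤ.* (σ ℤ.* σ) ℤ.+ zeros ℤ.* (Q ℤ.* Q ℤ.- affineZeros) ∎
      rearrange : ∀ p a d s z k →
        (p ℤ.- (a ℤ.* s ℤ.+ z ℤ.* (k ℤ.- a))) ℤ.- ((d ℤ.* s ℤ.+ z ℤ.* (1ℤ ℤ.- d)) ℤ.- (a ℤ.+ 1ℤ ℤ.* (k ℤ.- a))) ≡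
        p ℤ.- z ℤ.- (d ℤ.+ a) ℤ.* (s ℤ.- z) ℤ.- (z ℤ.- 1ℤ) ℤ.* k
      rearrange = let open ℤ-Solver in solve 6 (λ p a d s z k →
        (p :- (a :* s :+ z :* (k :- a))) :- ((d :* s :+ z :* (con 1ℤ :- d)) :- (a :+ con 1ℤ :* (k :- a))) :=
        p :- z :- (d :+ a) :* (s :- z) :- (z :- con 1ℤ) :* k) refl

  lineForm : HermitianForm lineSpace
  lineForm = record
    { form = λ x y → conj x * y
    ; form-⊕ = λ u v w → distribˡ (conj u) v w
    ; form-· = λ u x v → solve 3 (λ u x v → u :* (x :* v) := x :* (u :* v)) refl (conj u) x v
    ; form-sym = λ u v → trans (conj-* (conj u) v) (trans (cong (_* conj v) (conj-conj u)) (*-comm u (conj v)))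
    }
    where open Solver using (solve; _:*_; _:=_)

  module ProjectiveZeros (M : HermitianMatrix₂) where
    open HermitianMatrix₂ M
    open PairForm M lineForm
    private module L = HermitianForm lineForm

    lineForm-nondegenerate : L.Nondegenerate
    lineForm-nondegenerate u orth = conj≡0 (trans (sym (*-identityʳ (conj u))) (orth 1#))

    noIndependentPairs : isotropicIndependentPairs ≡ 0ℤ
    noIndependentPairs = trans (sum-cong list (λ v → vanish v (v ≟ 0#))) (sum-zero list)
      where
      vanish : ∀ v (d : Dec (v ≡ 0#)) →
        (1ℤ ℤ.- 𝟙 d) ℤ.* (∑ᴱ (isotropic v) ℤ.- ∑ᴱ (λ a → isotropic v (a * v))) ≡ 0ℤ
      vanish v (yes _) = refl
      vanish v (no v≢0) = trans (ℤ.*-identityˡ _) (ℤ.i≡j⇒i-j≡0 (sym (trans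
        (sum-cong list (λ a → cong (isotropic v) (*-comm a v))) (Space.∑-scale lineSpace v v≢0 (isotropic v)))))

    -- In dimension one there are no independent pairs. The general formula, applied to `lineForm`,
    -- then equates a known expression to zero and can be solved for this number.
    δ₂₂+affineZeros : δ₂₂ ℤ.+ affineZeros ≡ Q ℤ.+ 1ℤ
    δ₂₂+affineZeros = projective (δ₂₂ ℤ.+ affineZeros) P.zeros L.zeros
      (L.Q*zeros lineForm-nondegenerate)
      (P.Q*zeros (pairForm-nondegenerate lineForm-nondegenerate))
      (trans (sym isotropicIndependentPairs≡) noIndependentPairs)
      where
      projective : ∀ d p z → Q ℤ.* z ≡ ℤ.- Q ℤ.* ℤ.- Q ℤ.+ (Q ℤ.- 1ℤ) ℤ.* ℤ.- Q →
        Q ℤ.* p ≡ (ℤ.- Q ℤ.* ℤ.- Q) ℤ.* (ℤ.- Q ℤ.* ℤ.- Q) ℤ.+ (Q ℤ.- 1ℤ) ℤ.* (ℤ.- Q ℤ.* ℤ.- Q) →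
        p ℤ.- z ℤ.- d ℤ.* (ℤ.- Q ℤ.* ℤ.- Q ℤ.- z) ℤ.- (z ℤ.- 1ℤ) ℤ.* (Q ℤ.* Q) ≡ 0ℤ → d ≡ Q ℤ.+ 1ℤ
      projective d p z Qz Qp e = ℤ.*-cancelʳ-≡ d (Q ℤ.+ 1ℤ) (Q ℤ.* Q ℤ.- 1ℤ) {{Q²-1-nonZero}}
        (ℤ.*-cancelˡ-≡ Q (d ℤ.* (Q ℤ.* Q ℤ.- 1ℤ)) ((Q ℤ.+ 1ℤ) ℤ.* (Q ℤ.* Q ℤ.- 1ℤ)) (begin
          Q ℤ.* (d ℤ.* (Q ℤ.* Q ℤ.- 1ℤ))
            ≡⟨ solve 2 (λ Q d → Q :* (d :* (Q :* Q :- con 1ℤ)) := Q :* (d :* (:- Q :* :- Q :- con 1ℤ))) refl Q d ⟩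
          Q ℤ.* (d ℤ.* (ℤ.- Q ℤ.* ℤ.- Q ℤ.- 1ℤ))
            ≡⟨ cong (λ z → Q ℤ.* (d ℤ.* (ℤ.- Q ℤ.* ℤ.- Q ℤ.- z))) (sym z≡1) ⟩
          Q ℤ.* (d ℤ.* (ℤ.- Q ℤ.* ℤ.- Q ℤ.- z))
            ≡⟨ solve 4 (λ Q d p z → Q :* (d :* (:- Q :* :- Q :- z)) :=
                 (Q :* p :- Q :* z) :- (Q :* (z :- con 1ℤ) :* (Q :* Q) :+
                 Q :* (p :- z :- d :* (:- Q :* :- Q :- z) :- (z :- con 1ℤ) :* (Q :* Q)))) refl Q d p z ⟩
          (Q ℤ.* p ℤ.- Q ℤ.* z) ℤ.- (Q ℤ.* (z ℤ.- 1ℤ) ℤ.* (Q ℤ.* Q) ℤ.+ Q ℤ.* (p ℤ.- z ℤ.- d ℤ.* (ℤ.- Q ℤ.* ℤ.- Q ℤ.- z) ℤ.- (z ℤ.- 1ℤ) ℤ.* (Q ℤ.* Q)))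
            ≡⟨ cong₂ ℤ._-_ (cong₂ ℤ._-_ Qp Qz) (cong₂ (λ s t → Q ℤ.* (s ℤ.- 1ℤ) ℤ.* (Q ℤ.* Q) ℤ.+ Q ℤ.* t) z≡1 e) ⟩
          (((ℤ.- Q ℤ.* ℤ.- Q) ℤ.* (ℤ.- Q ℤ.* ℤ.- Q) ℤ.+ (Q ℤ.- 1ℤ) ℤ.* (ℤ.- Q ℤ.* ℤ.- Q)) ℤ.- (ℤ.- Q ℤ.* ℤ.- Q ℤ.+ (Q ℤ.- 1ℤ) ℤ.* ℤ.- Q)) ℤ.-
            (Q ℤ.* (1ℤ ℤ.- 1ℤ) ℤ.* (Q ℤ.* Q) ℤ.+ Q ℤ.* 0ℤ)
            ≡⟨ solve 1 (λ Q → (((:- Q :* :- Q) :* (:- Q :* :- Q) :+ (Q :- con 1ℤ) :* (:- Q :* :- Q)) :- (:- Q :* :- Q :+ (Q :- con 1ℤ) :* :- Q)) :-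
                 (Q :* (con 1ℤ :- con 1ℤ) :* (Q :* Q) :+ Q :* con 0ℤ) := Q :* ((Q :+ con 1ℤ) :* (Q :* Q :- con 1ℤ))) refl Q ⟩
          Q ℤ.* ((Q ℤ.+ 1ℤ) ℤ.* (Q ℤ.* Q ℤ.- 1ℤ)) ∎))
        where
        open ≡-Reasoning
        open ℤ-Solver
        z≡1 : z ≡ 1ℤ
        z≡1 = ℤ.*-cancelˡ-≡ Q z 1ℤ (trans Qz (solve 1 (λ Q → :- Q :* :- Q :+ (Q :- con 1ℤ) :* :- Q := Q :* con 1ℤ) refl Q))
        Q²-1-nonZero : ℤ.NonZero (Q ℤ.* Q ℤ.- 1ℤ)
        Q²-1-nonZero = ℤ.>-nonZero (subst (0ℤ ℤ.<_)
          (trans (cong (ℤ._- 1ℤ) (ℤ.pos-* q q)) refl)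
          (ℤ.+-monoˡ-< (ℤ.- 1ℤ) {1ℤ} {pos (q ℕ.* q)} (ℤ.+<+ (ℕ.*-mono-≤ q>1 (ℕ.<⇒≤ q>1)))))

  -- q times the number of independent pairs that are isotropic for M ⊗ b, in terms of the Gauss sum s of b.
  independentPairsPoly : ℤ → ℤ
  independentPairsPoly s = (s ℤ.* s) ℤ.* (s ℤ.* s) ℤ.+ (Q ℤ.- 1ℤ) ℤ.* (s ℤ.* s) ℤ.- (s ℤ.* s ℤ.+ (Q ℤ.- 1ℤ) ℤ.* s)
    ℤ.- (Q ℤ.+ 1ℤ) ℤ.* (Q ℤ.* (s ℤ.* s) ℤ.- (s ℤ.* s ℤ.+ (Q ℤ.- 1ℤ) ℤ.* s))
    ℤ.- ((s ℤ.* s ℤ.+ (Q ℤ.- 1ℤ) ℤ.* s) ℤ.- Q) ℤ.* (Q ℤ.* Q)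

  module IndependentPairCount (M : HermitianMatrix₂) {𝒮 : Space} (H : HermitianForm 𝒮) where
    open HermitianMatrix₂ M
    open PairForm M H
    open Space 𝒮
    open HermitianForm H

    Q*isotropicIndependentPairs : Nondegenerate → Q ℤ.* isotropicIndependentPairs ≡ independentPairsPoly σ
    Q*isotropicIndependentPairs nd = substitute isotropicIndependentPairs P.zeros zeros (δ₂₂ ℤ.+ affineZeros) σ
      isotropicIndependentPairs≡ (ProjectiveZeros.δ₂₂+affineZeros M)
      (P.Q*zeros (pairForm-nondegenerate nd)) (Q*zeros nd)
      where
      open ≡-Reasoning
      open ℤ-Solver
      substitute : ∀ k p z d s → k ≡ p ℤ.- z ℤ.- d ℤ.* (s ℤ.* s ℤ.- z) ℤ.- (z ℤ.- 1ℤ) ℤ.* (Q ℤ.* Q) →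
        d ≡ Q ℤ.+ 1ℤ → Q ℤ.* p ≡ (s ℤ.* s) ℤ.* (s ℤ.* s) ℤ.+ (Q ℤ.- 1ℤ) ℤ.* (s ℤ.* s) →
        Q ℤ.* z ≡ s ℤ.* s ℤ.+ (Q ℤ.- 1ℤ) ℤ.* s →
        Q ℤ.* k ≡ independentPairsPoly s
      substitute k p z d s k≡ d≡ Qp Qz = begin
        Q ℤ.* k
          ≡⟨ cong (Q ℤ.*_) (trans k≡ (cong (λ d → p ℤ.- z ℤ.- d ℤ.* (s ℤ.* s ℤ.- z) ℤ.- (z ℤ.- 1ℤ) ℤ.* (Q ℤ.* Q)) d≡)) ⟩
        Q ℤ.* (p ℤ.- z ℤ.- (Q ℤ.+ 1ℤ) ℤ.* (s ℤ.* s ℤ.- z) ℤ.- (z ℤ.- 1ℤ) ℤ.* (Q ℤ.* Q))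
          ≡⟨ solve 4 (λ Q p z s → Q :* (p :- z :- (Q :+ con 1ℤ) :* (s :* s :- z) :- (z :- con 1ℤ) :* (Q :* Q)) :=
               Q :* p :- Q :* z :- (Q :+ con 1ℤ) :* (Q :* (s :* s) :- Q :* z) :- (Q :* z :- Q) :* (Q :* Q)) refl Q p z s ⟩
        Q ℤ.* p ℤ.- Q ℤ.* z ℤ.- (Q ℤ.+ 1ℤ) ℤ.* (Q ℤ.* (s ℤ.* s) ℤ.- Q ℤ.* z) ℤ.- (Q ℤ.* z ℤ.- Q) ℤ.* (Q ℤ.* Q)
          ≡⟨ cong₂ (λ x y → x ℤ.- y ℤ.- (Q ℤ.+ 1ℤ) ℤ.* (Q ℤ.* (s ℤ.* s) ℤ.- y) ℤ.- (y ℤ.- Q) ℤ.* (Q ℤ.* Q)) Qp Qz ⟩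
        (s ℤ.* s) ℤ.* (s ℤ.* s) ℤ.+ (Q ℤ.- 1ℤ) ℤ.* (s ℤ.* s) ℤ.- (s ℤ.* s ℤ.+ (Q ℤ.- 1ℤ) ℤ.* s)
          ℤ.- (Q ℤ.+ 1ℤ) ℤ.* (Q ℤ.* (s ℤ.* s) ℤ.- (s ℤ.* s ℤ.+ (Q ℤ.- 1ℤ) ℤ.* s))
          ℤ.- ((s ℤ.* s ℤ.+ (Q ℤ.- 1ℤ) ℤ.* s) ℤ.- Q) ℤ.* (Q ℤ.* Q) ∎

-- Coordinate spaces and transitivity of their linear bijections.

module CoordinateSpaces {c} (q : ℕ) (pp : IsPrimePower q) (F : Field c) (iso : Field.Carrier F ↔ Fin (q ℕ.^ 2)) where
  open import Data.Vec.Base using (map; zipWith; replicate; head; tail)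
  open Field F
  open ProductSpaces q pp F iso public

  Vector : ℕ → Set c
  Vector = Vec Carrier

  infixl 6 _+ᵛ_
  infixr 7 _*ᵛ_

  _+ᵛ_ : ∀ {n} → Vector n → Vector n → Vector n
  _+ᵛ_ = zipWith _+_

  _*ᵛ_ : ∀ {n} → Carrier → Vector n → Vector n
  x *ᵛ u = map (x *_) u

  0ᵛ : ∀ {n} → Vector n
  0ᵛ = replicate _ 0#

  pivotᵛ : ∀ {n} → Vector n → Carrier
  pivotᵛ [] = 0#
  pivotᵛ (x ∷ u) = firstNonzero (x ≟ 0#) (pivotᵛ u)

  pivotᵛ-* : ∀ {n} x (u : Vector n) → pivotᵛ (x *ᵛ u) ≡ x * pivotᵛ u
  pivotᵛ-* x [] = sym (zeroʳ x)
  pivotᵛ-* x (y ∷ u) = trans (cong (firstNonzero (x * y ≟ 0#)) (pivotᵛ-* x u))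
                             (firstNonzero-* x (y ≟ 0#) (x * y ≟ 0#) refl)

  pivotᵛ-0 : ∀ n → pivotᵛ (0ᵛ {n}) ≡ 0#
  pivotᵛ-0 zero = refl
  pivotᵛ-0 (suc n) = firstNonzero-0 (0# ≟ 0#) refl (pivotᵛ-0 n)

  pivotᵛ≡0 : ∀ {n} (u : Vector n) → pivotᵛ u ≡ 0# → u ≡ 0ᵛ
  pivotᵛ≡0 [] e = refl
  pivotᵛ≡0 (x ∷ u) e = let ex , eu = firstNonzero≡0 (x ≟ 0#) e in cong₂ _∷_ ex (pivotᵛ≡0 u eu)

  -- The integer (-q)^n, a square root of the number of vectors with the sign required by the
  -- congruence modulo q + 1.
  gaussSum : ℕ → ℤ
  gaussSum zero = 1ℤ
  gaussSum (suc n) = ℤ.- Q ℤ.* gaussSum n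

  gaussSum-mod : ∀ n → ∃ λ k → gaussSum n ℤ.- 1ℤ ≡ (Q ℤ.+ 1ℤ) ℤ.* k
  gaussSum-mod zero = 0ℤ , sym (ℤ.*-zeroʳ (Q ℤ.+ 1ℤ))
  gaussSum-mod (suc n) = product-mod (ℤ.- Q) (gaussSum n) -Q-mod (gaussSum-mod n)

  card-Vector : ∀ n → Enumeration.card (Vec-Enumeration E n) ≡ gaussSum n ℤ.* gaussSum n
  card-Vector zero = refl
  card-Vector (suc n) = trans (Vec-card-suc E n) (trans (cong₂ ℤ._*_ card-F (card-Vector n)) (squares Q (gaussSum n)))
    where
    squares : ∀ i s → (i ℤ.* i) ℤ.* (s ℤ.* s) ≡ (ℤ.- i ℤ.* s) ℤ.* (ℤ.- i ℤ.* s)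
    squares = let open ℤ-Solver in solve 2 (λ i s → (i :* i) :* (s :* s) := (:- i :* s) :* (:- i :* s)) refl

  coordinateSpace : ℕ → Space
  coordinateSpace n = record
    { V = Vector n ; enum = Vec-Enumeration E n
    ; _⊕_ = _+ᵛ_ ; ⊖_ = map -_ ; 0ⱽ = 0ᵛ ; _·_ = _*ᵛ_
    ; ⊕-⊖ = ⊕-⊖ ; ⊖-⊕ = ⊖-⊕ ; ·-· = ·-· ; 1· = 1· ; 0· = 0· ; ·0ⱽ = ·0 n
    ; pivot = pivotᵛ ; pivot-· = pivotᵛ-* ; pivot-0 = pivotᵛ-0 n ; pivot≡0 = pivotᵛ≡0
    ; σ = gaussSum n ; card-σ = card-Vector n ; σ-mod = gaussSum-mod n
    }
    where
    open Solver using (solve; _:+_; :-_; _:=_)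
    ⊕-⊖ : ∀ {n} (u w : Vector n) → (u +ᵛ w) +ᵛ map -_ w ≡ u
    ⊕-⊖ [] [] = refl
    ⊕-⊖ (x ∷ u) (y ∷ w) = cong₂ _∷_ (solve 2 (λ x y → (x :+ y) :+ :- y := x) refl x y) (⊕-⊖ u w)
    ⊖-⊕ : ∀ {n} (u w : Vector n) → (u +ᵛ map -_ w) +ᵛ w ≡ u
    ⊖-⊕ [] [] = refl
    ⊖-⊕ (x ∷ u) (y ∷ w) = cong₂ _∷_ (solve 2 (λ x y → (x :+ :- y) :+ y := x) refl x y) (⊖-⊕ u w)
    ·-· : ∀ {n} x y (u : Vector n) → x *ᵛ y *ᵛ u ≡ (x * y) *ᵛ u
    ·-· x y [] = refl
    ·-· x y (z ∷ u) = cong₂ _∷_ (sym (*-assoc x y z)) (·-· x y u)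
    1· : ∀ {n} (u : Vector n) → 1# *ᵛ u ≡ u
    1· [] = refl
    1· (x ∷ u) = cong₂ _∷_ (*-identityˡ x) (1· u)
    0· : ∀ {n} (u : Vector n) → 0# *ᵛ u ≡ 0ᵛ
    0· [] = refl
    0· (x ∷ u) = cong₂ _∷_ (zeroˡ x) (0· u)
    ·0 : ∀ n x → x *ᵛ 0ᵛ {n} ≡ 0ᵛ
    ·0 zero x = refl
    ·0 (suc n) x = cong₂ _∷_ (zeroʳ x) (·0 n x)

  *ᵛ-0 : ∀ {n} x → x *ᵛ 0ᵛ {n} ≡ 0ᵛ
  *ᵛ-0 {n} = Space.·0ⱽ (coordinateSpace n)

  0*ᵛ : ∀ {n} (u : Vector n) → 0# *ᵛ u ≡ 0ᵛ
  0*ᵛ {n} = Space.0· (coordinateSpace n)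

  1*ᵛ : ∀ {n} (u : Vector n) → 1# *ᵛ u ≡ u
  1*ᵛ {n} = Space.1· (coordinateSpace n)

  +ᵛ-identityˡ : ∀ {n} (u : Vector n) → 0ᵛ +ᵛ u ≡ u
  +ᵛ-identityˡ [] = refl
  +ᵛ-identityˡ (x ∷ u) = cong₂ _∷_ (+-identityˡ x) (+ᵛ-identityˡ u)

  basis : ∀ {n} → Fin n → Vector n
  basis Fin.zero = 1# ∷ 0ᵛ
  basis (Fin.suc i) = 0# ∷ basis i

  -- An element of GL(n) given as a map with its inverse, so that no matrix has to be inverted.
  record LinearBijection (n : ℕ) : Set c where
    field
      to from : Vector n → Vector n
      to-+ : ∀ u v → to (u +ᵛ v) ≡ to u +ᵛ to v
      to-* : ∀ x u → to (x *ᵛ u) ≡ x *ᵛ to u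
      to-from : ∀ u → to (from u) ≡ u
      from-to : ∀ u → from (to u) ≡ u

    inverse-bijection : LinearBijection n
    inverse-bijection = record
      { to = from ; from = to ; to-from = from-to ; from-to = to-from
      ; to-+ = λ u v → trans (cong from (sym (trans (to-+ (from u) (from v)) (cong₂ _+ᵛ_ (to-from u) (to-from v)))))
                             (from-to (from u +ᵛ from v))
      ; to-* = λ x u → trans (cong from (sym (trans (to-* x (from u)) (cong (x *ᵛ_) (to-from u)))))
                             (from-to (x *ᵛ from u))
      }

    to-0 : to 0ᵛ ≡ 0ᵛ
    to-0 = trans (cong to (sym (0*ᵛ 0ᵛ))) (trans (to-* 0# 0ᵛ) (0*ᵛ (to 0ᵛ)))

    to≡0 : ∀ {u} → to u ≡ 0ᵛ → u ≡ 0ᵛ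
    to≡0 {u} e = trans (sym (from-to u)) (trans (cong from (trans e (sym to-0))) (from-to 0ᵛ))

  open LinearBijection using (to; from)

  _∘ᴸ_ : ∀ {n} → LinearBijection n → LinearBijection n → LinearBijection n
  e ∘ᴸ f = record
    { to = λ u → E′.to (F′.to u) ; from = λ u → F′.from (E′.from u)
    ; to-+ = λ u v → trans (cong E′.to (F′.to-+ u v)) (E′.to-+ (F′.to u) (F′.to v))
    ; to-* = λ x u → trans (cong E′.to (F′.to-* x u)) (E′.to-* x (F′.to u))
    ; to-from = λ u → trans (cong E′.to (F′.to-from (E′.from u))) (E′.to-from u)
    ; from-to = λ u → trans (cong F′.from (E′.from-to (F′.to u))) (F′.from-to u)
    }
    where
    module E′ = LinearBijection e
    module F′ = LinearBijection f

  private
    shear-+ : ∀ {n} y y′ (s s′ t : Vector n) → (s +ᵛ s′) +ᵛ (y + y′) *ᵛ t ≡ (s +ᵛ y *ᵛ t) +ᵛ (s′ +ᵛ y′ *ᵛ t)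
    shear-+ y y′ [] [] [] = refl
    shear-+ y y′ (a ∷ s) (b ∷ s′) (d ∷ t) = cong₂ _∷_
      (solve 5 (λ y y′ a b d → (a :+ b) :+ (y :+ y′) :* d := (a :+ y :* d) :+ (b :+ y′ :* d)) refl y y′ a b d)
      (shear-+ y y′ s s′ t)
      where open Solver using (solve; _:+_; _:*_; _:=_)

    shear-* : ∀ {n} x y (s t : Vector n) → x *ᵛ s +ᵛ (x * y) *ᵛ t ≡ x *ᵛ (s +ᵛ y *ᵛ t)
    shear-* x y [] [] = refl
    shear-* x y (a ∷ s) (d ∷ t) = cong₂ _∷_
      (solve 4 (λ x y a d → x :* a :+ (x :* y) :* d := x :* (a :+ y :* d)) refl x y a d) (shear-* x y s t)
      where open Solver using (solve; _:+_; _:*_; _:=_)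

    shear-cancel : ∀ {n} y z (s t : Vector n) → y + z ≡ 0# → (s +ᵛ y *ᵛ t) +ᵛ z *ᵛ t ≡ s
    shear-cancel y z [] [] e = refl
    shear-cancel y z (a ∷ s) (d ∷ t) e = cong₂ _∷_ (begin
      (a + y * d) + z * d ≡⟨ solve 4 (λ y z a d → (a :+ y :* d) :+ z :* d := a :+ (y :+ z) :* d) refl y z a d ⟩
      a + (y + z) * d ≡⟨ cong (λ z → a + z * d) e ⟩
      a + 0# * d ≡⟨ trans (cong (a +_) (zeroˡ d)) (+-identityʳ a) ⟩
      a ∎) (shear-cancel y z s t e)
      where
      open ≡-Reasoning
      open Solver using (solve; _:+_; _:*_; _:=_)

    head-+ : ∀ {n} (u v : Vector (suc n)) → head (u +ᵛ v) ≡ head u + head v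
    head-+ (x ∷ u) (y ∷ v) = refl

    head-* : ∀ {n} x (u : Vector (suc n)) → head (x *ᵛ u) ≡ x * head u
    head-* x (y ∷ u) = refl

    head∷tail : ∀ {n} (u : Vector (suc n)) → head u ∷ tail u ≡ u
    head∷tail (x ∷ u) = refl

  -- The matrix with first column `x ∷ t` and the other basis vectors fixed; it is invertible as x
  -- is nonzero.
  shearBijection : ∀ {n} x → x ≢ 0# → (t : Vector n) → LinearBijection (suc n)
  shearBijection x x≢0 t = record
    { to = λ { (y ∷ s) → (y * x) ∷ (s +ᵛ y *ᵛ t) }
    ; from = λ { (y ∷ s) → (y * x⁻¹) ∷ (s +ᵛ (- (y * x⁻¹)) *ᵛ t) }
    ; to-+ = λ { (y ∷ s) (y′ ∷ s′) → cong₂ _∷_ (distribʳ x y y′) (shear-+ y y′ s s′ t) }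
    ; to-* = λ { z (y ∷ s) → cong₂ _∷_ (*-assoc z y x) (shear-* z y s t) }
    ; to-from = λ { (y ∷ s) → cong₂ _∷_ (cancel′ y) (shear-cancel (- (y * x⁻¹)) (y * x⁻¹) s t (-‿inverseˡ _)) }
    ; from-to = λ { (y ∷ s) → cong₂ _∷_ (cancel y) (shear-cancel y (- (y * x * x⁻¹)) s t (trans (cong (λ z → y + - z) (cancel y)) (-‿inverseʳ y))) }
    }
    where
    x⁻¹ = proj₁ (inverse x x≢0)
    cancel : ∀ y → y * x * x⁻¹ ≡ y
    cancel y = trans (*-assoc y x x⁻¹) (trans (cong (y *_) (proj₂ (inverse x x≢0))) (*-identityʳ y))
    cancel′ : ∀ y → y * x⁻¹ * x ≡ y
    cancel′ y = trans (*-assoc y x⁻¹ x) (trans (cong (y *_) (trans (*-comm x⁻¹ x) (proj₂ (inverse x x≢0)))) (*-identityʳ y))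

  -- The second coordinate moves to the front and e acts on the rest. The first basis vector then
  -- acquires a leading zero, which serves targets that begin with one.
  swapBijection : ∀ {n} → LinearBijection (suc n) → LinearBijection (suc (suc n))
  swapBijection e = record
    { to = λ { (y ∷ s₀ ∷ s) → s₀ ∷ to e (y ∷ s) }
    ; from = λ { (y ∷ s) → head (from e s) ∷ y ∷ tail (from e s) }
    ; to-+ = λ { (y ∷ s₀ ∷ s) (y′ ∷ s₀′ ∷ s′) → cong (_ ∷_) (L.to-+ (y ∷ s) (y′ ∷ s′)) }
    ; to-* = λ { x (y ∷ s₀ ∷ s) → cong (_ ∷_) (L.to-* x (y ∷ s)) }
    ; to-from = λ { (y ∷ s) → cong (y ∷_) (trans (cong (to e) (head∷tail (from e s))) (L.to-from s)) }
    ; from-to = λ { (y ∷ s₀ ∷ s) → cong₂ (λ a b → a ∷ s₀ ∷ b) (cong head (L.from-to (y ∷ s))) (cong tail (L.from-to (y ∷ s))) }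
    }
    where module L = LinearBijection e

  -- Keeps the first basis vector and sends the second to x followed by the image under e of the
  -- first basis vector of the smaller space.
  fixFirstBijection : ∀ {n} → Carrier → LinearBijection (suc n) → LinearBijection (suc (suc n))
  fixFirstBijection x e = record
    { to = λ { (y ∷ s) → (y + x * head s) ∷ to e s }
    ; from = λ { (y ∷ s) → (y + - (x * head (from e s))) ∷ from e s }
    ; to-+ = λ { (y ∷ s) (y′ ∷ s′) → cong₂ _∷_
        (trans (cong (λ z → (y + y′) + x * z) (head-+ s s′))
          (solve 5 (λ y y′ x a b → (y :+ y′) :+ x :* (a :+ b) := (y :+ x :* a) :+ (y′ :+ x :* b)) refl y y′ x (head s) (head s′)))
        (L.to-+ s s′) }
    ; to-* = λ { z (y ∷ s) → cong₂ _∷_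
        (trans (cong (λ w → z * y + x * w) (head-* z s))
          (solve 4 (λ z y x a → z :* y :+ x :* (z :* a) := z :* (y :+ x :* a)) refl z y x (head s)))
        (L.to-* z s) }
    ; to-from = λ { (y ∷ s) → cong₂ _∷_
        (solve 2 (λ y a → (y :+ :- a) :+ a := y) refl y (x * head (from e s))) (L.to-from s) }
    ; from-to = λ { (y ∷ s) → cong₂ _∷_
        (trans (cong (λ u → (y + x * head s) + - (x * head u)) (L.from-to s))
          (solve 2 (λ y a → (y :+ a) :+ :- a := y) refl y (x * head s))) (L.from-to s) }
    }
    where
    module L = LinearBijection e
    open Solver using (solve; _:+_; _:*_; :-_; _:=_)

  nonzero-transitive : ∀ {n} (v : Vector (suc n)) → v ≢ 0ᵛ → Σ (LinearBijection (suc n)) λ e → to e (basis Fin.zero) ≡ v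
  nonzero-transitive (x ∷ t) v≢0 = go (x ≟ 0#) t v≢0
    where
    go : ∀ {n} → Dec (x ≡ 0#) → (t : Vector n) → x ∷ t ≢ 0ᵛ → Σ (LinearBijection (suc n)) λ e → to e (basis Fin.zero) ≡ x ∷ t
    go (no x≢0) t v≢0 = shearBijection x x≢0 t , cong₂ _∷_ (*-identityˡ x)
      (trans (cong (0ᵛ +ᵛ_) (1*ᵛ t)) (+ᵛ-identityˡ t))
    go (yes x≡0) [] v≢0 = contradiction (cong (_∷ []) x≡0) v≢0
    go (yes x≡0) (y ∷ t) v≢0 = let e , ee = nonzero-transitive (y ∷ t) (λ e → v≢0 (cong₂ _∷_ x≡0 e)) in
      swapBijection e , cong₂ _∷_ (sym x≡0) ee

  -- After v is moved to the first basis vector, the preimage `x ∷ t` of w has nonzero tail by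
  -- independence; a bijection fixing the first basis vector then adjusts the second.
  independent-transitive : ∀ {n} (v w : Vector (suc (suc n))) → v ≢ 0ᵛ → (∀ a → w ≢ a *ᵛ v) →
    Σ (LinearBijection (suc (suc n))) λ e → to e (basis Fin.zero) ≡ v × to e (basis (Fin.suc Fin.zero)) ≡ w
  independent-transitive v w v≢0 w≢av with nonzero-transitive v v≢0
  ... | e , e≡v = go (from e w) refl
    where
    module L = LinearBijection e
    go : ∀ w′ → from e w ≡ w′ → Σ (LinearBijection _) λ e → to e (basis Fin.zero) ≡ v × to e (basis (Fin.suc Fin.zero)) ≡ w
    go (x ∷ t) e≡ = let f , f≡t = nonzero-transitive t t≢0 in
      e ∘ᴸ fixFirstBijection x f ,
      trans (cong L.to (cong₂ _∷_ (trans (cong (1# +_) (zeroʳ x)) (+-identityʳ 1#)) (LinearBijection.to-0 f))) e≡v ,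
      trans (cong L.to (cong₂ _∷_ (trans (+-identityˡ _) (*-identityʳ x)) f≡t)) (trans (cong L.to (sym e≡)) (L.to-from w))
      where
      t≢0 : t ≢ 0ᵛ
      t≢0 t≡0 = w≢av x (begin
        w ≡⟨ L.to-from w ⟨
        L.to (L.from w) ≡⟨ cong L.to e≡ ⟩
        L.to (x ∷ t) ≡⟨ cong L.to (cong₂ _∷_ (sym (*-identityʳ x)) (trans t≡0 (sym (*ᵛ-0 x)))) ⟩
        L.to (x *ᵛ basis Fin.zero) ≡⟨ L.to-* x (basis Fin.zero) ⟩
        x *ᵛ L.to (basis Fin.zero) ≡⟨ cong (x *ᵛ_) e≡v ⟩
        x *ᵛ v ∎)
        where open ≡-Reasoning

-- Nonsingular hermitian matrices and their congruences.

module MatrixForms {c} (q : ℕ) (pp : IsPrimePower q) (F : Field c) (iso : Field.Carrier F ↔ Fin (q ℕ.^ 2)) where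
  open import Data.Vec.Base using (lookup; tabulate)
  open import Data.Vec.Properties using (lookup-zipWith; lookup-map; lookup-replicate; lookup∘tabulate; tabulate∘lookup; tabulate-cong)
  open Field F
  open CoordinateSpaces q pp F iso public

  ∑-cong : ∀ {n} {f g : Fin n → Carrier} → (∀ i → f i ≡ g i) → ∑ f ≡ ∑ g
  ∑-cong {zero} e = refl
  ∑-cong {suc n} e = cong₂ _+_ (e Fin.zero) (∑-cong (λ i → e (Fin.suc i)))

  ∑-zero : ∀ n → ∑ {n} (λ _ → 0#) ≡ 0#
  ∑-zero zero = refl
  ∑-zero (suc n) = trans (+-identityˡ _) (∑-zero n)

  ∑-+ : ∀ {n} (f g : Fin n → Carrier) → ∑ (λ i → f i + g i) ≡ ∑ f + ∑ g
  ∑-+ {zero} f g = sym (+-identityˡ 0#)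
  ∑-+ {suc n} f g = trans (cong (f Fin.zero + g Fin.zero +_) (∑-+ (λ i → f (Fin.suc i)) (λ i → g (Fin.suc i))))
    (solve 4 (λ a b x y → (a :+ b) :+ (x :+ y) := (a :+ x) :+ (b :+ y)) refl _ _ _ _)
    where open Solver using (solve; _:+_; _:=_)

  ∑-*ˡ : ∀ {n} x (f : Fin n → Carrier) → ∑ (λ i → x * f i) ≡ x * ∑ f
  ∑-*ˡ {zero} x f = sym (zeroʳ x)
  ∑-*ˡ {suc n} x f = trans (cong (x * f Fin.zero +_) (∑-*ˡ x (λ i → f (Fin.suc i)))) (sym (distribˡ x _ _))

  ∑-swap : ∀ {m n} (f : Fin m → Fin n → Carrier) → ∑ (λ i → ∑ (f i)) ≡ ∑ (λ j → ∑ (λ i → f i j))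
  ∑-swap {zero} {n} f = sym (∑-zero n)
  ∑-swap {suc m} f = trans (cong (∑ (f Fin.zero) +_) (∑-swap (λ i → f (Fin.suc i)))) (sym (∑-+ (f Fin.zero) _))

  conj-∑ : ∀ {n} (f : Fin n → Carrier) → conj (∑ f) ≡ ∑ (λ i → conj (f i))
  conj-∑ {zero} f = conj-0
  conj-∑ {suc n} f = trans (conj-+ _ _) (cong (conj (f Fin.zero) +_) (conj-∑ (λ i → f (Fin.suc i))))

  ∑-basis : ∀ {n} (f : Fin n → Carrier) k → ∑ (λ i → f i * lookup (basis k) i) ≡ f k
  ∑-basis {suc n} f Fin.zero = trans (cong₂ _+_ (*-identityʳ _)
    (trans (∑-cong (λ i → trans (cong (f (Fin.suc i) *_) (lookup-replicate i 0#)) (zeroʳ _))) (∑-zero n))) (+-identityʳ _)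
  ∑-basis {suc n} f (Fin.suc k) = trans (cong₂ _+_ (zeroʳ _) (∑-basis (λ i → f (Fin.suc i)) k)) (+-identityˡ _)

  conj-basis : ∀ {n} (k i : Fin n) → conj (lookup (basis k) i) ≡ lookup (basis k) i
  conj-basis Fin.zero Fin.zero = conj-1
  conj-basis Fin.zero (Fin.suc i) = trans (cong conj (lookup-replicate i 0#)) (trans conj-0 (sym (lookup-replicate i 0#)))
  conj-basis (Fin.suc k) Fin.zero = conj-0
  conj-basis (Fin.suc k) (Fin.suc i) = conj-basis k i

  record Linear {n} (f : Vector n → Carrier) : Set c where
    field
      lin-+ : ∀ u v → f (u +ᵛ v) ≡ f u + f v
      lin-* : ∀ x u → f (x *ᵛ u) ≡ x * f u
  open Linear

  linear-ext : ∀ {n} {f g : Vector n → Carrier} → Linear f → Linear g →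
    (∀ k → f (basis k) ≡ g (basis k)) → ∀ u → f u ≡ g u
  linear-ext {zero} lf lg e [] = trans (lin-* lf 0# []) (trans (zeroˡ _) (sym (trans (lin-* lg 0# []) (zeroˡ _))))
  linear-ext {suc n} {f} {g} lf lg e (x ∷ u) = begin
    f (x ∷ u) ≡⟨ split lf ⟩
    x * f (basis Fin.zero) + f (0# ∷ u)
      ≡⟨ cong₂ _+_ (cong (x *_) (e Fin.zero)) (linear-ext (extend lf) (extend lg) (λ k → e (Fin.suc k)) u) ⟩
    x * g (basis Fin.zero) + g (0# ∷ u) ≡⟨ split lg ⟨
    g (x ∷ u) ∎
    where
    open ≡-Reasoning
    split : ∀ {f} → Linear f → f (x ∷ u) ≡ x * f (basis Fin.zero) + f (0# ∷ u)
    split {f} lf = trans (cong f (cong₂ _∷_ (sym (trans (+-identityʳ _) (*-identityʳ x)))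
        (sym (trans (cong (_+ᵛ u) (*ᵛ-0 x)) (+ᵛ-identityˡ u)))))
      (trans (lin-+ lf (x *ᵛ basis Fin.zero) (0# ∷ u)) (cong (_+ f (0# ∷ u)) (lin-* lf x (basis Fin.zero))))
    extend : ∀ {f} → Linear f → Linear (λ u → f (0# ∷ u))
    extend {f} lf = record
      { lin-+ = λ u v → trans (cong f (cong (_∷ (u +ᵛ v)) (sym (+-identityˡ 0#)))) (lin-+ lf (0# ∷ u) (0# ∷ v))
      ; lin-* = λ y u → trans (cong f (cong (_∷ (y *ᵛ u)) (sym (zeroʳ y)))) (lin-* lf y (0# ∷ u))
      }

  -- Vectors instead of functions, so that propositional equality is decidable and all matrices can
  -- be listed.
  SquareMatrix : ℕ → Set c
  SquareMatrix n = Vec (Vector n) n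

  entry : ∀ {n} → SquareMatrix n → Fin n → Fin n → Carrier
  entry B i j = lookup (lookup B i) j

  matrix : ∀ {n} → (Fin n → Fin n → Carrier) → SquareMatrix n
  matrix f = tabulate (λ i → tabulate (f i))

  entry-matrix : ∀ {n} (f : Fin n → Fin n → Carrier) i j → entry (matrix f) i j ≡ f i j
  entry-matrix f i j = trans (cong (λ r → lookup r j) (lookup∘tabulate (λ i → tabulate (f i)) i)) (lookup∘tabulate (f i) j)

  matrix-entry : ∀ {n} (B : SquareMatrix n) → matrix (entry B) ≡ B
  matrix-entry B = trans (tabulate-cong (λ i → tabulate∘lookup (lookup B i))) (tabulate∘lookup B)

  matrix-cong : ∀ {n} {f g : Fin n → Fin n → Carrier} → (∀ i j → f i j ≡ g i j) → matrix f ≡ matrix g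
  matrix-cong e = tabulate-cong (λ i → tabulate-cong (e i))

  bil : ∀ {n} → SquareMatrix n → Vector n → Vector n → Carrier
  bil B u v = ∑ (λ i → conj (lookup u i) * ∑ (λ j → entry B i j * lookup v j))

  bil-linearʳ : ∀ {n} (B : SquareMatrix n) u → Linear (bil B u)
  bil-linearʳ {n} B u = record
    { lin-+ = λ v w → trans
        (∑-cong (λ i → trans (cong (conj (lookup u i) *_) (trans
          (∑-cong (λ j → trans (cong (entry B i j *_) (lookup-zipWith _+_ j v w)) (distribˡ _ _ _)))
          (∑-+ (λ j → entry B i j * lookup v j) (λ j → entry B i j * lookup w j)))) (distribˡ _ _ _)))
        (∑-+ (λ i → conj (lookup u i) * ∑ (λ j → entry B i j * lookup v j)) _)
    ; lin-* = λ x v → trans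
        (∑-cong (λ i → trans (cong (conj (lookup u i) *_) (trans
          (∑-cong (λ j → trans (cong (entry B i j *_) (lookup-map j (x *_) v)) (exchange (entry B i j) x (lookup v j))))
          (∑-*ˡ x (λ j → entry B i j * lookup v j)))) (exchange _ x _)))
        (∑-*ˡ {n} x _)
    }
    where
    exchange : ∀ a x b → a * (x * b) ≡ x * (a * b)
    exchange = solve 3 (λ a x b → a :* (x :* b) := x :* (a :* b)) refl
      where open Solver using (solve; _:*_; _:=_)

  -- `bil` is semilinear on the left; conjugating it makes `linear-ext` applicable there too.
  conj-bil-linearˡ : ∀ {n} (B : SquareMatrix n) v → Linear (λ u → conj (bil B u v))
  conj-bil-linearˡ B v = record
    { lin-+ = λ u w → trans (cong conj (trans
        (∑-cong (λ i → trans (cong (_* row i) (trans (cong conj (lookup-zipWith _+_ i u w)) (conj-+ _ _))) (distribʳ _ _ _)))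
        (∑-+ (λ i → conj (lookup u i) * row i) _))) (conj-+ _ _)
    ; lin-* = λ x u → trans (cong conj (trans
        (∑-cong (λ i → trans (cong (_* row i) (trans (cong conj (lookup-map i (x *_) u)) (conj-* _ _))) (*-assoc _ _ _)))
        (∑-*ˡ (conj x) (λ i → conj (lookup u i) * row i)))) (trans (conj-* _ _) (cong (_* _) (conj-conj x)))
    }
    where
    row : Fin _ → Carrier
    row i = ∑ (λ j → entry B i j * lookup v j)

  bil-basis : ∀ {n} (B : SquareMatrix n) k l → bil B (basis k) (basis l) ≡ entry B k l
  bil-basis B k l = trans (∑-cong (λ i → trans (cong₂ _*_ (conj-basis k i) (∑-basis (entry B i) l)) (*-comm _ _)))
                          (∑-basis (λ i → entry B i l) k)

  -- The Gram matrix of the transported basis, that is E* B E for the matrix E of e.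
  congruence : ∀ {n} → LinearBijection n → SquareMatrix n → SquareMatrix n
  congruence e B = matrix (λ i j → bil B (LinearBijection.to e (basis i)) (LinearBijection.to e (basis j)))

  bil-congruence : ∀ {n} (e : LinearBijection n) B u v →
    bil (congruence e B) u v ≡ bil B (LinearBijection.to e u) (LinearBijection.to e v)
  bil-congruence e B u v = trans (sym (conj-conj _)) (trans (cong conj (linear-ext
      (conj-bil-linearˡ (congruence e B) v)
      (record { lin-+ = λ u w → trans (cong (λ z → conj (bil B z (L.to v))) (L.to-+ u w)) (lin-+ (conj-bil-linearˡ B (L.to v)) (L.to u) (L.to w))
              ; lin-* = λ x u → trans (cong (λ z → conj (bil B z (L.to v))) (L.to-* x u)) (lin-* (conj-bil-linearˡ B (L.to v)) x (L.to u)) })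
      (λ k → cong conj (onBasis k v)) u)) (conj-conj _))
    where
    module L = LinearBijection e
    onBasis : ∀ k v → bil (congruence e B) (basis k) v ≡ bil B (L.to (basis k)) (L.to v)
    onBasis k = linear-ext (bil-linearʳ (congruence e B) (basis k))
      (record { lin-+ = λ v w → trans (cong (bil B (L.to (basis k))) (L.to-+ v w)) (lin-+ (bil-linearʳ B (L.to (basis k))) (L.to v) (L.to w))
              ; lin-* = λ x v → trans (cong (bil B (L.to (basis k))) (L.to-* x v)) (lin-* (bil-linearʳ B (L.to (basis k))) x (L.to v)) })
      (λ l → trans (bil-basis (congruence e B) k l) (entry-matrix _ k l))

  congruence-inverse : ∀ {n} (e : LinearBijection n) B → congruence (LinearBijection.inverse-bijection e) (congruence e B) ≡ B
  congruence-inverse e B = trans (matrix-cong (λ i j → trans (bil-congruence e B _ _)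
    (trans (cong₂ (bil B) (L.to-from (basis i)) (L.to-from (basis j))) (bil-basis B i j)))) (matrix-entry B)
    where module L = LinearBijection e

  IsHermitian NonDeg Regular : ∀ {n} → SquareMatrix n → Set c
  IsHermitian B = ∀ i j → conj (entry B i j) ≡ entry B j i
  NonDeg B = ∀ u → (∀ v → bil B u v ≡ 0#) → u ≡ 0ᵛ
  Regular B = IsHermitian B × NonDeg B

  bil-sym : ∀ {n} (B : SquareMatrix n) → IsHermitian B → ∀ u v → conj (bil B u v) ≡ bil B v u
  bil-sym {n} B hB u v = begin
    conj (bil B u v)
      ≡⟨ conj-∑ {n} _ ⟩
    ∑ (λ i → conj (conj (u′ i) * ∑ (λ j → entry B i j * v′ j)))
      ≡⟨ ∑-cong (λ i → trans (conj-* _ _) (cong₂ _*_ (conj-conj (u′ i)) (conj-∑ (λ j → entry B i j * v′ j)))) ⟩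
    ∑ (λ i → u′ i * ∑ (λ j → conj (entry B i j * v′ j)))
      ≡⟨ ∑-cong (λ i → sym (∑-*ˡ {n} (u′ i) _)) ⟩
    ∑ (λ i → ∑ (λ j → u′ i * conj (entry B i j * v′ j)))
      ≡⟨ ∑-swap {n} {n} _ ⟩
    ∑ (λ j → ∑ (λ i → u′ i * conj (entry B i j * v′ j)))
      ≡⟨ ∑-cong (λ j → trans (∑-cong (λ i → trans
           (cong (u′ i *_) (trans (conj-* _ _) (cong (_* conj (v′ j)) (hB i j))))
           (solve 3 (λ u b v → u :* (b :* v) := v :* (b :* u)) refl (u′ i) (entry B j i) (conj (v′ j)))))
           (∑-*ˡ (conj (v′ j)) (λ i → entry B j i * u′ i))) ⟩
    bil B v u ∎
    where
    open ≡-Reasoning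
    open Solver using (solve; _:*_; _:=_)
    u′ = lookup u
    v′ = lookup v

  matrixForm : ∀ {n} (B : SquareMatrix n) → IsHermitian B → HermitianForm (coordinateSpace n)
  matrixForm B hB = record
    { form = bil B
    ; form-⊕ = λ u → lin-+ (bil-linearʳ B u)
    ; form-· = λ u → lin-* (bil-linearʳ B u)
    ; form-sym = bil-sym B hB
    }

  Matrices : ∀ n → Enumeration (SquareMatrix n)
  Matrices n = Vec-Enumeration (Vec-Enumeration E n) n

  regular? : ∀ {n} (B : SquareMatrix n) → Dec (Regular B)
  regular? {n} B = Fin.all? (λ i → Fin.all? (λ j → conj (entry B i j) ≟ entry B j i)) ×-dec
    V.∀? (λ u → V.∀? (λ v → bil B u v ≟ 0#) →-dec (u V.≟ 0ᵛ))
    where module V = Enumeration (Vec-Enumeration E n)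

  regular-congruence : ∀ {n} (e : LinearBijection n) B → Regular B → Regular (congruence e B)
  regular-congruence e B (hB , nB) =
    (λ i j → trans (cong conj (entry-matrix _ i j)) (trans (bil-sym B hB (L.to (basis i)) (L.to (basis j))) (sym (entry-matrix _ j i)))) ,
    (λ u orth → L.to≡0 (nB (L.to u) (λ v → trans (cong (bil B (L.to u)) (sym (L.to-from v)))
      (trans (sym (bil-congruence e B u (L.from v))) (orth (L.from v))))))
    where module L = LinearBijection e

  identityMatrix : ∀ n → SquareMatrix n
  identityMatrix n = matrix (λ i j → lookup (basis i) j)

  -- One nonsingular hermitian matrix is exhibited to make `regularCount` positive, which permits
  -- cancelling it later.
  identity-regular : ∀ n → Regular (identityMatrix n)
  identity-regular n =
    (λ i j → trans (cong conj (entry-matrix _ i j)) (trans (conj-basis i j) (trans (basis-sym i j) (sym (entry-matrix _ j i))))) ,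
    λ u orth → trans (sym (tabulate∘lookup u)) (trans (tabulate-cong (λ k → trans (conj≡0 (begin
        conj (lookup u k)
          ≡⟨ ∑-basis (λ i → conj (lookup u i)) k ⟨
        ∑ (λ i → conj (lookup u i) * lookup (basis k) i)
          ≡⟨ ∑-cong (λ i → cong (conj (lookup u i) *_) (trans (basis-sym k i) (sym (trans (∑-basis (entry (identityMatrix n) i) k) (entry-matrix _ i k))))) ⟩
        bil (identityMatrix n) u (basis k)
          ≡⟨ orth (basis k) ⟩
        0# ∎)) (sym (lookup-replicate k 0#)))) (tabulate∘lookup 0ᵛ))
    where
    open ≡-Reasoning
    basis-sym : ∀ {n} (i j : Fin n) → lookup (basis i) j ≡ lookup (basis j) i
    basis-sym Fin.zero Fin.zero = refl
    basis-sym Fin.zero (Fin.suc j) = lookup-replicate j 0#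
    basis-sym (Fin.suc i) Fin.zero = sym (lookup-replicate i 0#)
    basis-sym (Fin.suc i) (Fin.suc j) = basis-sym i j

  module WeightedCounts (n : ℕ) where
    open Enumeration (Matrices n) using () renaming (list to matrices; ∑ᴱ to ∑ᴹ; ∈list to ∈matrices)

    weight : SquareMatrix n → ℤ
    weight B = 𝟙 (regular? B)

    weight≥0 : ∀ B → 0ℤ ℤ.≤ weight B
    weight≥0 B = 𝟙-≥0 (regular? B)

    regularCount : ℤ
    regularCount = ∑ᴹ weight

    weight-congruence : ∀ e B → weight (congruence e B) ≡ weight B
    weight-congruence e B = 𝟙-cong (regular? (congruence e B)) (regular? B)
      (λ r → subst Regular (congruence-inverse e B) (regular-congruence (LinearBijection.inverse-bijection e) (congruence e B) r))
      (regular-congruence e B)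

    weighted : (SquareMatrix n → ℤ) → ℤ
    weighted f = ∑ᴹ (λ B → weight B ℤ.* f B)

    -- Congruence permutes all matrices and preserves `Regular`, its inverse being congruence by the
    -- inverse bijection.
    weighted-congruence : ∀ e (f : SquareMatrix n → ℤ) → weighted (λ B → f (congruence e B)) ≡ weighted f
    weighted-congruence e f = trans
      (sum-cong matrices (λ B → cong (ℤ._* f (congruence e B)) (sym (weight-congruence e B))))
      (∑-bijection (Matrices n) (Matrices n) (congruence e) (congruence (LinearBijection.inverse-bijection e))
        (congruence-inverse e) (congruence-inverse (LinearBijection.inverse-bijection e)) (λ B → weight B ℤ.* f B))

    weighted-const : ∀ x → weighted (λ _ → x) ≡ regularCount ℤ.* x
    weighted-const x = sum-*ʳ matrices x weight

    weighted-cong : ∀ {f g : SquareMatrix n → ℤ} → (∀ B → Regular B → f B ≡ g B) → weighted f ≡ weighted g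
    weighted-cong {f} {g} e = sum-cong matrices (λ B → go B (regular? B))
      where
      go : ∀ B (d : Dec (Regular B)) → 𝟙 d ℤ.* f B ≡ 𝟙 d ℤ.* g B
      go B (yes r) = cong (1ℤ ℤ.*_) (e B r)
      go B (no _) = refl

    regularCount>0 : 0ℤ ℤ.< regularCount
    regularCount>0 = ℤ.≤∧≢⇒< (sum-≥0 matrices (λ {B} _ → weight≥0 B)) λ z →
      contradiction (trans (sym (sum≡0⇒≡0 matrices (λ {B} _ → weight≥0 B) (ℤ.≤-reflexive (sym z)) (∈matrices (identityMatrix n))))
        (𝟙-yes (regular? (identityMatrix n)) (identity-regular n))) λ ()

-- Collisions of the trace pairing and double counts over nonsingular matrices.

module RankCounts {c} (q : ℕ) (pp : IsPrimePower q) (F : Field c) (iso : Field.Carrier F ↔ Fin (q ℕ.^ 2)) where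
  open import Data.Vec.Base using (lookup)
  open Field F
  open MatrixForms q pp F iso public

  -- Cauchy-Schwarz in the form of a nonnegative variance over the q fixed values; the deviation
  -- from the mean is multiplied by q to remain an integer.
  collisions≥ : ∀ {a} {A : Set a} (xs : List A) (φ : A → Carrier) → (∀ {x} → x ∈ xs → conj (φ x) ≡ φ x) →
    sumOver xs (λ _ → 1ℤ) ℤ.* sumOver xs (λ _ → 1ℤ) ℤ.≤ Q ℤ.* sumOver xs (λ x → sumOver xs (λ y → 𝟙 (φ x ≟ φ y)))
  collisions≥ xs φ φ-fixed = subst (λ z → L ℤ.* L ℤ.≤ Q ℤ.* z) ∑occ²
      (ℤ.0≤i-j⇒j≤i (ℤ.*-cancelˡ-≤-pos 0ℤ (Q ℤ.* S₂ ℤ.- L ℤ.* L) Q (subst₂ ℤ._≤_ (sym (ℤ.*-zeroʳ Q)) variance≡ variance≥0)))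
    where
    open Occurrences xs φ
    L = sumOver xs (λ _ → 1ℤ)
    S₂ = ∑ᴱ (λ t → occ t ℤ.* occ t)
    variance = ∑ᴱ (λ t → fixed t ℤ.* ((Q ℤ.* occ t ℤ.- L) ℤ.* (Q ℤ.* occ t ℤ.- L)))
    square≥0 : ∀ i → 0ℤ ℤ.≤ i ℤ.* i
    square≥0 (pos n) = *-≥0 {pos n} {pos n} (ℤ.+≤+ ℕ.z≤n) (ℤ.+≤+ ℕ.z≤n)
    square≥0 ℤ.-[1+ n ] = ℤ.+≤+ ℕ.z≤n
    variance≥0 : 0ℤ ℤ.≤ variance
    variance≥0 = sum-≥0 list (λ {t} _ → *-≥0 (fixed≥0 t) (square≥0 (Q ℤ.* occ t ℤ.- L)))
    fixed*occ² : ∀ t (d : Dec (conj t ≡ t)) → 𝟙 d ℤ.* (occ t ℤ.* occ t) ≡ occ t ℤ.* occ t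
    fixed*occ² t (yes _) = ℤ.*-identityˡ (occ t ℤ.* occ t)
    fixed*occ² t (no ne) = sym (cong₂ ℤ._*_ (occ-nonfixed φ-fixed ne) (occ-nonfixed φ-fixed ne))
    expand : ∀ f Q o L → f ℤ.* ((Q ℤ.* o ℤ.- L) ℤ.* (Q ℤ.* o ℤ.- L)) ≡
      (Q ℤ.* Q) ℤ.* (f ℤ.* (o ℤ.* o)) ℤ.- (pos 2 ℤ.* Q ℤ.* L) ℤ.* (f ℤ.* o) ℤ.+ f ℤ.* (L ℤ.* L)
    expand = let open ℤ-Solver in solve 4 (λ f Q o L → f :* ((Q :* o :- L) :* (Q :* o :- L)) :=
      (Q :* Q) :* (f :* (o :* o)) :- (con (pos 2) :* Q :* L) :* (f :* o) :+ f :* (L :* L)) refl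
    variance≡ : variance ≡ Q ℤ.* (Q ℤ.* S₂ ℤ.- L ℤ.* L)
    variance≡ = begin
      variance
        ≡⟨ sum-cong list (λ t → expand (fixed t) Q (occ t) L) ⟩
      ∑ᴱ (λ t → (Q ℤ.* Q) ℤ.* (fixed t ℤ.* (occ t ℤ.* occ t)) ℤ.- (pos 2 ℤ.* Q ℤ.* L) ℤ.* (fixed t ℤ.* occ t) ℤ.+ fixed t ℤ.* (L ℤ.* L))
        ≡⟨ trans (sum-+ list _ (λ t → fixed t ℤ.* (L ℤ.* L)))
             (cong (ℤ._+ ∑ᴱ (λ t → fixed t ℤ.* (L ℤ.* L))) (sum-minus list _ (λ t → (pos 2 ℤ.* Q ℤ.* L) ℤ.* (fixed t ℤ.* occ t)))) ⟩
      ∑ᴱ (λ t → (Q ℤ.* Q) ℤ.* (fixed t ℤ.* (occ t ℤ.* occ t))) ℤ.- ∑ᴱ (λ t → (pos 2 ℤ.* Q ℤ.* L) ℤ.* (fixed t ℤ.* occ t)) ℤ.+ ∑ᴱ (λ t → fixed t ℤ.* (L ℤ.* L))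
        ≡⟨ cong₂ ℤ._+_ (cong₂ ℤ._-_
             (trans (sum-*ˡ list (Q ℤ.* Q) _) (cong ((Q ℤ.* Q) ℤ.*_) (sum-cong list (λ t → fixed*occ² t (conj t ≟ t)))))
             (trans (sum-*ˡ list (pos 2 ℤ.* Q ℤ.* L) _) (cong ((pos 2 ℤ.* Q ℤ.* L) ℤ.*_) (∑fixed*occ φ-fixed))))
             (trans (sum-*ʳ list (L ℤ.* L) fixed) (cong (ℤ._* (L ℤ.* L)) card-fixed)) ⟩
      (Q ℤ.* Q) ℤ.* S₂ ℤ.- (pos 2 ℤ.* Q ℤ.* L) ℤ.* L ℤ.+ Q ℤ.* (L ℤ.* L)
        ≡⟨ collect Q S₂ L ⟩
      Q ℤ.* (Q ℤ.* S₂ ℤ.- L ℤ.* L) ∎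
      where
      open ≡-Reasoning
      collect : ∀ Q s L → (Q ℤ.* Q) ℤ.* s ℤ.- (pos 2 ℤ.* Q ℤ.* L) ℤ.* L ℤ.+ Q ℤ.* (L ℤ.* L) ≡ Q ℤ.* (Q ℤ.* s ℤ.- L ℤ.* L)
      collect = let open ℤ-Solver in solve 3 (λ Q s L → (Q :* Q) :* s :- (con (pos 2) :* Q :* L) :* L :+ Q :* (L :* L) := Q :* (Q :* s :- L :* L)) refl

  -- The trace pairing tr(X Bᵀ).
  pairing : ∀ {n} → SquareMatrix n → (Fin n → Fin n → Carrier) → Carrier
  pairing B X = ∑ (λ k → ∑ (λ l → X k l * entry B k l))

  pairing-cong : ∀ {n} (B : SquareMatrix n) {X Y} → (∀ k l → X k l ≡ Y k l) → pairing B X ≡ pairing B Y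
  pairing-cong B e = ∑-cong (λ k → ∑-cong (λ l → cong (_* entry B k l) (e k l)))

  pairing-+ : ∀ {n} (B : SquareMatrix n) X Y → pairing B (λ k l → X k l + Y k l) ≡ pairing B X + pairing B Y
  pairing-+ {n} B X Y = trans (∑-cong (λ k → trans (∑-cong (λ l → distribʳ (entry B k l) (X k l) (Y k l)))
    (∑-+ {n} (λ l → X k l * entry B k l) (λ l → Y k l * entry B k l))))
    (∑-+ {n} (λ k → ∑ (λ l → X k l * entry B k l)) (λ k → ∑ (λ l → Y k l * entry B k l)))

  pairing-* : ∀ {n} (B : SquareMatrix n) x X → pairing B (λ k l → x * X k l) ≡ x * pairing B X
  pairing-* {n} B x X = trans (∑-cong (λ k → trans (∑-cong (λ l → *-assoc x (X k l) (entry B k l)))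
    (∑-*ˡ {n} x (λ l → X k l * entry B k l)))) (∑-*ˡ {n} x (λ k → ∑ (λ l → X k l * entry B k l)))

  pairing-neg : ∀ {n} (B : SquareMatrix n) X → pairing B (λ k l → - X k l) ≡ - pairing B X
  pairing-neg B X = trans (pairing-cong B (λ k l → neg≡ (X k l))) (trans (pairing-* B (- 1#) X) (sym (neg≡ _)))
    where
    neg≡ : ∀ x → - x ≡ - 1# * x
    neg≡ = let open Solver in solve 1 (λ x → :- x := :- con 1ℤ :* x) refl

  -- Annihilating a matrix of rank one or two thereby becomes isotropy for b or for M ⊗ b.
  pairing-outer : ∀ {n} (B : SquareMatrix n) u v → pairing B (λ k l → conj (lookup u k) * lookup v l) ≡ bil B u v
  pairing-outer {n} B u v = ∑-cong (λ k → trans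
    (∑-cong (λ l → solve 3 (λ u v b → (u :* v) :* b := u :* (b :* v)) refl (conj (lookup u k)) (lookup v l) (entry B k l)))
    (∑-*ˡ {n} (conj (lookup u k)) (λ l → entry B k l * lookup v l)))
    where open Solver using (solve; _:*_; _:=_)

  pairing-0 : ∀ {n} (B : SquareMatrix n) {X} → (∀ k l → X k l ≡ 0#) → pairing B X ≡ 0#
  pairing-0 {n} B e = trans (∑-cong (λ k → trans (∑-cong (λ l → trans (cong (_* entry B k l) (e k l)) (zeroˡ _))) (∑-zero n))) (∑-zero n)

  -- Conjugation transposes both factors, and the double sum is symmetric. The pairing thus has only
  -- q possible values, which makes q and not q² the collision constant.
  pairing-fixed : ∀ {n} (B : SquareMatrix n) X → IsHermitian B → (∀ k l → conj (X k l) ≡ X l k) →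
    conj (pairing B X) ≡ pairing B X
  pairing-fixed {n} B X hB hX = trans (conj-∑ {n} _) (trans (∑-cong (λ k → trans (conj-∑ {n} _)
    (∑-cong (λ l → trans (conj-* _ _) (cong₂ _*_ (hX k l) (hB k l)))))) (∑-swap {n} {n} (λ k l → X l k * entry B l k)))

  module Counts (n₂ : ℕ) where
    n : ℕ
    n = suc (suc n₂)

    open WeightedCounts n public
    open Space (coordinateSpace n) using (σ; vectors; ∑ⱽ; _≟ⱽ_; card-σ; ∑ⱽ-δ)
    open Enumeration (Matrices n) using () renaming (list to matrices)

    weighted-∑ : ∀ {a} {A : Set a} (xs : List A) (f : A → SquareMatrix n → ℤ) →
      sumOver xs (λ x → weighted (f x)) ≡ weighted (λ B → sumOver xs (λ x → f x B))
    weighted-∑ xs f = trans (sum-swap xs matrices _) (sum-cong matrices (λ B → sum-*ˡ xs (weight B) (λ x → f x B)))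

    weighted-*ˡ : ∀ x f → weighted (λ B → x ℤ.* f B) ≡ x ℤ.* weighted f
    weighted-*ˡ x f = trans (sum-cong matrices (λ B → exchange (weight B) x (f B))) (sum-*ˡ matrices x (λ B → weight B ℤ.* f B))
      where
      exchange : ∀ w x f → w ℤ.* (x ℤ.* f) ≡ x ℤ.* (w ℤ.* f)
      exchange = let open ℤ-Solver in solve 3 (λ w x f → w :* (x :* f) := x :* (w :* f)) refl

    weighted-minus : ∀ f g → weighted (λ B → f B ℤ.- g B) ≡ weighted f ℤ.- weighted g
    weighted-minus f g = trans (sum-cong matrices (λ B → distr (weight B) (f B) (g B))) (sum-minus matrices _ _)
      where
      distr : ∀ w f g → w ℤ.* (f ℤ.- g) ≡ w ℤ.* f ℤ.- w ℤ.* g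
      distr = let open ℤ-Solver in solve 3 (λ w f g → w :* (f :- g) := w :* f :- w :* g) refl

    -- The count called c(X) in the overview.
    annihilators : (Fin n → Fin n → Carrier) → ℤ
    annihilators X = weighted (λ B → 𝟙 (pairing B X ≟ 0#))

    annihilators-0 : ∀ X → (∀ k l → X k l ≡ 0#) → annihilators X ≡ regularCount
    annihilators-0 X X≡0 = trans (weighted-cong (λ B _ → 𝟙-yes (pairing B X ≟ 0#) (pairing-0 B X≡0)))
      (trans (weighted-const 1ℤ) (ℤ.*-identityʳ regularCount))

    isotropicFor : Vector n → ℤ
    isotropicFor v = weighted (λ B → 𝟙 (bil B v v ≟ 0#))

    isotropicFor-const : ∀ v → v ≢ 0ᵛ → isotropicFor v ≡ isotropicFor (basis Fin.zero)
    isotropicFor-const v v≢0 = let e , e≡v = nonzero-transitive v v≢0 in begin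
      weighted (λ B → 𝟙 (bil B v v ≟ 0#))
        ≡⟨ sum-cong matrices (λ B → cong (λ z → weight B ℤ.* 𝟙 (z ≟ 0#))
             (trans (cong₂ (bil B) (sym e≡v) (sym e≡v)) (sym (bil-congruence e B (basis Fin.zero) (basis Fin.zero))))) ⟩
      weighted (λ B → 𝟙 (bil (congruence e B) (basis Fin.zero) (basis Fin.zero) ≟ 0#))
        ≡⟨ weighted-congruence e (λ B → 𝟙 (bil B (basis Fin.zero) (basis Fin.zero) ≟ 0#)) ⟩
      isotropicFor (basis Fin.zero) ∎
      where open ≡-Reasoning

    -- Double counting of the pairs (B, v) with v isotropic for B. The zero vector is isotropic for
    -- every B, which accounts for the separate `regularCount`.
    rankOne-equation : ∀ v → v ≢ 0ᵛ →
      Q ℤ.* ((σ ℤ.* σ ℤ.- 1ℤ) ℤ.* isotropicFor v ℤ.+ regularCount) ≡ regularCount ℤ.* (σ ℤ.* σ ℤ.+ (Q ℤ.- 1ℤ) ℤ.* σ)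
    rankOne-equation v v≢0 = begin
      Q ℤ.* ((σ ℤ.* σ ℤ.- 1ℤ) ℤ.* isotropicFor v ℤ.+ regularCount)
        ≡⟨ cong (λ t → Q ℤ.* ((σ ℤ.* σ ℤ.- 1ℤ) ℤ.* t ℤ.+ regularCount)) (isotropicFor-const v v≢0) ⟩
      Q ℤ.* ((σ ℤ.* σ ℤ.- 1ℤ) ℤ.* t₁ ℤ.+ regularCount)
        ≡⟨ cong (Q ℤ.*_) (rearrange (σ ℤ.* σ) t₁ regularCount) ⟩
      Q ℤ.* (σ ℤ.* σ ℤ.* t₁ ℤ.+ (regularCount ℤ.- t₁))
        ≡⟨ cong (Q ℤ.*_) ∑-isotropicFor ⟨
      Q ℤ.* ∑ⱽ isotropicFor
        ≡⟨ cong (Q ℤ.*_) (weighted-∑ vectors _) ⟩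
      Q ℤ.* weighted (λ B → ∑ⱽ (λ v → 𝟙 (bil B v v ≟ 0#)))
        ≡⟨ weighted-*ˡ Q _ ⟨
      weighted (λ B → Q ℤ.* ∑ⱽ (λ v → 𝟙 (bil B v v ≟ 0#)))
        ≡⟨ weighted-cong (λ B (hB , nB) → HermitianForm.Q*zeros (matrixForm B hB) nB) ⟩
      weighted (λ B → σ ℤ.* σ ℤ.+ (Q ℤ.- 1ℤ) ℤ.* σ)
        ≡⟨ weighted-const _ ⟩
      regularCount ℤ.* (σ ℤ.* σ ℤ.+ (Q ℤ.- 1ℤ) ℤ.* σ) ∎
      where
      open ≡-Reasoning
      t₁ = isotropicFor (basis Fin.zero)
      rearrange : ∀ s t r → (s ℤ.- 1ℤ) ℤ.* t ℤ.+ r ≡ s ℤ.* t ℤ.+ (r ℤ.- t)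
      rearrange = let open ℤ-Solver in solve 3 (λ s t r → (s :- con 1ℤ) :* t :+ r := s :* t :+ (r :- t)) refl
      pointwise : ∀ v (d : Dec (v ≡ 0ᵛ)) → isotropicFor v ≡ t₁ ℤ.+ 𝟙 d ℤ.* (regularCount ℤ.- t₁)
      pointwise v (no v≢0) = trans (isotropicFor-const v v≢0) (sym (ℤ.+-identityʳ t₁))
      pointwise v (yes v≡0) = trans
        (trans (weighted-cong (λ B (hB , _) → 𝟙-yes (bil B v v ≟ 0#)
          (trans (cong (λ u → bil B u v) v≡0) (HermitianForm.form-0ˡ (matrixForm B hB) v))))
        (trans (weighted-const 1ℤ) (ℤ.*-identityʳ regularCount)))
        (at-0 t₁ regularCount)
        where
        at-0 : ∀ t r → r ≡ t ℤ.+ 1ℤ ℤ.* (r ℤ.- t)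
        at-0 = let open ℤ-Solver in solve 2 (λ t r → r := t :+ con 1ℤ :* (r :- t)) refl
      ∑-isotropicFor : ∑ⱽ isotropicFor ≡ σ ℤ.* σ ℤ.* t₁ ℤ.+ (regularCount ℤ.- t₁)
      ∑-isotropicFor = trans (sum-cong vectors (λ v → pointwise v (v ≟ⱽ 0ᵛ)))
        (trans (sum-+ vectors (λ _ → t₁) _) (cong₂ ℤ._+_ (trans (sum-const vectors t₁) (cong (ℤ._* t₁) card-σ)) (∑ⱽ-δ 0ᵛ _)))

    -- 1 if w is not a multiple of v (for v ≢ 0ᵛ), and 0 otherwise.
    independent : Vector n → Vector n → ℤ
    independent v w = 1ℤ ℤ.- ∑ᴱ (λ a → 𝟙 (w ≟ⱽ a *ᵛ v))

    ∑-independent : ∀ v (f : Vector n → ℤ) → ∑ⱽ (λ w → independent v w ℤ.* f w) ≡ ∑ⱽ f ℤ.- ∑ᴱ (λ a → f (a *ᵛ v))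
    ∑-independent v f = begin
      ∑ⱽ (λ w → (1ℤ ℤ.- ∑ᴱ (λ a → 𝟙 (w ≟ⱽ a *ᵛ v))) ℤ.* f w)
        ≡⟨ sum-cong vectors (λ w → trans (distr (∑ᴱ (λ a → 𝟙 (w ≟ⱽ a *ᵛ v))) (f w)) (cong (λ z → f w ℤ.- z) (sym (sum-*ʳ list (f w) _)))) ⟩
      ∑ⱽ (λ w → f w ℤ.- ∑ᴱ (λ a → 𝟙 (w ≟ⱽ a *ᵛ v) ℤ.* f w))
        ≡⟨ sum-minus vectors f _ ⟩
      ∑ⱽ f ℤ.- ∑ⱽ (λ w → ∑ᴱ (λ a → 𝟙 (w ≟ⱽ a *ᵛ v) ℤ.* f w))
        ≡⟨ cong (λ z → ∑ⱽ f ℤ.- z) (trans (sum-swap vectors list _) (sum-cong list (λ a → ∑ⱽ-δ (a *ᵛ v) f))) ⟩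
      ∑ⱽ f ℤ.- ∑ᴱ (λ a → f (a *ᵛ v)) ∎
      where
      open ≡-Reasoning
      distr : ∀ d x → (1ℤ ℤ.- d) ℤ.* x ≡ x ℤ.- d ℤ.* x
      distr = let open ℤ-Solver in solve 2 (λ d x → (con 1ℤ :- d) :* x := x :- d :* x) refl

    independent-multiple : ∀ v w a → v ≢ 0ᵛ → w ≡ a *ᵛ v → independent v w ≡ 0ℤ
    independent-multiple v w a v≢0 w≡av = trans (cong (λ z → 1ℤ ℤ.- z) (trans
      (sum-cong list (λ b → 𝟙-cong (w ≟ⱽ b *ᵛ v) (b ≟ a) (λ e → cancel b (trans (sym e) w≡av)) (λ e → trans w≡av (cong (_*ᵛ v) (sym e)))))
      (count a))) refl
      where
      cancel : ∀ b → b *ᵛ v ≡ a *ᵛ v → b ≡ a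
      cancel b e = x-y≡0⇒x≡y (*-zero-product (λ p → v≢0 (pivotᵛ≡0 v p)) (begin
        pivotᵛ v * (b + - a)
          ≡⟨ solve 3 (λ p a b → p :* (b :+ :- a) := b :* p :+ :- (a :* p)) refl (pivotᵛ v) a b ⟩
        b * pivotᵛ v + - (a * pivotᵛ v) ≡⟨ cong₂ (λ x y → x + - y) (pivotᵛ-* b v) (pivotᵛ-* a v) ⟨
        pivotᵛ (b *ᵛ v) + - pivotᵛ (a *ᵛ v) ≡⟨ x≡y⇒x-y≡0 (cong pivotᵛ e) ⟩
        0# ∎))
        where
        open ≡-Reasoning
        open Solver using (solve; _:+_; _:*_; :-_; _:=_)

    module RankTwo (M : HermitianMatrix₂) where
      open HermitianMatrix₂ M using (combination)

      value : SquareMatrix n → Vector n → Vector n → Carrier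
      value B v w = combination (bil B v v) (bil B v w) (bil B w v) (bil B w w)

      isotropicForPair : Vector n → Vector n → ℤ
      isotropicForPair v w = weighted (λ B → 𝟙 (value B v w ≟ 0#))

      private
        ε₀ ε₁ : Vector n
        ε₀ = basis Fin.zero
        ε₁ = basis (Fin.suc Fin.zero)
        t₂ : ℤ
        t₂ = isotropicForPair ε₀ ε₁

      value-congruence : ∀ e B → value (congruence e B) ε₀ ε₁ ≡ value B (LinearBijection.to e ε₀) (LinearBijection.to e ε₁)
      value-congruence e B = trans
          (cong₂ (λ x y → combination x y (bil (congruence e B) ε₁ ε₀) (bil (congruence e B) ε₁ ε₁))
            (bil-congruence e B ε₀ ε₀) (bil-congruence e B ε₀ ε₁))
          (cong₂ (combination (bil B (to e ε₀) (to e ε₀)) (bil B (to e ε₀) (to e ε₁)))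
            (bil-congruence e B ε₁ ε₀) (bil-congruence e B ε₁ ε₁))
        where open LinearBijection using (to)

      isotropicForPair-const : ∀ v w → v ≢ 0ᵛ → (∀ a → w ≢ a *ᵛ v) → isotropicForPair v w ≡ t₂
      isotropicForPair-const v w v≢0 w≢av = go (independent-transitive v w v≢0 w≢av)
        where
        open ≡-Reasoning
        go : Σ (LinearBijection n) (λ e → LinearBijection.to e ε₀ ≡ v × LinearBijection.to e ε₁ ≡ w) → isotropicForPair v w ≡ t₂
        go (e , e≡v , e≡w) = begin
          weighted (λ B → 𝟙 (value B v w ≟ 0#))
            ≡⟨ sum-cong matrices (λ B → cong (λ z → weight B ℤ.* 𝟙 (z ≟ 0#))
                 (sym (trans (value-congruence e B) (cong₂ (value B) e≡v e≡w)))) ⟩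
          weighted (λ B → 𝟙 (value (congruence e B) ε₀ ε₁ ≟ 0#))
            ≡⟨ weighted-congruence e (λ B → 𝟙 (value B ε₀ ε₁ ≟ 0#)) ⟩
          t₂ ∎

      private
        nonzero : Vector n → ℤ
        nonzero v = 1ℤ ℤ.- 𝟙 (v ≟ⱽ 0ᵛ)

        nonzero*independent : ∀ v (d : Dec (v ≡ 0ᵛ)) w →
          (1ℤ ℤ.- 𝟙 d) ℤ.* (independent v w ℤ.* isotropicForPair v w) ≡ (1ℤ ℤ.- 𝟙 d) ℤ.* (independent v w ℤ.* t₂)
        nonzero*independent v (yes _) w = refl
        nonzero*independent v (no v≢0) w = cong (1ℤ ℤ.*_) (go (search (λ a → ¬? (w ≟ⱽ a *ᵛ v))))
          where
          go : (∀ a → w ≢ a *ᵛ v) ⊎ (∃ λ a → ¬ (w ≢ a *ᵛ v)) → independent v w ℤ.* isotropicForPair v w ≡ independent v w ℤ.* t₂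
          go (inj₁ w≢av) = cong (independent v w ℤ.*_) (isotropicForPair-const v w v≢0 w≢av)
          go (inj₂ (a , ¬¬e)) = let i≡0 = independent-multiple v w a v≢0 (decidable-stable (w ≟ⱽ a *ᵛ v) ¬¬e) in
            trans (cong (ℤ._* isotropicForPair v w) i≡0) (sym (cong (ℤ._* t₂) i≡0))

        line : SquareMatrix n → Vector n → ℤ
        line B v = ∑ⱽ (λ w → 𝟙 (value B v w ≟ 0#)) ℤ.- ∑ᴱ (λ a → 𝟙 (value B v (a *ᵛ v) ≟ 0#))

        -- There are σ² - 1 nonzero v and, for each, σ² - q² vectors off its line, all giving the
        -- same count by transitivity.
        ∑-independentPairs : (σ ℤ.* σ ℤ.- Q ℤ.* Q) ℤ.* (σ ℤ.* σ ℤ.- 1ℤ) ℤ.* t₂ ≡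
          weighted (λ B → ∑ⱽ (λ v → nonzero v ℤ.* line B v))
        ∑-independentPairs = begin
          (σ ℤ.* σ ℤ.- Q ℤ.* Q) ℤ.* (σ ℤ.* σ ℤ.- 1ℤ) ℤ.* t₂
            ≡⟨ rearrange (σ ℤ.* σ) (Q ℤ.* Q) t₂ ⟩
          (σ ℤ.* σ ℤ.- 1ℤ) ℤ.* (σ ℤ.* σ ℤ.* t₂ ℤ.- Q ℤ.* Q ℤ.* t₂)
            ≡⟨ trans (sum-*ʳ vectors _ nonzero) (cong (ℤ._* (σ ℤ.* σ ℤ.* t₂ ℤ.- Q ℤ.* Q ℤ.* t₂))
                 (trans (sum-minus vectors (λ _ → 1ℤ) _) (cong₂ ℤ._-_ card-σ (Space.countⱽ (coordinateSpace n) 0ᵛ)))) ⟨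
          ∑ⱽ (λ v → nonzero v ℤ.* (σ ℤ.* σ ℤ.* t₂ ℤ.- Q ℤ.* Q ℤ.* t₂))
            ≡⟨ sum-cong vectors (λ v → cong (nonzero v ℤ.*_) (trans (∑-independent v (λ _ → t₂))
                 (cong₂ ℤ._-_ (trans (sum-const vectors t₂) (cong (ℤ._* t₂) card-σ)) (trans (sum-const list t₂) (cong (ℤ._* t₂) card-F))))) ⟨
          ∑ⱽ (λ v → nonzero v ℤ.* ∑ⱽ (λ w → independent v w ℤ.* t₂))
            ≡⟨ sum-cong vectors (λ v → trans (sym (sum-*ˡ vectors (nonzero v) _))
                 (trans (sum-cong vectors (λ w → sym (nonzero*independent v (v ≟ⱽ 0ᵛ) w))) (sum-*ˡ vectors (nonzero v) _))) ⟩
          ∑ⱽ (λ v → nonzero v ℤ.* ∑ⱽ (λ w → independent v w ℤ.* isotropicForPair v w))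
            ≡⟨ sum-cong vectors (λ v → cong (nonzero v ℤ.*_) (trans (∑-independent v (isotropicForPair v))
                 (trans (cong₂ ℤ._-_ (weighted-∑ vectors _) (weighted-∑ list _)) (sym (weighted-minus _ _))))) ⟩
          ∑ⱽ (λ v → nonzero v ℤ.* weighted (λ B → line B v))
            ≡⟨ sum-cong vectors (λ v → sym (weighted-*ˡ (nonzero v) (λ B → line B v))) ⟩
          ∑ⱽ (λ v → weighted (λ B → nonzero v ℤ.* line B v))
            ≡⟨ weighted-∑ vectors _ ⟩
          weighted (λ B → ∑ⱽ (λ v → nonzero v ℤ.* line B v)) ∎
          where
          open ≡-Reasoning
          rearrange : ∀ s k t → (s ℤ.- k) ℤ.* (s ℤ.- 1ℤ) ℤ.* t ≡ (s ℤ.- 1ℤ) ℤ.* (s ℤ.* t ℤ.- k ℤ.* t)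
          rearrange = let open ℤ-Solver in solve 3 (λ s k t → (s :- k) :* (s :- con 1ℤ) :* t := (s :- con 1ℤ) :* (s :* t :- k :* t)) refl

      -- Double counting of the triples (B, v, w). The right-hand side does not mention M, so all
      -- hermitian matrices of rank two have equally many annihilators.
      rankTwo-equation : ∀ v w → v ≢ 0ᵛ → (∀ a → w ≢ a *ᵛ v) →
        Q ℤ.* ((σ ℤ.* σ ℤ.- Q ℤ.* Q) ℤ.* (σ ℤ.* σ ℤ.- 1ℤ) ℤ.* isotropicForPair v w) ≡ regularCount ℤ.* independentPairsPoly σ
      rankTwo-equation v w v≢0 w≢av = begin
        Q ℤ.* ((σ ℤ.* σ ℤ.- Q ℤ.* Q) ℤ.* (σ ℤ.* σ ℤ.- 1ℤ) ℤ.* isotropicForPair v w)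
          ≡⟨ cong (λ t → Q ℤ.* ((σ ℤ.* σ ℤ.- Q ℤ.* Q) ℤ.* (σ ℤ.* σ ℤ.- 1ℤ) ℤ.* t)) (isotropicForPair-const v w v≢0 w≢av) ⟩
        Q ℤ.* ((σ ℤ.* σ ℤ.- Q ℤ.* Q) ℤ.* (σ ℤ.* σ ℤ.- 1ℤ) ℤ.* t₂)
          ≡⟨ cong (Q ℤ.*_) ∑-independentPairs ⟩
        Q ℤ.* weighted (λ B → ∑ⱽ (λ v → nonzero v ℤ.* line B v))
          ≡⟨ weighted-*ˡ Q _ ⟨
        weighted (λ B → Q ℤ.* ∑ⱽ (λ v → nonzero v ℤ.* line B v))
          ≡⟨ weighted-cong (λ B (hB , nB) → IndependentPairCount.Q*isotropicIndependentPairs M (matrixForm B hB) nB) ⟩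
        weighted (λ _ → independentPairsPoly σ)
          ≡⟨ weighted-const (independentPairsPoly σ) ⟩
        regularCount ℤ.* independentPairsPoly σ ∎
        where open ≡-Reasoning

-- Hermitian matrices of rank one and two as combinations of outer products.

module LowRank {c} (q : ℕ) (pp : IsPrimePower q) (F : Field c) (iso : Field.Carrier F ↔ Fin (q ℕ.^ 2)) where
  open import Data.Vec.Base using (lookup; tabulate)
  open import Data.Vec.Properties using (lookup-map; lookup-replicate; lookup∘tabulate)
  open Field F
  open RankCounts q pp F iso public
  open Matrices F

  module _ {n : ℕ} (X : Mat n) where

    minor : (k l i j : Fin n) → Carrier
    minor k l i j = X k i * X l j + - (X k j * X l i)

    -- A decidable form of rank at least two.
    NonzeroMinor : Set c
    NonzeroMinor = ∃ λ k → ∃ λ l → ∃ λ i → ∃ λ j → minor k l i j ≢ 0#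

    nonzeroMinor? : Dec NonzeroMinor
    nonzeroMinor? = Fin.any? λ k → Fin.any? λ l → Fin.any? λ i → Fin.any? λ j → ¬? (minor k l i j ≟ 0#)

    private
      pair : Fin n → Fin n → Fin 2 → Fin n
      pair i j Fin.zero = i
      pair i j (Fin.suc _) = j

      triple : Fin n → Fin n → Fin n → Fin 3 → Fin n
      triple i j l Fin.zero = i
      triple i j l (Fin.suc Fin.zero) = j
      triple i j l (Fin.suc (Fin.suc _)) = l

    cramer : ∀ k l i j → minor k l i j ≢ 0# → ∀ a b →
      a * X k i + b * X k j ≡ 0# → a * X l i + b * X l j ≡ 0# → a ≡ 0# × b ≡ 0#
    cramer k l i j Δ≢0 a b e₁ e₂ =
      *-zero-product Δ≢0 (trans
        (solve 6 (λ a b p q r s → (p :* s :+ :- (q :* r)) :* a := s :* (a :* p :+ b :* q) :+ :- (q :* (a :* r :+ b :* s))) refl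
          a b (X k i) (X k j) (X l i) (X l j))
        (trans (cong₂ (λ x y → X l j * x + - (X k j * y)) e₁ e₂) (solve 2 (λ s q → s :* con 0ℤ :+ :- (q :* con 0ℤ) := con 0ℤ) refl (X l j) (X k j)))) ,
      *-zero-product Δ≢0 (trans
        (solve 6 (λ a b p q r s → (p :* s :+ :- (q :* r)) :* b := p :* (a :* r :+ b :* s) :+ :- (r :* (a :* p :+ b :* q))) refl
          a b (X k i) (X k j) (X l i) (X l j))
        (trans (cong₂ (λ x y → X k i * x + - (X l i * y)) e₂ e₁) (solve 2 (λ s q → s :* con 0ℤ :+ :- (q :* con 0ℤ) := con 0ℤ) refl (X k i) (X l i))))
      where open Solver using (solve; _:+_; _:*_; :-_; _:=_; con)

    minor⇒independent : NonzeroMinor → Σ (Fin 2 → Fin n) λ f → ColumnsIndependent X f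
    minor⇒independent (k , l , i , j , Δ≢0) = pair i j , λ a e →
      let both = cramer k l i j Δ≢0 (a Fin.zero) (a (Fin.suc Fin.zero))
            (trans (cong (a Fin.zero * X k i +_) (sym (+-identityʳ _))) (e k))
            (trans (cong (a Fin.zero * X l i +_) (sym (+-identityʳ _))) (e l))
      in λ { Fin.zero → proj₁ both ; (Fin.suc Fin.zero) → proj₂ both }

    module MinorExpansion (k l i j : Fin n) (Δ≢0 : minor k l i j ≢ 0#) (rank≤2 : RankAtMost X 2) where
      Δ⁻¹ : Carrier
      Δ⁻¹ = proj₁ (inverse (minor k l i j) Δ≢0)

      ΔΔ⁻¹ : minor k l i j * Δ⁻¹ ≡ 1#
      ΔΔ⁻¹ = proj₂ (inverse (minor k l i j) Δ≢0)

      -- Cramer's rule in the rows k and l: the coefficients that express column t through the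
      -- columns i and j in those two rows.
      s₁ s₂ : Fin n → Carrier
      s₁ t = minor k l t j * Δ⁻¹
      s₂ t = minor k l i t * Δ⁻¹

      s₁i : s₁ i ≡ 1#
      s₁i = ΔΔ⁻¹

      s₂j : s₂ j ≡ 1#
      s₂j = ΔΔ⁻¹

      s₁j : s₁ j ≡ 0#
      s₁j = trans (cong (_* Δ⁻¹) (-‿inverseʳ _)) (zeroˡ _)

      open Solver using (solve; _:+_; _:*_; :-_; _:=_; con)

      residue : Fin n → Fin n → Carrier
      residue m t = X m t + - (s₁ t * X m i + s₂ t * X m j)

      residue-k : ∀ t → residue k t ≡ 0#
      residue-k t = trans (cong (_+ - (s₁ t * X k i + s₂ t * X k j)) (trans (sym (*-identityʳ _)) (cong (X k t *_) (sym ΔΔ⁻¹))))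
        (solve 7 (λ p q r s x y d → x :* ((p :* s :+ :- (q :* r)) :* d) :+
            :- ((x :* s :+ :- (q :* y)) :* d :* p :+ (p :* y :+ :- (x :* r)) :* d :* q) := con 0ℤ) refl
          (X k i) (X k j) (X l i) (X l j) (X k t) (X l t) Δ⁻¹)

      residue-l : ∀ t → residue l t ≡ 0#
      residue-l t = trans (cong (_+ - (s₁ t * X l i + s₂ t * X l j)) (trans (sym (*-identityʳ _)) (cong (X l t *_) (sym ΔΔ⁻¹))))
        (solve 7 (λ p q r s x y d → y :* ((p :* s :+ :- (q :* r)) :* d) :+
            :- ((x :* s :+ :- (q :* y)) :* d :* r :+ (p :* y :+ :- (x :* r)) :* d :* s) := con 0ℤ) refl
          (X k i) (X k j) (X l i) (X l j) (X k t) (X l t) Δ⁻¹)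

      -- A nonzero residue would make the columns i, j, t independent. In a vanishing combination
      -- the rows k and l determine the coefficients of i and j from that of t, and row m then
      -- forces the latter to be zero.
      residue≡0 : ∀ m t → residue m t ≡ 0#
      residue≡0 m t with residue m t ≟ 0#
      ... | yes e = e
      ... | no ne = contradiction independent (rank≤2 (triple i j t))
        where
        independent : ColumnsIndependent X (triple i j t)
        independent a e = λ { Fin.zero → zero₁ ; (Fin.suc Fin.zero) → zero₂ ; (Fin.suc (Fin.suc Fin.zero)) → a₂≡0 }
          where
          a₀ = a Fin.zero
          a₁ = a (Fin.suc Fin.zero)
          a₂ = a (Fin.suc (Fin.suc Fin.zero))
          expand : ∀ r → a₂ * residue r t + ((a₀ + a₂ * s₁ t) * X r i + (a₁ + a₂ * s₂ t) * X r j) ≡ 0#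
          expand r = trans (solve 8 (λ a b d s u x y z →
              d :* (z :+ :- (s :* x :+ u :* y)) :+ ((a :+ d :* s) :* x :+ (b :+ d :* u) :* y) := a :* x :+ (b :* y :+ (d :* z :+ con 0ℤ))) refl
              a₀ a₁ a₂ (s₁ t) (s₂ t) (X r i) (X r j) (X r t)) (e r)
          reduced : ∀ r → residue r t ≡ 0# → (a₀ + a₂ * s₁ t) * X r i + (a₁ + a₂ * s₂ t) * X r j ≡ 0#
          reduced r e′ = trans (sym (trans (cong (_+ ((a₀ + a₂ * s₁ t) * X r i + (a₁ + a₂ * s₂ t) * X r j)) (trans (cong (a₂ *_) e′) (zeroʳ a₂))) (+-identityˡ _))) (expand r)
          both = cramer k l i j Δ≢0 (a₀ + a₂ * s₁ t) (a₁ + a₂ * s₂ t) (reduced k (residue-k t)) (reduced l (residue-l t))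
          a₂≡0 : a₂ ≡ 0#
          a₂≡0 = *-zero-product ne (begin
            residue m t * a₂
              ≡⟨ solve 4 (λ r d x y → r :* d := d :* r :+ (con 0ℤ :* x :+ con 0ℤ :* y)) refl (residue m t) a₂ (X m i) (X m j) ⟩
            a₂ * residue m t + (0# * X m i + 0# * X m j)
              ≡⟨ cong₂ (λ u v → a₂ * residue m t + (u * X m i + v * X m j)) (sym (proj₁ both)) (sym (proj₂ both)) ⟩
            a₂ * residue m t + ((a₀ + a₂ * s₁ t) * X m i + (a₁ + a₂ * s₂ t) * X m j)
              ≡⟨ expand m ⟩
            0# ∎)
            where open ≡-Reasoning
          drop : ∀ b s → b + a₂ * s ≡ 0# → b ≡ 0#
          drop b s e = trans (sym (trans (cong (λ z → b + z * s) a₂≡0) (trans (cong (b +_) (zeroˡ s)) (+-identityʳ b)))) e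
          zero₁ = drop a₀ (s₁ t) (proj₁ both)
          zero₂ = drop a₁ (s₂ t) (proj₂ both)

      columns : ∀ m t → X m t ≡ s₁ t * X m i + s₂ t * X m j
      columns m t = x-y≡0⇒x≡y (residue≡0 m t)

    module HermitianExpansion (hermitian : ∀ i j → conj (X i j) ≡ X j i) where
      open ≡-Reasoning

      module RankTwoExpansion (k l i j : Fin n) (Δ≢0 : minor k l i j ≢ 0#) (rank≤2 : RankAtMost X 2) where
        open MinorExpansion k l i j Δ≢0 rank≤2 public
        open Solver using (solve; _:+_; _:*_; :-_; _:=_; con)

        rows : ∀ m a → X m a ≡ conj (s₁ m) * X i a + conj (s₂ m) * X j a
        rows m a = begin
          X m a ≡⟨ hermitian a m ⟨
          conj (X a m) ≡⟨ cong conj (columns a m) ⟩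
          conj (s₁ m * X a i + s₂ m * X a j) ≡⟨ trans (conj-+ _ _) (cong₂ _+_ (conj-* _ _) (conj-* _ _)) ⟩
          conj (s₁ m) * conj (X a i) + conj (s₂ m) * conj (X a j)
            ≡⟨ cong₂ (λ x y → conj (s₁ m) * x + conj (s₂ m) * y) (hermitian a i) (hermitian a j) ⟩
          conj (s₁ m) * X i a + conj (s₂ m) * X j a ∎

        -- Applying the column expansion and its conjugate transpose leaves the principal submatrix
        -- on i and j as the core. It is hermitian by itself, so no diagonalisation is involved.
        expansion : ∀ m t → X m t ≡
          X i i * (conj (s₁ m) * s₁ t) + X i j * (conj (s₁ m) * s₂ t) + (X j i * (conj (s₂ m) * s₁ t) + X j j * (conj (s₂ m) * s₂ t))
        expansion m t = begin
          X m t ≡⟨ columns m t ⟩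
          s₁ t * X m i + s₂ t * X m j ≡⟨ cong₂ (λ x y → s₁ t * x + s₂ t * y) (rows m i) (rows m j) ⟩
          s₁ t * (conj (s₁ m) * X i i + conj (s₂ m) * X j i) + s₂ t * (conj (s₁ m) * X i j + conj (s₂ m) * X j j)
            ≡⟨ solve 8 (λ s u c d p q r w → s :* (c :* p :+ d :* r) :+ u :* (c :* q :+ d :* w) :=
                 p :* (c :* s) :+ q :* (c :* u) :+ (r :* (d :* s) :+ w :* (d :* u))) refl
                 (s₁ t) (s₂ t) (conj (s₁ m)) (conj (s₂ m)) (X i i) (X i j) (X j i) (X j j) ⟩
          X i i * (conj (s₁ m) * s₁ t) + X i j * (conj (s₁ m) * s₂ t) + (X j i * (conj (s₂ m) * s₁ t) + X j j * (conj (s₂ m) * s₂ t)) ∎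

        -- By `rows` and multiplicativity of determinants, the chosen nonzero minor is a multiple of
        -- the principal one.
        principal≢0 : X i i * X j j + - (X i j * X j i) ≢ 0#
        principal≢0 e = Δ≢0 (begin
          X k i * X l j + - (X k j * X l i)
            ≡⟨ cong₂ (λ x y → x + - y) (cong₂ _*_ (rows k i) (rows l j)) (cong₂ _*_ (rows k j) (rows l i)) ⟩
          (conj (s₁ k) * X i i + conj (s₂ k) * X j i) * (conj (s₁ l) * X i j + conj (s₂ l) * X j j) +
            - ((conj (s₁ k) * X i j + conj (s₂ k) * X j j) * (conj (s₁ l) * X i i + conj (s₂ l) * X j i))
            ≡⟨ solve 8 (λ a b c d p q r w → (a :* p :+ b :* r) :* (c :* q :+ d :* w) :+ :- ((a :* q :+ b :* w) :* (c :* p :+ d :* r)) :=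
                 (a :* d :+ :- (b :* c)) :* (p :* w :+ :- (q :* r))) refl
                 (conj (s₁ k)) (conj (s₂ k)) (conj (s₁ l)) (conj (s₂ l)) (X i i) (X i j) (X j i) (X j j) ⟩
          (conj (s₁ k) * conj (s₂ l) + - (conj (s₂ k) * conj (s₁ l))) * (X i i * X j j + - (X i j * X j i))
            ≡⟨ trans (cong ((conj (s₁ k) * conj (s₂ l) + - (conj (s₂ k) * conj (s₁ l))) *_) e) (zeroʳ _) ⟩
          0# ∎)

        principalMatrix : HermitianMatrix₂
        principalMatrix = record
          { m₁₁ = X i i ; m₁₂ = X i j ; m₂₁ = X j i ; m₂₂ = X j j
          ; m₁₁-fixed = hermitian i i ; m₂₂-fixed = hermitian j j ; conj-m₁₂ = hermitian i j ; det≢0 = principal≢0 }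

        v₁ v₂ : Vector n
        v₁ = tabulate s₁
        v₂ = tabulate s₂

        v₁≢0 : v₁ ≢ 0ᵛ
        v₁≢0 e = 0≢1 (begin
          0# ≡⟨ lookup-replicate i 0# ⟨
          lookup 0ᵛ i ≡⟨ cong (λ v → lookup v i) e ⟨
          lookup v₁ i ≡⟨ trans (lookup∘tabulate s₁ i) s₁i ⟩
          1# ∎)

        v₂≢av₁ : ∀ a → v₂ ≢ a *ᵛ v₁
        v₂≢av₁ a e = 0≢1 (sym (begin
          1# ≡⟨ trans (lookup∘tabulate s₂ j) s₂j ⟨
          lookup v₂ j ≡⟨ cong (λ v → lookup v j) e ⟩
          lookup (a *ᵛ v₁) j ≡⟨ trans (lookup-map j (a *_) v₁) (cong (a *_) (trans (lookup∘tabulate s₁ j) s₁j)) ⟩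
          a * 0# ≡⟨ zeroʳ a ⟩
          0# ∎))

      module RankOneExpansion (noMinor : ¬ NonzeroMinor) (k i : Fin n) (Xki≢0 : X k i ≢ 0#) where
        open Solver using (solve; _:+_; _:*_; :-_; _:=_; con)

        minor≡0 : ∀ k l i j → X k i * X l j ≡ X k j * X l i
        minor≡0 k l i j = x-y≡0⇒x≡y (decidable-stable (minor k l i j ≟ 0#) λ ne → noMinor (k , l , i , j , ne))

        s : Fin n → Carrier
        s t = X k t * proj₁ (inverse (X k i) Xki≢0)

        columns : ∀ m t → X m t ≡ X m i * s t
        columns m t = begin
          X m t ≡⟨ trans (sym (*-identityˡ _)) (cong (_* X m t) (sym (proj₂ (inverse (X k i) Xki≢0)))) ⟩
          X k i * y * X m t ≡⟨ solve 3 (λ x y z → x :* y :* z := (x :* z) :* y) refl (X k i) y (X m t) ⟩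
          X k i * X m t * y ≡⟨ cong (_* y) (minor≡0 k m i t) ⟩
          X k t * X m i * y ≡⟨ solve 3 (λ x y z → x :* z :* y := z :* (x :* y)) refl (X k t) y (X m i) ⟩
          X m i * s t ∎
          where y = proj₁ (inverse (X k i) Xki≢0)

        expansion : ∀ m t → X m t ≡ X i i * (conj (s m) * s t)
        expansion m t = begin
          X m t ≡⟨ columns m t ⟩
          X m i * s t ≡⟨ cong (_* s t) (hermitian i m) ⟨
          conj (X i m) * s t ≡⟨ cong (λ x → conj x * s t) (columns i m) ⟩
          conj (X i i * s m) * s t ≡⟨ cong (_* s t) (trans (conj-* _ _) (cong (_* conj (s m)) (hermitian i i))) ⟩
          X i i * conj (s m) * s t ≡⟨ *-assoc _ _ _ ⟩
          X i i * (conj (s m) * s t) ∎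

        -- Makes annihilating X equivalent to isotropy of v, since X is this scalar times an outer
        -- product of v with itself.
        Xii≢0 : X i i ≢ 0#
        Xii≢0 e = Xki≢0 (trans (expansion k i) (trans (cong (_* (conj (s k) * s i)) e) (zeroˡ _)))

        v : Vector n
        v = tabulate s

        v≢0 : v ≢ 0ᵛ
        v≢0 e = 0≢1 (begin
          0# ≡⟨ lookup-replicate i 0# ⟨
          lookup 0ᵛ i ≡⟨ cong (λ v → lookup v i) e ⟨
          lookup v i ≡⟨ trans (lookup∘tabulate s i) (proj₂ (inverse (X k i) Xki≢0)) ⟩
          1# ∎)

  outer : ∀ {n} → Vector n → Vector n → Fin n → Fin n → Carrier
  outer u v k l = conj (lookup u k) * lookup v l

  pairing-combination : ∀ {n} (B : SquareMatrix n) (M : HermitianMatrix₂) u v {X} → let open HermitianMatrix₂ M in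
    (∀ k l → X k l ≡ combination (outer u u k l) (outer u v k l) (outer v u k l) (outer v v k l)) →
    pairing B X ≡ combination (bil B u u) (bil B u v) (bil B v u) (bil B v v)
  pairing-combination B M u v e = trans (pairing-cong B e)
    (trans (pairing-+ B (λ k l → m₁₁ * outer u u k l + m₁₂ * outer u v k l) (λ k l → m₂₁ * outer v u k l + m₂₂ * outer v v k l)) (cong₂ _+_
      (trans (pairing-+ B (λ k l → m₁₁ * outer u u k l) (λ k l → m₁₂ * outer u v k l)) (cong₂ _+_ (part m₁₁ u u) (part m₁₂ u v)))
      (trans (pairing-+ B (λ k l → m₂₁ * outer v u k l) (λ k l → m₂₂ * outer v v k l)) (cong₂ _+_ (part m₂₁ v u) (part m₂₂ v v)))))
    where
    open HermitianMatrix₂ M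
    part : ∀ x u v → pairing B (λ k l → x * outer u v k l) ≡ x * bil B u v
    part x u v = trans (pairing-* B x (outer u v)) (cong (x *_) (pairing-outer B u v))

  module Annihilators (n₂ : ℕ) where
    open Counts n₂

    annihilators-rankTwo : ∀ (X : Mat n) → (∀ i j → conj (X i j) ≡ X j i) → RankAtMost X 2 → NonzeroMinor X →
      Q ℤ.* ((gaussSum n ℤ.* gaussSum n ℤ.- Q ℤ.* Q) ℤ.* (gaussSum n ℤ.* gaussSum n ℤ.- 1ℤ) ℤ.* annihilators X) ≡
        regularCount ℤ.* independentPairsPoly (gaussSum n)
    annihilators-rankTwo X hX rank≤2 (k , l , i , j , Δ≢0) =
      trans (cong (λ z → Q ℤ.* ((gaussSum n ℤ.* gaussSum n ℤ.- Q ℤ.* Q) ℤ.* (gaussSum n ℤ.* gaussSum n ℤ.- 1ℤ) ℤ.* z))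
        (weighted-cong (λ B _ → cong (λ z → 𝟙 (z ≟ 0#)) (pairing-combination B principalMatrix v₁ v₂ (λ m t → trans (expansion m t) (tabulated m t))))))
        (RankTwo.rankTwo-equation principalMatrix v₁ v₂ v₁≢0 v₂≢av₁)
      where
      open HermitianExpansion X hX
      open RankTwoExpansion k l i j Δ≢0 rank≤2
      tabulated : ∀ m t → HermitianMatrix₂.combination principalMatrix
          (conj (s₁ m) * s₁ t) (conj (s₁ m) * s₂ t) (conj (s₂ m) * s₁ t) (conj (s₂ m) * s₂ t) ≡
        HermitianMatrix₂.combination principalMatrix
          (conj (lookup v₁ m) * lookup v₁ t) (conj (lookup v₁ m) * lookup v₂ t) (conj (lookup v₂ m) * lookup v₁ t) (conj (lookup v₂ m) * lookup v₂ t)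
      tabulated m t rewrite lookup∘tabulate s₁ m | lookup∘tabulate s₂ m | lookup∘tabulate s₁ t | lookup∘tabulate s₂ t = refl

    annihilators-rankOne : ∀ (X : Mat n) → (∀ i j → conj (X i j) ≡ X j i) → ¬ NonzeroMinor X → ∀ k i → X k i ≢ 0# →
      Q ℤ.* ((gaussSum n ℤ.* gaussSum n ℤ.- 1ℤ) ℤ.* annihilators X ℤ.+ regularCount) ≡
        regularCount ℤ.* (gaussSum n ℤ.* gaussSum n ℤ.+ (Q ℤ.- 1ℤ) ℤ.* gaussSum n)
    annihilators-rankOne X hX noMinor k i Xki≢0 =
      trans (cong (λ z → Q ℤ.* ((gaussSum n ℤ.* gaussSum n ℤ.- 1ℤ) ℤ.* z ℤ.+ regularCount))
        (weighted-cong (λ B _ → 𝟙-cong (pairing B X ≟ 0#) (bil B v v ≟ 0#)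
          (λ e → *-zero-product Xii≢0 (trans (sym (pairing≡ B)) e))
          (λ e → trans (pairing≡ B) (trans (cong (X i i *_) e) (zeroʳ _))))))
        (rankOne-equation v v≢0)
      where
      open HermitianExpansion X hX
      open RankOneExpansion noMinor k i Xki≢0
      pairing≡ : ∀ B → pairing B X ≡ X i i * bil B v v
      pairing≡ B = trans (pairing-cong B (λ m t → trans (expansion m t)
          (cong₂ (λ x y → X i i * (conj x * y)) (sym (lookup∘tabulate s m)) (sym (lookup∘tabulate s t)))))
        (trans (pairing-* B (X i i) (λ k l → conj (lookup v k) * lookup v l)) (cong (X i i *_) (pairing-outer B v v)))

-- The polynomial identities and signs behind the bound.

module BoundArithmetic (q μ : ℕ) (q>1 : 1 ℕ.< q) (μ>1 : 1 ℕ.< μ) where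
  open import Data.Integer.Base using (_+_; _*_; _-_; -_; _≤_; _<_)
  open ℤ-Solver

  Q m : ℤ
  Q = pos q
  m = pos μ

  -- Read off from the rank-two double count: `D s` times the number of annihilators is
  -- `regularCount` times `K s`, with `K` a copy of `independentPairsPoly`.
  D K : ℤ → ℤ
  D s = Q * ((s * s - Q * Q) * (s * s - 1ℤ))
  K s = (s * s) * (s * s) + (Q - 1ℤ) * (s * s) - (s * s + (Q - 1ℤ) * s)
    - (Q + 1ℤ) * (Q * (s * s) - (s * s + (Q - 1ℤ) * s))
    - ((s * s + (Q - 1ℤ) * s) - Q) * (Q * Q)

  -- All evaluated at s = -q m with m = q^(n-1): `W` is the defect D - qK, `R` the gap between ranks
  -- two and one, and `β` the bound.
  W R β : ℤ
  W = Q * Q * Q * (Q - 1ℤ) * (Q * m + 1ℤ) * (m - 1ℤ)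
  R = Q * Q * (Q * m + 1ℤ) * (m - 1ℤ) * (Q - 1ℤ) * m
  β = Q * (m * m) + Q * m - m

  -- As W is positive, matrices of rank two have fewer annihilators than the average 1/q; the
  -- Cauchy-Schwarz inequality can therefore hold only for small sets.
  D-QK : D (- Q * m) - Q * K (- Q * m) ≡ W
  D-QK = solve 2 (λ Q m → let s = :- Q :* m in
    Q :* ((s :* s :- Q :* Q) :* (s :* s :- con 1ℤ)) :- Q :* ((s :* s) :* (s :* s) :+ (Q :- con 1ℤ) :* (s :* s) :- (s :* s :+ (Q :- con 1ℤ) :* s)
      :- (Q :+ con 1ℤ) :* (Q :* (s :* s) :- (s :* s :+ (Q :- con 1ℤ) :* s))
      :- ((s :* s :+ (Q :- con 1ℤ) :* s) :- Q) :* (Q :* Q)) :=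
    Q :* Q :* Q :* (Q :- con 1ℤ) :* (Q :* m :+ con 1ℤ) :* (m :- con 1ℤ)) refl Q m

  -- The same factor W splits off, and the quotient is the bound.
  Q[D-K] : Q * (D (- Q * m) - K (- Q * m)) ≡ W * β
  Q[D-K] = solve 2 (λ Q m → let s = :- Q :* m in
    Q :* (Q :* ((s :* s :- Q :* Q) :* (s :* s :- con 1ℤ)) :- ((s :* s) :* (s :* s) :+ (Q :- con 1ℤ) :* (s :* s) :- (s :* s :+ (Q :- con 1ℤ) :* s)
      :- (Q :+ con 1ℤ) :* (Q :* (s :* s) :- (s :* s :+ (Q :- con 1ℤ) :* s))
      :- ((s :* s :+ (Q :- con 1ℤ) :* s) :- Q) :* (Q :* Q))) :=
    Q :* Q :* Q :* (Q :- con 1ℤ) :* (Q :* m :+ con 1ℤ) :* (m :- con 1ℤ) :* (Q :* (m :* m) :+ Q :* m :- m)) refl Q m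

  -- `R` carries the odd factor m, so its positivity depends on m > 0, which is the case of odd
  -- dimension.
  K-rankOne : let s = - Q * m in K s - (s * s - Q * Q) * (s * s + (Q - 1ℤ) * s - Q) ≡ R
  K-rankOne = solve 2 (λ Q m → let s = :- Q :* m in
    ((s :* s) :* (s :* s) :+ (Q :- con 1ℤ) :* (s :* s) :- (s :* s :+ (Q :- con 1ℤ) :* s)
      :- (Q :+ con 1ℤ) :* (Q :* (s :* s) :- (s :* s :+ (Q :- con 1ℤ) :* s))
      :- ((s :* s :+ (Q :- con 1ℤ) :* s) :- Q) :* (Q :* Q)) :- (s :* s :- Q :* Q) :* (s :* s :+ (Q :- con 1ℤ) :* s :- Q) :=
    Q :* Q :* (Q :* m :+ con 1ℤ) :* (m :- con 1ℤ) :* (Q :- con 1ℤ) :* m) refl Q m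

  D-factor : D (- Q * m) ≡ Q * (Q * Q * (m - 1ℤ) * (m + 1ℤ)) * ((Q * m - 1ℤ) * (Q * m + 1ℤ))
  D-factor = solve 2 (λ Q m → let s = :- Q :* m in
    Q :* ((s :* s :- Q :* Q) :* (s :* s :- con 1ℤ)) :=
    Q :* (Q :* Q :* (m :- con 1ℤ) :* (m :+ con 1ℤ)) :* ((Q :* m :- con 1ℤ) :* (Q :* m :+ con 1ℤ))) refl Q m

  pos>0 : ∀ {k} → 1 ℕ.< k → 0ℤ < pos k
  pos>0 1<k = ℤ.+<+ (ℕ.<-trans (ℕ.s≤s ℕ.z≤n) 1<k)

  pos-1>0 : ∀ {k} → 1 ℕ.< k → 0ℤ < pos k - 1ℤ
  pos-1>0 {k} 1<k = ℤ.+-monoˡ-< (- 1ℤ) {1ℤ} {pos k} (ℤ.+<+ 1<k)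

  +1>0 : ∀ {i} → 0ℤ < i → 0ℤ < i + 1ℤ
  +1>0 {i} 0<i = ℤ.+-mono-< {0ℤ} {i} {0ℤ} {1ℤ} 0<i (ℤ.+<+ (ℕ.s≤s ℕ.z≤n))

  Q>0 : 0ℤ < Q
  Q>0 = pos>0 q>1

  m>0 : 0ℤ < m
  m>0 = pos>0 μ>1

  Qm>0 : 0ℤ < Q * m
  Qm>0 = *->0 Q>0 m>0

  Qm-1>0 : 0ℤ < Q * m - 1ℤ
  Qm-1>0 = subst (λ z → 0ℤ < z - 1ℤ) (ℤ.pos-* q μ) (pos-1>0 (ℕ.*-mono-< q>1 μ>1))

  W>0 : 0ℤ < W
  W>0 = *->0 (*->0 (*->0 (*->0 (*->0 Q>0 Q>0) Q>0) (pos-1>0 q>1)) (+1>0 Qm>0)) (pos-1>0 μ>1)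

  R>0 : 0ℤ < R
  R>0 = *->0 (*->0 (*->0 (*->0 (*->0 Q>0 Q>0) (+1>0 Qm>0)) (pos-1>0 μ>1)) (pos-1>0 q>1)) m>0

  D>0 : 0ℤ < D (- Q * m)
  D>0 = subst (0ℤ <_) (sym D-factor)
    (*->0 (*->0 Q>0 (*->0 (*->0 (*->0 Q>0 Q>0) (pos-1>0 μ>1)) (+1>0 m>0))) (*->0 Qm-1>0 (+1>0 Qm>0)))

  rankTwo-slack : ∀ V c {s} → s ≡ - Q * m → Q * ((s * s - Q * Q) * (s * s - 1ℤ) * c) ≡ V * K s → V * K s - D s * c ≡ 0ℤ
  rankTwo-slack V c {s} refl e = ℤ.i≡j⇒i-j≡0 (trans (sym e)
    (solve 3 (λ Q d c → Q :* (d :* c) := Q :* d :* c) refl Q ((s * s - Q * Q) * (s * s - 1ℤ)) c))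

  -- The rank-one equation multiplied by `s * s - Q * Q` acquires the factor `D s` of rank two, so
  -- the two counts compare without division.
  rankOne-slack : ∀ V c {s} → s ≡ - Q * m → Q * ((s * s - 1ℤ) * c + V) ≡ V * (s * s + (Q - 1ℤ) * s) → V * K s - D s * c ≡ V * R
  rankOne-slack V c {s} refl e = begin
    V * K s - D s * c
      ≡⟨ solve 6 (λ V K Q t c r → V :* K :- (Q :* ((t :- Q :* Q) :* (t :- con 1ℤ))) :* c :=
           V :* (K :- (t :- Q :* Q) :* (r :- Q)) :- (t :- Q :* Q) :* (Q :* ((t :- con 1ℤ) :* c :+ V) :- V :* r)) refl
           V (K s) Q (s * s) c (s * s + (Q - 1ℤ) * s) ⟩
    V * (K s - (s * s - Q * Q) * ((s * s + (Q - 1ℤ) * s) - Q)) - (s * s - Q * Q) * (Q * ((s * s - 1ℤ) * c + V) - V * (s * s + (Q - 1ℤ) * s))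
      ≡⟨ cong₂ (λ x y → V * x - (s * s - Q * Q) * y) K-rankOne (ℤ.i≡j⇒i-j≡0 e) ⟩
    V * R - (s * s - Q * Q) * 0ℤ
      ≡⟨ solve 2 (λ x y → x :- y :* con 0ℤ := x) refl (V * R) (s * s - Q * Q) ⟩
    V * R ∎
    where open ≡-Reasoning

  -- The u diagonal pairs and the u² - u others at their rank-two value, set against the
  -- Cauchy-Schwarz lower bound: both sides carry u, V and W, and what remains is β - u.
  total-slack : ∀ V u {s} → s ≡ - Q * m →
    Q * (u * (D s * V) + (u * u - u) * (V * K s)) - D s * (V * (u * u)) ≡ u * V * W * (β - u)
  total-slack V u {s} refl = begin
    Q * (u * (D s * V) + (u * u - u) * (V * K s)) - D s * (V * (u * u))
      ≡⟨ solve 5 (λ Q u V D K → Q :* (u :* (D :* V) :+ (u :* u :- u) :* (V :* K)) :- D :* (V :* (u :* u)) :=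
           u :* V :* (Q :* (D :- K) :- u :* (D :- Q :* K))) refl Q u V (D s) (K s) ⟩
    u * V * (Q * (D s - K s) - u * (D s - Q * K s))
      ≡⟨ cong₂ (λ x y → u * V * (x - u * y)) Q[D-K] D-QK ⟩
    u * V * (W * β - u * W)
      ≡⟨ solve 4 (λ u V W β → u :* V :* (W :* β :- u :* W) := u :* V :* W :* (β :- u)) refl u V W β ⟩
    u * V * W * (β - u) ∎
    where open ≡-Reasoning

  slack⇒bound : ∀ w t x → 0ℤ < w → 0ℤ ≤ t → Q * t ≤ w * (β - x) → x ≤ β
  slack⇒bound w t x w>0 t≥0 le = ℤ.0≤i-j⇒j≤i (ℤ.*-cancelˡ-≤-pos 0ℤ (β - x) w {{ℤ.positive w>0}}
    (subst (_≤ w * (β - x)) (sym (ℤ.*-zeroʳ w)) (ℤ.≤-trans (*-≥0 (ℤ.<⇒≤ Q>0) t≥0) le)))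

  extremal⇒slack≤0 : ∀ w t x → x ≡ β → Q * t ≤ w * (β - x) → t ≤ 0ℤ
  extremal⇒slack≤0 w t x x≡β le = ℤ.*-cancelˡ-≤-pos t 0ℤ Q {{ℤ.positive Q>0}} (ℤ.≤-trans le (ℤ.≤-reflexive
    (trans (cong (w *_) (ℤ.i≡j⇒i-j≡0 (sym x≡β))) (trans (ℤ.*-zeroʳ w) (sym (ℤ.*-zeroʳ Q))))))

-- The bound for a set of hermitian matrices and its equality case.

module CodeBound {c} (q : ℕ) (pp : IsPrimePower q) (F : Field c) (iso : Field.Carrier F ↔ Fin (q ℕ.^ 2)) where
  open Field F
  open LowRank q pp F iso public
  open Matrices F

  -- Applied to n - 1, it makes the Gauss sum in odd dimension n equal to -q · q^(n-1), the sign
  -- under which `R` is positive.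
  gaussSum-even : ∀ k → gaussSum (2 ℕ.* k) ≡ pos (q ℕ.^ (2 ℕ.* k))
  gaussSum-even zero = refl
  gaussSum-even (suc k) = begin
    gaussSum (2 ℕ.* suc k) ≡⟨ cong gaussSum (ℕ.*-suc 2 k) ⟩
    ℤ.- Q ℤ.* (ℤ.- Q ℤ.* gaussSum (2 ℕ.* k)) ≡⟨ cong (λ z → ℤ.- Q ℤ.* (ℤ.- Q ℤ.* z)) (gaussSum-even k) ⟩
    ℤ.- Q ℤ.* (ℤ.- Q ℤ.* pos p) ≡⟨ (let open ℤ-Solver in solve 2 (λ Q p → :- Q :* (:- Q :* p) := Q :* (Q :* p)) refl Q (pos p)) ⟩
    Q ℤ.* (Q ℤ.* pos p) ≡⟨ cong (Q ℤ.*_) (ℤ.pos-* q p) ⟨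
    Q ℤ.* pos (q ℕ.* p) ≡⟨ ℤ.pos-* q (q ℕ.* p) ⟨
    pos (q ℕ.^ suc (suc (2 ℕ.* k))) ≡⟨ cong (λ n → pos (q ℕ.^ n)) (ℕ.*-suc 2 k) ⟨
    pos (q ℕ.^ (2 ℕ.* suc k)) ∎
    where
    open ≡-Reasoning
    p = q ℕ.^ (2 ℕ.* k)

  _≋?_ : ∀ {n} (A B : Mat n) → Dec (A ≋ B)
  A ≋? B = Fin.all? (λ i → Fin.all? (λ j → A i j ≟ B i j))

  -- The diagonal is identified by entrywise equality, the relation in which the members of U are
  -- pairwise distinct.
  ≋-occurrences : ∀ {n} (U : List (Mat n)) → AllPairs (λ A B → ¬ (A ≋ B)) U →
    sumOver U (λ A → sumOver U (λ B → 𝟙 (A ≋? B))) ≡ sumOver U (λ _ → 1ℤ)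
  ≋-occurrences [] [] = refl
  ≋-occurrences (A ∷ U) (A≠ ∷ U≠) = begin
    (𝟙 (A ≋? A) ℤ.+ sumOver U (λ B → 𝟙 (A ≋? B))) ℤ.+ sumOver U (λ B → 𝟙 (B ≋? A) ℤ.+ sumOver U (λ C → 𝟙 (B ≋? C)))
      ≡⟨ cong₂ ℤ._+_ (cong₂ ℤ._+_ (𝟙-yes (A ≋? A) (λ _ _ → refl))
             (trans (sum-cong-∈ U (λ {B} B∈ → 𝟙-no (A ≋? B) (All.lookup A≠ B∈))) (sum-zero U)))
           (trans (sum-cong-∈ U (λ {B} B∈ → cong (ℤ._+ sumOver U (λ C → 𝟙 (B ≋? C)))
             (𝟙-no (B ≋? A) (λ e → All.lookup A≠ B∈ (λ i j → sym (e i j)))))) (trans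
             (sum-cong U (λ B → ℤ.+-identityˡ _)) (≋-occurrences U U≠))) ⟩
    (1ℤ ℤ.+ 0ℤ) ℤ.+ sumOver U (λ _ → 1ℤ) ∎
    where open ≡-Reasoning

  module Code (n₂ : ℕ) (odd : gaussSum (suc n₂) ≡ pos (q ℕ.^ suc n₂)) where
    open Counts n₂
    open Annihilators n₂

    μ : ℕ
    μ = q ℕ.^ suc n₂

    μ>1 : 1 ℕ.< μ
    μ>1 = ℕ.≤-trans q>1 (ℕ.m≤m*n q (q ℕ.^ n₂) {{ℕ.m^n≢0 q n₂}})

    open BoundArithmetic q μ q>1 μ>1 hiding (Q; Q>0)

    s : ℤ
    s = gaussSum n

    s≡ : s ≡ ℤ.- Q ℤ.* m
    s≡ = cong (ℤ.- Q ℤ.*_) odd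

    -- The value of D s * annihilators X for a hermitian X of rank two, or for X = 0.
    target : {P : Set c} → Dec P → ℤ
    target d = 𝟙 d ℤ.* (D s ℤ.* regularCount) ℤ.+ (1ℤ ℤ.- 𝟙 d) ℤ.* (regularCount ℤ.* K s)

    -- How far a difference falls below the rank-two value: zero on the diagonal and at rank two,
    -- `regularCount * R` at rank one.
    slack : {P : Set c} → Dec P → Mat n → ℤ
    slack d X = target d ℤ.- D s ℤ.* annihilators X

    private
      at-yes : ∀ a b → 1ℤ ℤ.* a ℤ.+ (1ℤ ℤ.- 1ℤ) ℤ.* b ≡ a
      at-yes = let open ℤ-Solver in solve 2 (λ a b → con 1ℤ :* a :+ (con 1ℤ :- con 1ℤ) :* b := a) refl

      at-no : ∀ a b → 0ℤ ℤ.* a ℤ.+ (1ℤ ℤ.- 0ℤ) ℤ.* b ≡ b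
      at-no = let open ℤ-Solver in solve 2 (λ a b → con 0ℤ :* a :+ (con 1ℤ :- con 0ℤ) :* b := b) refl

    slack-yes : ∀ {P : Set c} (d : Dec P) X → P → (∀ k l → X k l ≡ 0#) → slack d X ≡ 0ℤ
    slack-yes (no ¬p) X p X≡0 = contradiction p ¬p
    slack-yes (yes _) X p X≡0 = ℤ.i≡j⇒i-j≡0 (trans (at-yes (D s ℤ.* regularCount) (regularCount ℤ.* K s))
      (cong (D s ℤ.*_) (sym (annihilators-0 X X≡0))))

    slack-rankTwo : ∀ {P : Set c} (d : Dec P) X → ¬ P → (∀ i j → conj (X i j) ≡ X j i) → RankAtMost X 2 → NonzeroMinor X → slack d X ≡ 0ℤ
    slack-rankTwo (yes p) X ¬p hX r minor = contradiction p ¬p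
    slack-rankTwo (no _) X ¬p hX r minor = trans (cong (ℤ._- D s ℤ.* annihilators X) (at-no (D s ℤ.* regularCount) (regularCount ℤ.* K s)))
      (rankTwo-slack regularCount (annihilators X) s≡ (annihilators-rankTwo X hX r minor))

    slack-rankOne : ∀ {P : Set c} (d : Dec P) X → ¬ P → (∀ i j → conj (X i j) ≡ X j i) → ¬ NonzeroMinor X →
      (∃ λ k → ∃ λ i → X k i ≢ 0#) → slack d X ≡ regularCount ℤ.* R
    slack-rankOne (yes p) X ¬p hX no-minor (k , i , ne) = contradiction p ¬p
    slack-rankOne (no _) X ¬p hX no-minor (k , i , ne) = trans (cong (ℤ._- D s ℤ.* annihilators X) (at-no (D s ℤ.* regularCount) (regularCount ℤ.* K s)))
      (rankOne-slack regularCount (annihilators X) s≡ (annihilators-rankOne X hX no-minor k i ne))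

    difference-nonzero : ∀ (A B : Mat n) → ¬ (A ≋ B) → ∃ λ k → ∃ λ i → (A -ᴹ B) k i ≢ 0#
    difference-nonzero A B ne = decidable-stable
      (Fin.any? (λ k → Fin.any? (λ i → ¬? ((A -ᴹ B) k i ≟ 0#))))
      λ none → ne λ k i → x-y≡0⇒x≡y (decidable-stable ((A -ᴹ B) k i ≟ 0#) λ ne′ → none (k , i , ne′))

    -- The second component prepares the equality case: rank one would leave the positive slack
    -- `regularCount * R`.
    slack≥0 : ∀ A B → (∀ i j → conj ((A -ᴹ B) i j) ≡ (A -ᴹ B) j i) → RankAtMost (A -ᴹ B) 2 →
      0ℤ ℤ.≤ slack (A ≋? B) (A -ᴹ B) × (slack (A ≋? B) (A -ᴹ B) ≡ 0ℤ → ¬ (A ≋ B) → NonzeroMinor (A -ᴹ B))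
    slack≥0 A B hX r = go (A ≋? B) (nonzeroMinor? (A -ᴹ B))
      where
      VR>0 : 0ℤ ℤ.< regularCount ℤ.* R
      VR>0 = *->0 regularCount>0 R>0
      go : Dec (A ≋ B) → Dec (NonzeroMinor (A -ᴹ B)) →
        0ℤ ℤ.≤ slack (A ≋? B) (A -ᴹ B) × (slack (A ≋? B) (A -ᴹ B) ≡ 0ℤ → ¬ (A ≋ B) → NonzeroMinor (A -ᴹ B))
      go _ (yes minor) = nonneg (A ≋? B) , λ _ _ → minor
        where
        nonneg : (d : Dec (A ≋ B)) → 0ℤ ℤ.≤ slack d (A -ᴹ B)
        nonneg (yes e) = ℤ.≤-reflexive (sym (slack-yes (yes e) (A -ᴹ B) e (λ k l → x≡y⇒x-y≡0 (e k l))))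
        nonneg (no ne) = ℤ.≤-reflexive (sym (slack-rankTwo (no ne) (A -ᴹ B) ne hX r minor))
      go (yes e) (no _) = ℤ.≤-reflexive (sym (slack-yes (A ≋? B) (A -ᴹ B) e (λ k l → x≡y⇒x-y≡0 (e k l)))) ,
        λ _ ne → contradiction e ne
      go (no ne) (no ¬minor) =
        let e = slack-rankOne (A ≋? B) (A -ᴹ B) ne hX ¬minor (difference-nonzero A B ne) in
        subst (0ℤ ℤ.≤_) (sym e) (ℤ.<⇒≤ VR>0) , λ z _ → contradiction (trans (sym e) z) (λ z′ → ℤ.<-irrefl (sym z′) VR>0)

    weighted-mono : ∀ {f g : SquareMatrix n → ℤ} → (∀ B → Regular B → f B ℤ.≤ g B) → weighted f ℤ.≤ weighted g
    weighted-mono {f} {g} le = sum-mono (Enumeration.list (Matrices n)) (λ {B} _ → go B (regular? B))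
      where
      go : ∀ B (d : Dec (Regular B)) → 𝟙 d ℤ.* f B ℤ.≤ 𝟙 d ℤ.* g B
      go B (yes r) = subst₂ ℤ._≤_ (sym (ℤ.*-identityˡ _)) (sym (ℤ.*-identityˡ _)) (le B r)
      go B (no _) = ℤ.≤-refl

    module _ (U : List (Mat n)) (distinct : AllPairs (λ A B → ¬ (A ≋ B)) U)
      (hermitian : ∀ {A} → A ∈ U → ∀ i j → conj (A i j) ≡ A j i)
      (rank≤2 : ∀ {A B} → A ∈ U → B ∈ U → RankAtMost (A -ᴹ B) 2) where

      u : ℤ
      u = sumOver U (λ _ → 1ℤ)

      hermitian-difference : ∀ {A B} → A ∈ U → B ∈ U → ∀ i j → conj ((A -ᴹ B) i j) ≡ (A -ᴹ B) j i
      hermitian-difference A∈ B∈ i j = trans (conj-+ _ _) (cong₂ _+_ (hermitian A∈ i j) (trans (conj-neg _) (cong -_ (hermitian B∈ i j))))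

      ∑∑ : (Mat n → Mat n → ℤ) → ℤ
      ∑∑ f = sumOver U (λ A → sumOver U (f A))

      cauchySchwarz : regularCount ℤ.* (u ℤ.* u) ℤ.≤ Q ℤ.* ∑∑ (λ A B → annihilators (A -ᴹ B))
      cauchySchwarz = begin
        regularCount ℤ.* (u ℤ.* u)
          ≡⟨ weighted-const (u ℤ.* u) ⟨
        weighted (λ _ → u ℤ.* u)
          ≤⟨ weighted-mono (λ M (hM , _) → collisions≥ U (pairing M) (λ {A} A∈ → pairing-fixed M A hM (hermitian A∈))) ⟩
        weighted (λ M → Q ℤ.* sumOver U (λ A → sumOver U (λ B → 𝟙 (pairing M A ≟ pairing M B))))
          ≡⟨ weighted-*ˡ Q _ ⟩
        Q ℤ.* weighted (λ M → sumOver U (λ A → sumOver U (λ B → 𝟙 (pairing M A ≟ pairing M B))))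
          ≡⟨ cong (Q ℤ.*_) (trans (sum-cong U (λ A → weighted-∑ U (λ B M → 𝟙 (pairing M A ≟ pairing M B)))) (weighted-∑ U _)) ⟨
        Q ℤ.* sumOver U (λ A → sumOver U (λ B → weighted (λ M → 𝟙 (pairing M A ≟ pairing M B))))
          ≡⟨ cong (Q ℤ.*_) (sum-cong U (λ A → sum-cong U (λ B → weighted-cong (λ M _ →
               𝟙-cong (pairing M A ≟ pairing M B) (pairing M (A -ᴹ B) ≟ 0#)
                 (λ e → trans (pairing-difference M A B) (x≡y⇒x-y≡0 e)) (λ e → x-y≡0⇒x≡y (trans (sym (pairing-difference M A B)) e)))))) ⟩
        Q ℤ.* ∑∑ (λ A B → annihilators (A -ᴹ B)) ∎
        where
        open ℤ.≤-Reasoning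
        pairing-difference : ∀ M A B → pairing M (A -ᴹ B) ≡ pairing M A + - pairing M B
        pairing-difference M A B = trans (pairing-+ M A (λ i j → - B i j)) (cong (pairing M A +_) (pairing-neg M B))

      ∑∑-target : ∑∑ (λ A B → target (A ≋? B)) ≡ u ℤ.* (D s ℤ.* regularCount) ℤ.+ (u ℤ.* u ℤ.- u) ℤ.* (regularCount ℤ.* K s)
      ∑∑-target = begin
        ∑∑ (λ A B → target (A ≋? B))
          ≡⟨ sum-cong U (λ A → trans (sum-cong U (λ B → split (𝟙 (A ≋? B)) a b)) (trans (sum-+ U (λ _ → b) _)
               (cong₂ ℤ._+_ (sum-const U b) (sum-*ʳ U (a ℤ.- b) (λ B → 𝟙 (A ≋? B)))))) ⟩
        sumOver U (λ A → u ℤ.* b ℤ.+ sumOver U (λ B → 𝟙 (A ≋? B)) ℤ.* (a ℤ.- b))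
          ≡⟨ trans (sum-+ U (λ _ → u ℤ.* b) _) (cong₂ ℤ._+_ (sum-const U (u ℤ.* b)) (sum-*ʳ U (a ℤ.- b) _)) ⟩
        u ℤ.* (u ℤ.* b) ℤ.+ ∑∑ (λ A B → 𝟙 (A ≋? B)) ℤ.* (a ℤ.- b)
          ≡⟨ cong (λ z → u ℤ.* (u ℤ.* b) ℤ.+ z ℤ.* (a ℤ.- b)) (≋-occurrences U distinct) ⟩
        u ℤ.* (u ℤ.* b) ℤ.+ u ℤ.* (a ℤ.- b)
          ≡⟨ collect u a b ⟩
        u ℤ.* a ℤ.+ (u ℤ.* u ℤ.- u) ℤ.* b ∎
        where
        open ≡-Reasoning
        a = D s ℤ.* regularCount
        b = regularCount ℤ.* K s
        split : ∀ d a b → d ℤ.* a ℤ.+ (1ℤ ℤ.- d) ℤ.* b ≡ b ℤ.+ d ℤ.* (a ℤ.- b)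
        split = let open ℤ-Solver in solve 3 (λ d a b → d :* a :+ (con 1ℤ :- d) :* b := b :+ d :* (a :- b)) refl
        collect : ∀ u a b → u ℤ.* (u ℤ.* b) ℤ.+ u ℤ.* (a ℤ.- b) ≡ u ℤ.* a ℤ.+ (u ℤ.* u ℤ.- u) ℤ.* b
        collect = let open ℤ-Solver in solve 3 (λ u a b → u :* (u :* b) :+ u :* (a :- b) := u :* a :+ (u :* u :- u) :* b) refl

      totalSlack : ℤ
      totalSlack = ∑∑ (λ A B → slack (A ≋? B) (A -ᴹ B))

      slackIn : ∀ {A B} → A ∈ U → B ∈ U → 0ℤ ℤ.≤ slack (A ≋? B) (A -ᴹ B)
      slackIn {A} {B} A∈ B∈ = proj₁ (slack≥0 A B (hermitian-difference A∈ B∈) (rank≤2 A∈ B∈))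

      rowSlack≥0 : ∀ {A} → A ∈ U → 0ℤ ℤ.≤ sumOver U (λ B → slack (A ≋? B) (A -ᴹ B))
      rowSlack≥0 A∈ = sum-≥0 U (λ B∈ → slackIn A∈ B∈)

      totalSlack≥0 : 0ℤ ℤ.≤ totalSlack
      totalSlack≥0 = sum-≥0 U rowSlack≥0

      -- Cauchy-Schwarz bounds the total number of annihilators from below; they enter the slack
      -- with a minus sign and the positive factor `D s`.
      totalSlack≤ : Q ℤ.* totalSlack ℤ.≤ u ℤ.* regularCount ℤ.* W ℤ.* (β ℤ.- u)
      totalSlack≤ = begin
        Q ℤ.* totalSlack
          ≡⟨ cong (Q ℤ.*_) (trans (sum-cong U (λ A → trans (sum-minus U _ _) (cong (λ z → sumOver U (λ B → target (A ≋? B)) ℤ.- z) (sum-*ˡ U (D s) _))))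
               (trans (sum-minus U _ _) (cong₂ ℤ._-_ ∑∑-target (sum-*ˡ U (D s) _)))) ⟩
        Q ℤ.* (t ℤ.- D s ℤ.* a)
          ≡⟨ distr Q t (D s) a ⟩
        Q ℤ.* t ℤ.- D s ℤ.* (Q ℤ.* a)
          ≤⟨ ℤ.+-monoʳ-≤ (Q ℤ.* t) (ℤ.neg-mono-≤ (ℤ.*-monoˡ-≤-nonNeg (D s) {{ℤ.nonNegative (ℤ.<⇒≤ Ds>0)}} cauchySchwarz)) ⟩
        Q ℤ.* t ℤ.- D s ℤ.* (regularCount ℤ.* (u ℤ.* u))
          ≡⟨ total-slack regularCount u s≡ ⟩
        u ℤ.* regularCount ℤ.* W ℤ.* (β ℤ.- u) ∎
        where
        open ℤ.≤-Reasoning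
        t = u ℤ.* (D s ℤ.* regularCount) ℤ.+ (u ℤ.* u ℤ.- u) ℤ.* (regularCount ℤ.* K s)
        a = ∑∑ (λ A B → annihilators (A -ᴹ B))
        Ds>0 : 0ℤ ℤ.< D s
        Ds>0 = subst (λ s → 0ℤ ℤ.< D s) (sym s≡) D>0
        distr : ∀ Q t D a → Q ℤ.* (t ℤ.- D ℤ.* a) ≡ Q ℤ.* t ℤ.- D ℤ.* (Q ℤ.* a)
        distr = let open ℤ-Solver in solve 4 (λ Q t D a → Q :* (t :- D :* a) := Q :* t :- D :* (Q :* a)) refl

      -- The estimate for the total slack has a factor u, which must be positive to be cancelled.
      size≤β : 0ℤ ℤ.< u → u ℤ.≤ β
      size≤β u>0 = slack⇒bound (u ℤ.* regularCount ℤ.* W) totalSlack u (*->0 (*->0 u>0 regularCount>0) W>0) totalSlack≥0 totalSlack≤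

      -- At u = β the upper estimate of the total slack is zero. Every row and then every single
      -- slack vanishes, which leaves no difference of rank one.
      extremal-minor : u ≡ β → ∀ {A B} → A ∈ U → B ∈ U → ¬ (A ≋ B) → NonzeroMinor (A -ᴹ B)
      extremal-minor u≡β {A} {B} A∈ B∈ = proj₂ (slack≥0 A B (hermitian-difference A∈ B∈) (rank≤2 A∈ B∈)) slack≡0
        where
        totalSlack≤0 : totalSlack ℤ.≤ 0ℤ
        totalSlack≤0 = extremal⇒slack≤0 (u ℤ.* regularCount ℤ.* W) totalSlack u u≡β totalSlack≤
        rowSlack≡0 : sumOver U (λ B → slack (A ≋? B) (A -ᴹ B)) ≡ 0ℤ
        rowSlack≡0 = sum≡0⇒≡0 U {λ A → sumOver U (λ B → slack (A ≋? B) (A -ᴹ B))} rowSlack≥0 totalSlack≤0 A∈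
        slack≡0 : slack (A ≋? B) (A -ᴹ B) ≡ 0ℤ
        slack≡0 = sum≡0⇒≡0 U {λ B → slack (A ≋? B) (A -ᴹ B)} (λ B∈ → slackIn A∈ B∈) (ℤ.≤-reflexive rowSlack≡0) B∈

-- Translates of U, the closed form of the bound, and the theorem.

open import Data.Nat using (ℕ; _+_; _*_; _∸_; _^_; _≤_; _<_; s≤s; z≤n; >-nonZero)
open import Data.List using (List; length; map)

module RankTransport {c} (q : ℕ) (pp : IsPrimePower q) (F : Field c) (iso : Field.Carrier F ↔ Fin (q ^ 2)) where
  open Field F hiding (_^_) renaming (_+_ to _+ᶠ_; _*_ to _*ᶠ_)
  open Matrices F
  open CodeBound q pp F iso

  independent-resp : ∀ {n k} {X Y : Mat n} (f : Fin k → Fin n) → X ≋ Y → ColumnsIndependent Y f → ColumnsIndependent X f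
  independent-resp f X≋Y ind a e = ind a (λ i → trans (∑-cong (λ j → cong (a j *ᶠ_) (sym (X≋Y i (f j))))) (e i))

  hasRank-resp : ∀ {n k} {X Y : Mat n} → X ≋ Y → HasRank X k → HasRank Y k
  hasRank-resp X≋Y (r , f , ind) = (λ g i → r g (independent-resp g X≋Y i)) ,
    f , independent-resp f (λ i j → sym (X≋Y i j)) ind

  -- Differences within a translate are differences within U, since (A - B) - (A - C) = C - B. This
  -- holds only entrywise, whence the transport of rank along `≋`.
  constantRankDistance : ∀ {n} (U : List (Mat n)) → (∀ {A B} → A ∈ U → B ∈ U → ¬ (A ≋ B) → HasRank (A -ᴹ B) 2) →
    ∀ {A} → A ∈ U → ConstantRankDistance 2 (map (λ B → A -ᴹ B) U)
  constantRankDistance U rank {A} A∈ = pairs , singles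
    where
    open Solver using (solve; _:+_; :-_; _:=_)
    pairs : ∀ {X Y} → X ∈ map (λ B → A -ᴹ B) U → Y ∈ map (λ B → A -ᴹ B) U → ¬ (X ≋ Y) → HasRank (X -ᴹ Y) 2
    pairs X∈ Y∈ X≠Y with ∈-map⁻ (λ B → A -ᴹ B) X∈ | ∈-map⁻ (λ B → A -ᴹ B) Y∈
    ... | B , B∈ , refl | C , C∈ , refl = hasRank-resp
      (λ i j → solve 3 (λ a b c → c :+ :- b := (a :+ :- b) :+ :- (a :+ :- c)) refl (A i j) (B i j) (C i j))
      (rank C∈ B∈ (λ C≋B → X≠Y (λ i j → cong (λ x → A i j +ᶠ - x) (sym (C≋B i j)))))
    singles : ∀ {X} → X ∈ map (λ B → A -ᴹ B) U → ¬ (X ≋ 0ᴹ) → HasRank X 2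
    singles X∈ X≠0 with ∈-map⁻ (λ B → A -ᴹ B) X∈
    ... | B , B∈ , refl = rank A∈ B∈ (λ A≋B → X≠0 (λ i j → x≡y⇒x-y≡0 (A≋B i j)))

-- The truncated subtraction agrees with the integer one because q^k ≤ q^(k+1).
bound-formula : ∀ q k (q>1 : 1 < q) (μ>1 : 1 < q ^ k) →
  BoundArithmetic.β q (q ^ k) q>1 μ>1 ≡ pos (q ^ (2 * suc k ∸ 1) + q ^ suc k ∸ q ^ k)
bound-formula q k q>1 μ>1 = begin
  pos q ℤ.* (pos μ ℤ.* pos μ) ℤ.+ pos q ℤ.* pos μ ℤ.- pos μ
    ≡⟨ cong₂ (λ x y → pos q ℤ.* x ℤ.+ y ℤ.- pos μ) (ℤ.pos-* μ μ) (ℤ.pos-* q μ) ⟨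
  pos q ℤ.* pos (μ * μ) ℤ.+ pos (q ^ suc k) ℤ.- pos μ
    ≡⟨ cong (λ x → x ℤ.+ pos (q ^ suc k) ℤ.- pos μ) (trans (sym (ℤ.pos-* q (μ * μ))) (cong pos power)) ⟩
  pos (q ^ (2 * suc k ∸ 1) + q ^ suc k) ℤ.- pos μ
    ≡⟨ ℤ.m-n≡m⊖n (q ^ (2 * suc k ∸ 1) + q ^ suc k) μ ⟩
  (q ^ (2 * suc k ∸ 1) + q ^ suc k) ℤ.⊖ μ
    ≡⟨ ℤ.⊖-≥ (ℕ.≤-trans (ℕ.m≤n*m μ q) (ℕ.m≤n+m (q ^ suc k) (q ^ (2 * suc k ∸ 1)))) ⟩
  pos (q ^ (2 * suc k ∸ 1) + q ^ suc k ∸ q ^ k) ∎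
  where
  open ≡-Reasoning
  μ = q ^ k
  instance _ = >-nonZero (ℕ.<-trans (s≤s z≤n) q>1)
  power : q * (μ * μ) ≡ q ^ (2 * suc k ∸ 1)
  power = begin
    q * (μ * μ) ≡⟨ ℕ.*-assoc q μ μ ⟨
    q ^ suc k * q ^ k ≡⟨ ℕ.*-comm (q ^ suc k) (q ^ k) ⟩
    q ^ k * q ^ suc k ≡⟨ ℕ.^-distribˡ-+-* q k (suc k) ⟨
    -- `2 * suc k ∸ 1` reduces to `k + (suc k + 0)`, which the last line of the chain has to match.
    q ^ (k + suc k) ≡⟨ cong (λ l → q ^ (k + l)) (ℕ.+-identityʳ (suc k)) ⟨
    q ^ (k + (suc k + 0)) ∎

theorem4p7 : ∀ {c : Level} (q : ℕ) → IsPrimePower q → (F : Field c) → (Field.Carrier F ↔ Fin (q ^ 2)) →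
    (n : ℕ) → 3 ≤ n → (∃ λ m → n ≡ 2 * m + 1) →
    let open Matrices F in
    (U : List (Mat n)) → AllPairs (λ A B → ¬ (A ≋ B)) U → All (Hermitian q) U →
    (∀ {x y} → x ∈ U → y ∈ U → RankAtMost (x -ᴹ y) 2) →
    (length U ≤ q ^ (2 * n ∸ 1) + q ^ n ∸ q ^ (n ∸ 1))
    × (length U ≡ q ^ (2 * n ∸ 1) + q ^ n ∸ q ^ (n ∸ 1) →
    ∀ {A} → A ∈ U → ConstantRankDistance 2 (map (λ B → A -ᴹ B) U))
theorem4p7 {c} q pp F iso (suc (suc n₂)) (s≤s (s≤s _)) (k , n≡2k+1) U distinct hermitian rank≤2 =
  size (length U) refl ,
  λ |U|≡bound → constantRankDistance U λ {A} {B} A∈ B∈ A≠B →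
    rank≤2 A∈ B∈ , minor⇒independent (A -ᴹ B)
      (extremal-minor U distinct hermitian′ rank≤2 (trans (sum-length U) (trans (cong pos |U|≡bound) (sym β≡))) A∈ B∈ A≠B)
  where
  open Matrices F
  open CodeBound q pp F iso
  open RankTransport q pp F iso using (constantRankDistance)

  odd : gaussSum (suc n₂) ≡ pos (q ^ suc n₂)
  odd = subst (λ j → gaussSum j ≡ pos (q ^ j)) (ℕ.suc-injective (trans (ℕ.+-comm 1 (2 * k)) (sym n≡2k+1))) (gaussSum-even k)

  open Code n₂ odd
  open BoundArithmetic q (q ^ suc n₂) q>1 μ>1 using (β)

  β≡ : β ≡ pos (q ^ (2 * suc (suc n₂) ∸ 1) + q ^ suc (suc n₂) ∸ q ^ suc n₂)
  β≡ = bound-formula q (suc n₂) q>1 μ>1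

  hermitian′ : ∀ {A} → A ∈ U → ∀ i j → conj (A i j) ≡ A j i
  hermitian′ A∈ i j = All.lookup hermitian A∈ j i

  -- The empty list is separated because `size≤β` requires a positive size.
  size : ∀ l → length U ≡ l → length U ≤ q ^ (2 * suc (suc n₂) ∸ 1) + q ^ suc (suc n₂) ∸ q ^ suc n₂
  size zero    e = subst (_≤ q ^ (2 * suc (suc n₂) ∸ 1) + q ^ suc (suc n₂) ∸ q ^ suc n₂) (sym e) z≤n
  size (suc l) e = ℤ.drop‿+≤+ (subst₂ ℤ._≤_ (sum-length U) β≡
    (size≤β U distinct hermitian′ rank≤2 (subst (0ℤ ℤ.<_) (sym (trans (sum-length U) (cong pos e))) (ℤ.+<+ (s≤s z≤n)))))
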